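{- For each $\mathfrak{s}=(s_{1},\ldots,s_{r})\in\mathbb{N}^{r}$, the following identity holds in $\mathcal{A}_{k}$: \[ \zeta_{\mathcal{A}_{k}}(\mathfrak{s})=\frac{1}{\Gamma_{\mathfrak{s}}}\sum_{\mathbf{j}\in J_{\mathfrak{s}}}a_{\mathbf{j}}(\theta)\,\mathrm{Li}_{\mathcal{A}_{k},\mathfrak{s}}(\mathbf{u}_{\mathbf{j}}). \]
   Context: Let $\mathbb{F}_{q}$ be the finite field with $q$ elements, $A:=\mathbb{F}_{q}[\theta]$, $k:=\mathbb{F}_q(\theta)$. Define the $k$-algebra $\mathcal{A}_{k}:=\prod_{P}A/(P)\big/\bigoplus_{P}A/(P)$, $P$ running over all monic irreducible polynomials of $A$ (an element of $k$ acts componentwise via its reduction mod $P$ for all but finitely many $P$). Finite multiple zeta values: for $\mathfrak{s}=(s_{1},\ldots,s_{r})\in\mathbb{N}^{r}$ ($\mathbb{N}$ = positive integers) and $P$ monic irreducible, $\zeta_{\mathcal{A}_{k}}(\mathfrak{s})_{P}:=\sum \frac{1}{a_{1}^{s_{1}}\cdots a_{r}^{s_{r}}}\bmod P$, summed over monic $a_{1},\ldots,a_{r}\in A$ with $\deg P>\deg a_{1}>\cdots>\deg a_{r}$, and $\zeta_{\mathcal{A}_{k}}(\mathfrak{s}):=(\zeta_{\mathcal{A}_{k}}(\mathfrak{s})_{P})_P\in\mathcal{A}_{k}$. Finite Carlitz multiple polylogarithms: let $L_{0}:=1$ and $L_{i}:=(\theta-\theta^{q})(\theta-\theta^{q^2})\cdots(\theta-\theta^{q^{i}})$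 for $i\ge1$. For $\mathbf{u}=(u_{1},\ldots,u_{r})\in k^{r}$ and $P$ not dividing the denominators of the $u_i$, set $\mathrm{Li}_{\mathcal{A}_{k},\mathfrak{s}}(\mathbf{u})_{P}:=\sum_{\deg P>i_{1}>\cdots>i_{r}\ge0}\frac{u_{1}^{q^{i_{1}}}\cdots u_{r}^{q^{i_{r}}}}{L_{i_{1}}^{s_{1}}\cdots L_{i_{r}}^{s_{r}}}\bmod P\in A/(P)$ (well defined since $P\nmid L_i$ for $i<\deg P$), and $\mathrm{Li}_{\mathcal{A}_{k},\mathfrak{s}}(\mathbf{u}):=(\mathrm{Li}_{\mathcal{A}_{k},\mathfrak{s}}(\mathbf{u})_P)_P\in\mathcal{A}_k$. Anderson–Thakur polynomials: let $t,x,y$ be independent variables. Put $G_{0}(y):=1$ and $G_{n}(y):=\prod_{i=1}^{n}(t^{q^{n}}-y^{q^{i}})\in\mathbb{F}_q[t,y]$ for $n\ge1$. Let $D_{0}:=1$ and $D_{i}:=\prod_{j=0}^{i-1}(\theta^{q^{i}}-\theta^{q^{j}})$ for $i\ge1$. For $n\ge0$ with base-$q$ expansion $n=\sum n_{i}q^{i}$ ($0\le n_i\le q-1$), define the Carlitz factorial $\Gamma_{n+1}:=\prod_i D_{i}^{n_{i}}\in A$. The Anderson–Thakur polynomials $H_{n}\in A[t]$ ($n\ge0$) are defined by \[\Big(1-\sum_{i=0}^{\infty}\frac{G_{i}(\theta)}{D_{i}|_{\theta=t}}x^{q^{i}}\Big)^{ -1}=\sum_{n=0}^{\infty}\frac{H_{n}}{\Gamma_{n+1}|_{\theta=t}}x^{n}.\]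 Data attached to $\mathfrak{s}$: for each $1\le i\le r$ write $H_{s_{i}-1}=\sum_{j=0}^{m_{i}}u_{ij}t^{j}$ with $u_{ij}\in A$ and $u_{im_{i}}\neq0$. Let $J_{\mathfrak{s}}:=\{0,\ldots,m_{1}\}\times\cdots\times\{0,\ldots,m_{r}\}$; for $\mathbf{j}=(j_{1},\ldots,j_{r})\in J_{\mathfrak{s}}$ set $\mathbf{u}_{\mathbf{j}}:=(u_{1j_{1}},\ldots,u_{rj_{r}})\in A^{r}$ and $a_{\mathbf{j}}(t):=t^{j_{1}+\cdots+j_{r}}$, so $a_{\mathbf{j}}(\theta)=\theta^{j_1+\cdots+j_r}$. Finally $\Gamma_{\mathfrak{s}}:=\Gamma_{s_{1}}\cdots\Gamma_{s_{r}}\in A$. -}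

module Defs where

open import Data.Bool using (Bool; true; false; if_then_else_)
open import Data.Nat as ℕ using (ℕ; zero; suc; _∸_; _<ᵇ_; _≤ᵇ_; NonZero)
open import Data.Nat.DivMod using (_/_; _%_)
open import Data.List using (List; []; _∷_; _++_; [_]; map; foldr; length; replicate; filter; concatMap; upTo; lookup; zip)
open import Data.List.Properties using (≡-dec)
open import Data.List.Membership.Propositional using (_∈_)
open import Data.List.Relation.Unary.Unique.Propositional using (Unique)
open import Data.Product using (_×_; _,_; proj₁; proj₂)
open import Data.Sum using (_⊎_)
open import Relation.Nullary using (¬_; does)
open import Relation.Binary.Definitions using (DecidableEquality)
open import Relation.Binary.PropositionalEquality using (_≡_; _≢_)
open import Algebra.Structures using (IsCommutativeRing)

record FiniteField : Set₁ where
  field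
    Carrier   : Set
    _≟_       : DecidableEquality Carrier
    0# 1#     : Carrier
    _+_ _*_   : Carrier → Carrier → Carrier
    -_        : Carrier → Carrier
    isCommutativeRing : IsCommutativeRing _≡_ _+_ _*_ -_ 0# 1#
    _⁻¹       : Carrier → Carrier
    inverseʳ  : ∀ x → x ≢ 0# → x * (x ⁻¹) ≡ 1#
    0≢1       : 0# ≢ 1#
    elems     : List Carrier
    complete  : ∀ x → x ∈ elems
    unique    : Unique elems

-- Polynomials over a (raw) commutative ring with decidable equality,
-- as coefficient lists, lowest degree first.  All operations return
-- normalised lists (no trailing zero coefficients), so propositional
-- equality of normalised lists is equality of polynomials.

module PolyOps {C : Set} (_≟_ : DecidableEquality C) (0# 1# : C)
               (_+_ _*_ : C → C → C) (-_ : C → C) where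

  Poly : Set
  Poly = List C

  private
    cons : C → Poly → Poly
    cons c [] = if does (c ≟ 0#) then [] else [ c ]
    cons c (x ∷ xs) = c ∷ x ∷ xs

    addRaw : Poly → Poly → Poly
    addRaw [] q = q
    addRaw (a ∷ p) [] = a ∷ p
    addRaw (a ∷ p) (b ∷ q) = (a + b) ∷ addRaw p q

    mulRaw : Poly → Poly → Poly
    mulRaw [] q = []
    mulRaw (a ∷ p) q = addRaw (map (a *_) q) (0# ∷ mulRaw p q)

  norm : Poly → Poly
  norm [] = []
  norm (c ∷ p) = cons c (norm p)

  infixl 6 _⊕_ _⊖_
  infixl 7 _⊗_

  _⊕_ : Poly → Poly → Poly
  p ⊕ q = norm (addRaw p q)

  neg : Poly → Poly
  neg p = norm (map -_ p)

  _⊖_ : Poly → Poly → Poly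
  p ⊖ q = p ⊕ neg q

  _⊗_ : Poly → Poly → Poly
  p ⊗ q = norm (mulRaw p q)

  zeroP oneP : Poly
  zeroP = []
  oneP = norm [ 1# ]

  const : C → Poly
  const c = norm [ c ]

  monomial : C → ℕ → Poly
  monomial c n = norm (replicate n 0# ++ [ c ])

  X^ : ℕ → Poly
  X^ n = monomial 1# n

  sumP : List Poly → Poly
  sumP = foldr _⊕_ zeroP

  prodP : List Poly → Poly
  prodP = foldr _⊗_ oneP

  _^P_ : Poly → ℕ → Poly
  p ^P zero = oneP
  p ^P suc n = p ⊗ (p ^P n)

  -- degree (of the normalised polynomial; deg 0 := 0)
  deg : Poly → ℕ
  deg p = length (norm p) ∸ 1

  lead : Poly → C
  lead p = go (norm p)
    where
    go : Poly → C
    go [] = 0#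
    go (c ∷ []) = c
    go (c ∷ d ∷ ds) = go (d ∷ ds)

  Monic : Poly → Set
  Monic p = (norm p ≡ p) × (lead p ≡ 1#)

  -- Euclidean division by a monic polynomial m (long division;
  -- fuel = length of the dividend suffices when m is monic).
  private
    divGo : Poly → ℕ → Poly → Poly → Poly × Poly
    divGo m zero qt r = qt , r
    divGo m (suc f) qt r =
      if length r <ᵇ length m then (qt , r)
      else divGo m f (qt ⊕ mon) (r ⊖ (mon ⊗ m))
      where
      mon : Poly
      mon = monomial (lead r) (length r ∸ length m)

  divMod : Poly → Poly → Poly × Poly
  divMod p m = divGo m (length p) zeroP (norm p)

  quot : Poly → Poly → Poly
  quot p m = proj₁ (divMod p m)

  _modP_ : Poly → Poly → Poly
  p modP m = proj₂ (divMod p m)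

module Setup (F : FiniteField) where
  open FiniteField F

  q : ℕ
  q = length elems

  module PA = PolyOps _≟_ 0# 1# _+_ _*_ -_
  open PA public using () renaming (Poly to A)
  open PA

  module PAt = PolyOps (≡-dec _≟_) zeroP oneP _⊕_ _⊗_ neg
  open PAt public using () renaming (Poly to At)

  θ : A
  θ = X^ 1

  L : ℕ → A
  L i = prodP (map (λ l → θ ⊖ (θ ^P (q ℕ.^ suc l))) (upTo i))

  D : ℕ → A
  D i = prodP (map (λ j → (θ ^P (q ℕ.^ i)) ⊖ (θ ^P (q ℕ.^ j))) (upTo i))

  digitsF : ℕ → ℕ → List ℕ
  digitsF zero n = []
  digitsF (suc f) n with q
  ... | zero = []
  ... | suc q' = (n % suc q') ∷ digitsF f (n / suc q')

  digits : ℕ → List ℕ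
  digits n = digitsF (suc n) n

  ΓS : ℕ → A
  ΓS n = prodP (map (λ p → D (proj₁ p) ^P proj₂ p) (zip (upTo (length (digits n))) (digits n)))

  Γ : ℕ → A
  Γ s = ΓS (s ∸ 1)

  θ↦t : A → At
  θ↦t a = PAt.norm (map const a)

  cA : A → At
  cA = PAt.const

  Gθ : ℕ → At
  Gθ i = PAt.prodP (map (λ l → PAt._⊖_ (PAt.X^ (q ℕ.^ i)) (cA (θ ^P (q ℕ.^ suc l)))) (upTo i))

  -- Coefficients b_n of (1 - Σ_i G_i(θ)/D_i(t) x^{q^i})^{-1} as fractions
  -- N_n / Δ_n with N_n ∈ A[t], Δ_n ∈ F_q[t] monic, via the recursion
  -- b_0 = 1, b_n = Σ_{q^i ≤ n} (G_i(θ)/D_i(t)) b_{n - q^i}.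
  Frac : Set
  Frac = At × At

  look : List Frac → ℕ → Frac
  look [] k = PAt.oneP , PAt.oneP
  look (x ∷ xs) zero = x
  look (x ∷ xs) (suc k) = look xs k

  step : ℕ → List Frac → Frac
  step n tbl = N , Δ
    where
    I : List ℕ
    I = filter (λ i → (q ℕ.^ i) ℕ.≤? n) (upTo (suc n))
    dd : ℕ → At
    dd i = PAt._⊗_ (θ↦t (D i)) (proj₂ (look tbl (n ∸ q ℕ.^ i)))
    Δ : At
    Δ = PAt.prodP (map dd I)
    N : At
    N = PAt.sumP (map (λ i → PAt._⊗_ (PAt._⊗_ (Gθ i) (proj₁ (look tbl (n ∸ q ℕ.^ i))))
                                   (PAt.prodP (map dd (filter (λ j → Relation.Nullary.¬? (j ℕ.≟ i)) I)))) I)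

  table : ℕ → List Frac
  table zero = [ (PAt.oneP , PAt.oneP) ]
  table (suc n) = table n ++ [ step (suc n) (table n) ]

  -- Anderson–Thakur polynomial H_n = Γ_{n+1}(t) · b_n  (exact division)
  H : ℕ → At
  H n = PAt.quot (PAt._⊗_ (θ↦t (ΓS n)) (proj₁ b)) (proj₂ b)
    where
    b : Frac
    b = look (table n) n

  uCoeffs : ℕ → List A
  uCoeffs s = H (s ∸ 1)

  -- J_𝔰 together with u_𝐣 : all tuples (j_1,u_{1j_1}), ..., (j_r,u_{rj_r})
  tuples : List (List A) → List (List (ℕ × A))
  tuples [] = [ [] ]
  tuples (us ∷ uss) =
    concatMap (λ ju → map (ju ∷_) (tuples uss)) (zip (upTo (length us)) us)

  Γ𝔰 : List ℕ → A
  Γ𝔰 𝔰 = prodP (map Γ 𝔰)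

  vecs : ℕ → List (List Carrier)
  vecs zero = [ [] ]
  vecs (suc n) = concatMap (λ c → map (c ∷_) (vecs n)) elems

  monics : ℕ → List A
  monics d = map (λ v → v ++ [ 1# ]) (vecs d)

  Irreducible : A → Set
  Irreducible P = Monic P × (1 ℕ.≤ deg P) ×
                  (∀ a b → a ⊗ b ≡ P → (deg a ≡ 0) ⊎ (deg b ≡ 0))

  -- Arithmetic in A/(P), P monic; elements represented by polynomials.
  module ModP (P : A) where
    red : A → A
    red x = x modP P

    _≈P_ : A → A → Set
    x ≈P y = red (x ⊖ y) ≡ zeroP

    _·_ : A → A → A
    x · y = red (x ⊗ y)

    pow : A → ℕ → A
    pow x zero = red oneP
    pow x (suc n) = x · pow x n

    Σ : List A → A
    Σ xs = red (sumP xs)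

    residues : List A
    residues = map norm (vecs (deg P))

    -- inverse of a modulo P (the unique residue b with b·a ≡ 1;
    -- 0 if none exists, which does not happen when P ∤ a, P irreducible)
    inv : A → A
    inv a = go residues
      where
      go : List A → A
      go [] = zeroP
      go (b ∷ bs) = if does (≡-dec _≟_ (b · a) (red oneP)) then b else go bs

    zetaB : ℕ → List ℕ → A
    zetaB b [] = red oneP
    zetaB b (s ∷ ss) =
      Σ (concatMap (λ d → map (λ a → pow (inv a) s · zetaB d ss) (monics d)) (upTo b))

    zeta : List ℕ → A
    zeta 𝔰 = zetaB (deg P) 𝔰

    liB : ℕ → List ℕ → List A → A
    liB b [] _ = red oneP
    liB b (s ∷ ss) [] = zeroP
    liB b (s ∷ ss) (u ∷ us) =
      Σ (map (λ i → (pow u (q ℕ.^ i) · pow (inv (L i)) s) · liB i ss us) (upTo b))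

    Li : List ℕ → List A → A
    Li 𝔰 𝐮 = liB (deg P) 𝔰 𝐮

    rhs : List ℕ → A
    rhs 𝔰 = inv (Γ𝔰 𝔰) ·
      Σ (map (λ ju → pow θ (foldr ℕ._+_ 0 (map proj₁ ju)) · Li 𝔰 (map proj₂ ju))
             (tuples (map uCoeffs 𝔰)))

{-# OPTIONS --safe #-}
-- Let S_d(s) be the sum of 1/a^s over the monic a of degree d.  Everything reduces to the Anderson–Thakur identity
--   Γ_s L_d^s S_d(s) = ∑_j u_j^{q^d} θ^j,  where H_{s-1} = ∑_j u_j t^j,
-- which is needed only modulo primes P with deg P ≥ s and deg P > d; the theorem follows on expanding both nested
-- sums by their outermost index.  Put e_d(y) = ∏ (y − a) over deg a < d.  It is additive, e_d(θ^d) = D_d, and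
-- ∑_{deg a < d} 1/(y + a) = e_d′/e_d(y), where e_d′ = D_d/L_d is its linear coefficient.  Taking y = θ^d − L_d x in
-- (A/P)[[x]] gives
--   ∑_n L_d^{n+1} S_d(n+1) x^n = 1/(1 − e_d(L_d x)/D_d) = 1/(1 − ∑_i (G_i^{(d)}(θ)|_{t=θ}/D_i) x^{q^i}),
-- which is the image of the generating function of the H_n/Γ_{n+1}(t) under the ring homomorphism A[t] → A/P that
-- raises the coefficients to the power q^d and sends t to θ.
-- The divisions defining H_n are exact because D_i Γ_{n+1−q^i} divides Γ_{n+1} whenever q^i ≤ n.
module Submission where

open import Defs
open import Level using (0ℓ)
open import Data.Bool using (true; false; if_then_else_; T)
open import Data.Empty using (⊥-elim)
open import Data.Unit using (⊤; tt)
open import Data.Nat as ℕ using (ℕ; zero; suc; _≤_; _<_; z≤n; s≤s; _∸_; _<ᵇ_; NonZero)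
import Data.Nat.Properties as ℕP
open import Data.Nat.DivMod using (_/_; _%_)
import Data.Nat.DivMod as ℕD
import Data.Nat.Divisibility as ℕDiv
open import Data.Nat.Induction using (<-rec)
open import Data.Nat.Combinatorics using (_C_; nCn≡1)
open import Data.Integer as ℤ using (ℤ; -[1+_])
import Data.Integer.Properties as ℤP
open import Data.Sign as Sign using (Sign)
open import Data.Fin using (toℕ)
import Data.Maybe
open import Data.List using (List; []; _∷_; _++_; [_]; _∷ʳ_; map; foldr; length; replicate; filter; concatMap; upTo; applyUpTo; zip)
import Data.List.Properties as LP
open import Data.List.Membership.Propositional using (_∈_; _∉_; lose)
import Data.List.Membership.Propositional.Properties as ∈P
open import Data.List.Relation.Unary.Any using (here; there)
open import Data.List.Relation.Unary.All as All using (All; []; _∷_)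
import Data.List.Relation.Unary.All.Properties as AllP
import Data.List.Relation.Unary.AllPairs as AllPairs
open import Data.List.Relation.Unary.Unique.Propositional using (Unique)
import Data.List.Relation.Unary.Unique.Propositional.Properties as UniqueP
open import Data.List.Relation.Binary.Permutation.Propositional using (_↭_; ↭-sym; ↭-trans; ↭-reflexive)
import Data.List.Relation.Binary.Permutation.Propositional as Perm
import Data.List.Relation.Binary.Permutation.Propositional.Properties as PermP
import Data.List.Relation.Binary.Permutation.Setoid.Properties as PermS
open import Data.List.Relation.Binary.BagAndSetEquality using (∼bag⇒↭)
open import Data.List.Membership.Propositional.Properties.WithK using (unique∧set⇒bag)
open import Data.Product using (Σ; ∃; _×_; _,_; proj₁; proj₂)
open import Data.Sum using (inj₁; inj₂)
open import Function using (_∘_; id; mk⇔; _∋_)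
open import Relation.Nullary using (¬_; Dec; yes; no; does; ¬?)
open import Relation.Nullary.Decidable using (dec-true; dec-false; dec⇒maybe)
open import Relation.Binary.Definitions using (DecidableEquality)
open import Relation.Binary.PropositionalEquality as ≡ using (_≡_; _≢_)
open import Algebra.Bundles using (CommutativeRing; CommutativeMonoid)
import Algebra.Solver.Ring
open import Algebra.Solver.Ring.AlmostCommutativeRing using (fromCommutativeRing; _-Raw-AlmostCommutative⟶_)
import Algebra.Properties.Ring
import Algebra.Properties.Semiring.Mult
import Algebra.Properties.Semiring.Mult.TCOptimised
import Algebra.Properties.Semiring.Sum
import Algebra.Properties.CommutativeSemiring.Exp
import Algebra.Properties.CommutativeSemiring.Binomial
import Relation.Binary.Reasoning.Setoid

-- The computation lives in A/(P) itself, where D_i, L_i and Γ become units only for small indices.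
-- Fractions therefore occur either through given inverses or cross-multiplied, and e_d is set up by
-- the recursion e_{d+1} = e_d^q - D_d^(q-1) e_d, which makes sense in every algebra over the finite
-- field. That development is instantiated twice, over A/(P) and over the power series ring above
-- it. The value of e_d at L_d x is found by induction on d: with φ_d(x) the sum of the
-- (G_i^{(d)}/D_i) x^{q^i}, both e_d(L_d x) and D_d φ_d(x) obey the same recursion, in which a q-th
-- power minus its base appears. The bound deg P ≥ s comes from the D_i that enter the coefficient
-- of index n = s - 1: q^i ≤ n gives i < q^i ≤ n < deg P, so these D_i are units. A second obstacle
-- is that H is computed by long division of one unreduced fraction of coefficient lists. The
-- equation H_n · Den_n = Γ_{n+1}(t) · Num_n, with Den_n monic, is the bridge from that computation
-- to the algebra.

-- Finite sums and products over lists, in a commutative monoid.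

module Fold (M : CommutativeMonoid 0ℓ 0ℓ) where
  open CommutativeMonoid M
  open Relation.Binary.Reasoning.Setoid setoid

  private variable
    X Y : Set

  fold : List X → (X → Carrier) → Carrier
  fold []       f = ε
  fold (x ∷ xs) f = f x ∙ fold xs f

  fold-cong-∈ : ∀ (xs : List X) {f g} → (∀ {x} → x ∈ xs → f x ≈ g x) → fold xs f ≈ fold xs g
  fold-cong-∈ []       e = refl
  fold-cong-∈ (x ∷ xs) e = ∙-cong (e (here ≡.refl)) (fold-cong-∈ xs (e ∘ there))

  fold-cong : ∀ (xs : List X) {f g} → (∀ x → f x ≈ g x) → fold xs f ≈ fold xs g
  fold-cong xs e = fold-cong-∈ xs (λ {x} _ → e x)

  fold-ε : ∀ (xs : List X) → fold xs (λ _ → ε) ≈ ε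
  fold-ε []       = refl
  fold-ε (x ∷ xs) = trans (identityˡ _) (fold-ε xs)

  fold-++ : ∀ (xs ys : List X) {f} → fold (xs ++ ys) f ≈ fold xs f ∙ fold ys f
  fold-++ []       ys = sym (identityˡ _)
  fold-++ (x ∷ xs) ys = trans (∙-congˡ (fold-++ xs ys)) (sym (assoc _ _ _))

  fold-map : ∀ (g : X → Y) xs {f} → fold (map g xs) f ≈ fold xs (f ∘ g)
  fold-map g []       = refl
  fold-map g (x ∷ xs) = ∙-congˡ (fold-map g xs)

  fold-concatMap : ∀ (g : X → List Y) xs {f} → fold (concatMap g xs) f ≈ fold xs (λ x → fold (g x) f)
  fold-concatMap g []       = refl
  fold-concatMap g (x ∷ xs) = trans (fold-++ (g x) (concatMap g xs)) (∙-congˡ (fold-concatMap g xs))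

  foldr≈fold : ∀ (xs : List Carrier) → foldr _∙_ ε xs ≈ fold xs id
  foldr≈fold []       = refl
  foldr≈fold (x ∷ xs) = ∙-congˡ (foldr≈fold xs)

  interchange : ∀ a b c d → (a ∙ b) ∙ (c ∙ d) ≈ (a ∙ c) ∙ (b ∙ d)
  interchange a b c d = begin
    (a ∙ b) ∙ (c ∙ d) ≈⟨ assoc a b (c ∙ d) ⟩
    a ∙ (b ∙ (c ∙ d)) ≈⟨ ∙-congˡ (sym (assoc b c d)) ⟩
    a ∙ ((b ∙ c) ∙ d) ≈⟨ ∙-congˡ (∙-congʳ (comm b c)) ⟩
    a ∙ ((c ∙ b) ∙ d) ≈⟨ ∙-congˡ (assoc c b d) ⟩
    a ∙ (c ∙ (b ∙ d)) ≈⟨ sym (assoc a c (b ∙ d)) ⟩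
    (a ∙ c) ∙ (b ∙ d) ∎

  fold-∙ : ∀ (xs : List X) f g → fold xs (λ x → f x ∙ g x) ≈ fold xs f ∙ fold xs g
  fold-∙ []       f g = sym (identityˡ _)
  fold-∙ (x ∷ xs) f g = trans (∙-congˡ (fold-∙ xs f g)) (interchange _ _ _ _)

  fold-swap : ∀ (xs : List X) (ys : List Y) (f : X → Y → Carrier) →
              fold xs (λ x → fold ys (f x)) ≈ fold ys (λ y → fold xs (λ x → f x y))
  fold-swap []       ys f = sym (fold-ε ys)
  fold-swap (x ∷ xs) ys f = trans (∙-congˡ (fold-swap xs ys f)) (sym (fold-∙ ys (f x) _))

  fold-↭ : ∀ {xs ys : List X} {f} → xs ↭ ys → fold xs f ≈ fold ys f
  fold-↭ Perm.refl         = refl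
  fold-↭ (Perm.prep x p)   = ∙-congˡ (fold-↭ p)
  fold-↭ {f = f} (Perm.swap {xs} {ys} x y p) = begin
    f x ∙ (f y ∙ fold xs f) ≈⟨ sym (assoc _ _ _) ⟩
    (f x ∙ f y) ∙ fold xs f ≈⟨ ∙-cong (comm _ _) (fold-↭ p) ⟩
    (f y ∙ f x) ∙ fold ys f ≈⟨ assoc _ _ _ ⟩
    f y ∙ (f x ∙ fold ys f) ∎
  fold-↭ (Perm.trans p q)  = trans (fold-↭ p) (fold-↭ q)

  fold-applyUpTo : ∀ (g : ℕ → X) n {f} → fold (applyUpTo g n) f ≈ fold (upTo n) (f ∘ g)
  fold-applyUpTo g n {f} = trans (reflexive (≡.cong (λ l → fold l f) (≡.sym (LP.map-upTo g n)))) (fold-map g (upTo n))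

  fold-upTo-head : ∀ n f → fold (upTo (suc n)) f ≈ f 0 ∙ fold (upTo n) (f ∘ suc)
  fold-upTo-head n f = ∙-congˡ (fold-applyUpTo suc n)

  fold-upTo-last : ∀ n f → fold (upTo (suc n)) f ≈ fold (upTo n) f ∙ f n
  fold-upTo-last n f = begin
    fold (upTo (suc n)) f  ≈⟨ reflexive (≡.cong (λ l → fold l f) (≡.sym (LP.upTo-∷ʳ n))) ⟩
    fold (upTo n ∷ʳ n) f  ≈⟨ fold-++ (upTo n) [ n ] ⟩
    fold (upTo n) f ∙ (f n ∙ ε)  ≈⟨ ∙-congˡ (identityʳ _) ⟩
    fold (upTo n) f ∙ f n  ∎

  fold-upTo-truncate : ∀ m k f → (∀ i → m ≤ i → f i ≈ ε) → fold (upTo (k ℕ.+ m)) f ≈ fold (upTo m) f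
  fold-upTo-truncate m zero    f v = refl
  fold-upTo-truncate m (suc k) f v = begin
    fold (upTo (suc (k ℕ.+ m))) f  ≈⟨ fold-upTo-last (k ℕ.+ m) f ⟩
    fold (upTo (k ℕ.+ m)) f ∙ f (k ℕ.+ m)  ≈⟨ ∙-cong (fold-upTo-truncate m k f v) (v _ (ℕP.m≤n+m m k)) ⟩
    fold (upTo m) f ∙ ε  ≈⟨ identityʳ _ ⟩
    fold (upTo m) f  ∎

  -- Uniqueness makes the filter drop a single occurrence. This splits the common denominator of a
  -- step of `table` into one denominator and its cofactor.
  fold-extract : ∀ {xs : List ℕ} {i} → Unique xs → i ∈ xs → ∀ f →
                 fold xs f ≈ f i ∙ fold (filter (λ j → ¬? (j ℕ.≟ i)) xs) f
  fold-extract {x ∷ xs} {i} (x∉ AllPairs.∷ u) (here ≡.refl) f = ∙-congˡ (reflexive (≡.cong (λ l → fold l f) (≡.sym kept)))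
    where
    kept : filter (λ j → ¬? (j ℕ.≟ x)) (x ∷ xs) ≡ xs
    kept = ≡.trans (LP.filter-reject (λ j → ¬? (j ℕ.≟ x)) (λ x≢x → x≢x ≡.refl))
                   (LP.filter-all (λ j → ¬? (j ℕ.≟ x)) (All.map (λ x≢j j≡x → x≢j (≡.sym j≡x)) x∉))
  fold-extract {x ∷ xs} {i} (x∉ AllPairs.∷ u) (there i∈) f = begin
    f x ∙ fold xs f  ≈⟨ ∙-congˡ (fold-extract u i∈ f) ⟩
    f x ∙ (f i ∙ rest)  ≈⟨ sym (assoc _ _ _) ⟩
    (f x ∙ f i) ∙ rest  ≈⟨ ∙-congʳ (comm _ _) ⟩
    (f i ∙ f x) ∙ rest  ≈⟨ assoc _ _ _ ⟩
    f i ∙ (f x ∙ rest)  ≈⟨ ∙-congˡ (reflexive (≡.cong (λ l → fold l f) (LP.filter-accept (λ j → ¬? (j ℕ.≟ i)) (All.lookup x∉ i∈)))) ⟨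
    f i ∙ fold (filter (λ j → ¬? (j ℕ.≟ i)) (x ∷ xs)) f ∎
    where
    rest : Carrier
    rest = fold (filter (λ j → ¬? (j ℕ.≟ i)) xs) f

-- A ring solver with integer coefficients, whose equality is decidable.

module IntegerSolver (R : CommutativeRing 0ℓ 0ℓ) where
  open CommutativeRing R
  open Algebra.Properties.Ring ring using (-0#≈0#; -‿distribˡ-*; -‿distribʳ-*; -‿involutive; -‿+-comm)
  open Algebra.Properties.Semiring.Mult.TCOptimised semiring using (1+×; ×-homo-+; ×1-homo-*) renaming (_×_ to _×ⁿ_)
  open Relation.Binary.Reasoning.Setoid setoid

  private
    signed : Sign → Carrier → Carrier
    signed Sign.+ x = x
    signed Sign.- x = - x

    signed-cong : ∀ s {x y} → x ≈ y → signed s x ≈ signed s y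
    signed-cong Sign.+ e = e
    signed-cong Sign.- e = -‿cong e

    signed-* : ∀ s t x y → signed (s Sign.* t) (x * y) ≈ signed s x * signed t y
    signed-* Sign.+ Sign.+ x y = refl
    signed-* Sign.+ Sign.- x y = -‿distribʳ-* x y
    signed-* Sign.- Sign.+ x y = -‿distribˡ-* x y
    signed-* Sign.- Sign.- x y = begin
      x * y  ≈⟨ -‿involutive (x * y) ⟨
      - - (x * y)  ≈⟨ -‿cong (-‿distribˡ-* x y) ⟩
      - (- x * y)  ≈⟨ -‿distribʳ-* (- x) y ⟩
      - x * - y  ∎

    -- With the optimised multiple, `int` sends 1 to `1#` definitionally, so the solver constants
    -- `:0#` and `:1#` match the goals on the nose.
    int : ℤ → Carrier
    int (ℤ.+ n)    = n ×ⁿ 1#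
    int -[1+ n ] = - (suc n ×ⁿ 1#)

    int-◃ : ∀ s n → int (s ℤ.◃ n) ≈ signed s (n ×ⁿ 1#)
    int-◃ Sign.+ zero    = refl
    int-◃ Sign.- zero    = sym -0#≈0#
    int-◃ Sign.+ (suc n) = refl
    int-◃ Sign.- (suc n) = refl

    int-sign : ∀ i → int i ≈ signed (ℤ.sign i) (ℤ.∣ i ∣ ×ⁿ 1#)
    int-sign (ℤ.+ n)    = refl
    int-sign -[1+ n ] = refl

    int-* : ∀ i j → int (i ℤ.* j) ≈ int i * int j
    int-* i j = begin
      int (s Sign.* t ℤ.◃ m ℕ.* n)  ≈⟨ int-◃ (s Sign.* t) (m ℕ.* n) ⟩
      signed (s Sign.* t) ((m ℕ.* n) ×ⁿ 1#)  ≈⟨ signed-cong (s Sign.* t) (×1-homo-* m n) ⟩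
      signed (s Sign.* t) ((m ×ⁿ 1#) * (n ×ⁿ 1#))  ≈⟨ signed-* s t _ _ ⟩
      signed s (m ×ⁿ 1#) * signed t (n ×ⁿ 1#)  ≈⟨ *-cong (int-sign i) (int-sign j) ⟨
      int i * int j  ∎
      where
      s t : Sign
      s = ℤ.sign i
      t = ℤ.sign j
      m n : ℕ
      m = ℤ.∣ i ∣
      n = ℤ.∣ j ∣

    int-⊖ : ∀ m n → int (m ℤ.⊖ n) ≈ (m ×ⁿ 1#) - (n ×ⁿ 1#)
    int-⊖ zero zero = sym (trans (+-congˡ -0#≈0#) (+-identityʳ 0#))
    int-⊖ zero (suc n) = sym (+-identityˡ (- (suc n ×ⁿ 1#)))
    int-⊖ (suc m) zero = sym (trans (+-congˡ -0#≈0#) (+-identityʳ (suc m ×ⁿ 1#)))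
    int-⊖ (suc m) (suc n) = begin
      int (suc m ℤ.⊖ suc n)  ≡⟨ ≡.cong int (ℤP.[1+m]⊖[1+n]≡m⊖n m n) ⟩
      int (m ℤ.⊖ n)  ≈⟨ int-⊖ m n ⟩
      a + - b  ≈⟨ +-congʳ (+-identityʳ a) ⟨
      a + 0# + - b  ≈⟨ +-congʳ (+-congˡ (-‿inverseʳ 1#)) ⟨
      a + (1# + - 1#) + - b  ≈⟨ +-congʳ (+-assoc a 1# (- 1#)) ⟨
      a + 1# + - 1# + - b  ≈⟨ +-assoc (a + 1#) (- 1#) (- b) ⟩
      a + 1# + (- 1# + - b)  ≈⟨ +-cong (+-comm a 1#) (-‿+-comm 1# b) ⟩
      1# + a + - (1# + b)  ≈⟨ +-cong (1+× m 1#) (-‿cong (1+× n 1#)) ⟨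
      (suc m ×ⁿ 1#) - (suc n ×ⁿ 1#)  ∎
      where
      a b : Carrier
      a = m ×ⁿ 1#
      b = n ×ⁿ 1#

    int-+ : ∀ i j → int (i ℤ.+ j) ≈ int i + int j
    int-+ (ℤ.+ m)    (ℤ.+ n)    = ×-homo-+ 1# m n
    int-+ (ℤ.+ m)    -[1+ n ] = int-⊖ m (suc n)
    int-+ -[1+ m ] (ℤ.+ n)    = trans (int-⊖ n (suc m)) (+-comm _ _)
    int-+ -[1+ m ] -[1+ n ] = begin
      - (suc (suc (m ℕ.+ n)) ×ⁿ 1#)  ≡⟨ ≡.cong (λ k → - (suc k ×ⁿ 1#)) (≡.sym (ℕP.+-suc m n)) ⟩
      - ((suc m ℕ.+ suc n) ×ⁿ 1#)  ≈⟨ -‿cong (×-homo-+ 1# (suc m) (suc n)) ⟩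
      - ((suc m ×ⁿ 1#) + (suc n ×ⁿ 1#))  ≈⟨ -‿+-comm _ _ ⟨
      - (suc m ×ⁿ 1#) + - (suc n ×ⁿ 1#)  ∎

    int-neg : ∀ i → int (ℤ.- i) ≈ - int i
    int-neg (ℤ.+ zero)  = sym -0#≈0#
    int-neg (ℤ.+ suc n) = refl
    int-neg -[1+ n ]  = sym (-‿involutive _)

    int-hom : ℤ.+-*-rawRing -Raw-AlmostCommutative⟶ fromCommutativeRing R
    int-hom = record
      { ⟦_⟧    = int
      ; +-homo = int-+
      ; *-homo = int-*
      ; -‿homo = int-neg
      ; 0-homo = refl
      ; 1-homo = refl
      }

  open Algebra.Solver.Ring ℤ.+-*-rawRing (fromCommutativeRing R) int-hom
    (λ i j → Data.Maybe.map (λ e → reflexive (≡.cong int e)) (dec⇒maybe (i ℤ.≟ j)))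
    public using (Polynomial; solve; _:=_; _:+_; _:*_; _:-_; :-_; con)

  :0# :1# : ∀ {n} → Polynomial n
  :0# = con (ℤ.+ 0)
  :1# = con (ℤ.+ 1)

-- Sums, products, powers, units and homomorphisms of commutative rings.

module Tools (R : CommutativeRing 0ℓ 0ℓ) where
  open CommutativeRing R public hiding (zero)
  open Algebra.Properties.Ring ring public using (-0#≈0#)
  open Algebra.Properties.CommutativeSemiring.Exp commutativeSemiring public
  open Algebra.Properties.Semiring.Mult semiring using (×-assoc-*; ×-congʳ) renaming (_×_ to _×ⁿ_)
  open module Reasoning = Relation.Binary.Reasoning.Setoid setoid public using (begin_; step-≈-⟩; step-≈-⟨; step-≡-⟩; step-≡-⟨; step-≡-∣; _∎)
  open IntegerSolver R public

  open Fold +-commutativeMonoid public using () renaming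
    ( fold to ∑; fold-cong-∈ to ∑-cong-∈; fold-cong to ∑-cong; fold-ε to ∑-0; fold-map to ∑-map
    ; fold-concatMap to ∑-concatMap; foldr≈fold to foldr≈∑; fold-∙ to ∑-+; fold-swap to ∑-swap; fold-↭ to ∑-↭
    ; fold-upTo-head to ∑-head; fold-upTo-last to ∑-last; fold-upTo-truncate to ∑-truncate)
  open Fold *-commutativeMonoid public using () renaming
    ( fold to ∏; fold-cong to ∏-cong; fold-map to ∏-map; foldr≈fold to foldr≈∏
    ; fold-∙ to ∏-*; fold-↭ to ∏-↭; fold-upTo-head to ∏-head; fold-upTo-last to ∏-last
    ; interchange to *-interchange; fold-extract to ∏-extract)

  private variable
    X : Set

  ∑-*ˡ : ∀ (xs : List X) c f → c * ∑ xs f ≈ ∑ xs (λ x → c * f x)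
  ∑-*ˡ []       c f = zeroʳ c
  ∑-*ˡ (x ∷ xs) c f = trans (distribˡ c _ _) (+-congˡ (∑-*ˡ xs c f))

  ∑-*ʳ : ∀ (xs : List X) c f → ∑ xs f * c ≈ ∑ xs (λ x → f x * c)
  ∑-*ʳ xs c f = trans (*-comm _ c) (trans (∑-*ˡ xs c f) (∑-cong xs (λ x → *-comm c (f x))))

  ∑-filter : ∀ {p} {Q : X → Set p} (Q? : ∀ x → Dec (Q x)) xs f →
             ∑ (filter Q? xs) f ≈ ∑ xs (λ x → if does (Q? x) then f x else 0#)
  ∑-filter Q? []       f = refl
  ∑-filter Q? (x ∷ xs) f with does (Q? x)
  ... | true  = +-congˡ (∑-filter Q? xs f)
  ... | false = trans (∑-filter Q? xs f) (sym (+-identityˡ _))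

  x-y≈0⇒x≈y : ∀ {x y} → x - y ≈ 0# → x ≈ y
  x-y≈0⇒x≈y {x} {y} e = begin
    x  ≈⟨ solve 2 (λ x y → x := (x :- y) :+ y) refl x y ⟩
    (x - y) + y  ≈⟨ +-congʳ e ⟩
    0# + y  ≈⟨ +-identityˡ y ⟩
    y  ∎

  1^n≈1 : ∀ n → 1# ^ n ≈ 1#
  1^n≈1 zero    = refl
  1^n≈1 (suc n) = trans (*-identityˡ _) (1^n≈1 n)

  0^n≈0 : ∀ n → 1 ≤ n → 0# ^ n ≈ 0#
  0^n≈0 (suc n) _ = zeroˡ _

  ∏-^ : ∀ (xs : List X) f n → ∏ xs f ^ n ≈ ∏ xs (λ x → f x ^ n)
  ∏-^ []       f n = 1^n≈1 n
  ∏-^ (x ∷ xs) f n = trans (^-distrib-* (f x) _ n) (*-congˡ (∏-^ xs f n))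

  ∏-zero : ∀ (xs : List X) f {x} → x ∈ xs → f x ≈ 0# → ∏ xs f ≈ 0#
  ∏-zero (y ∷ xs) f (here ≡.refl) e = trans (*-congʳ e) (zeroˡ _)
  ∏-zero (y ∷ xs) f (there i)     e = trans (*-congˡ (∏-zero xs f i e)) (zeroʳ _)

  Unit : Carrier → Set
  Unit x = ∃ λ y → y * x ≈ 1#

  unit-1 : Unit 1#
  unit-1 = 1# , *-identityˡ 1#

  unit-≈ : ∀ {x y} → x ≈ y → Unit x → Unit y
  unit-≈ e (z , p) = z , trans (*-congˡ (sym e)) p

  unit-* : ∀ {x y} → Unit x → Unit y → Unit (x * y)
  unit-* {x} {y} (u , p) (v , r) = u * v , trans (*-interchange u v x y) (trans (*-cong p r) (*-identityˡ 1#))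

  unit-^ : ∀ {x} n → Unit x → Unit (x ^ n)
  unit-^ zero    u = unit-1
  unit-^ (suc n) u = unit-* u (unit-^ n u)

  unit-neg : ∀ {x} → Unit x → Unit (- x)
  unit-neg {x} (u , p) = - u , trans (solve 2 (λ a b → (:- a) :* (:- b) := a :* b) refl u x) p

  unit-∏ : ∀ (xs : List X) f → (∀ {x} → x ∈ xs → Unit (f x)) → Unit (∏ xs f)
  unit-∏ []       f h = unit-1
  unit-∏ (x ∷ xs) f h = unit-* (h (here ≡.refl)) (unit-∏ xs f (h ∘ there))

  unit-factorˡ : ∀ {x y} → Unit (x * y) → Unit x
  unit-factorˡ {x} {y} (u , p) = u * y , trans (solve 3 (λ u x y → u :* y :* x := u :* (x :* y)) refl u x y) p

  unit-factorʳ : ∀ {x y} → Unit (x * y) → Unit y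
  unit-factorʳ u = unit-factorˡ (unit-≈ (*-comm _ _) u)

  unit-cancelˡ : ∀ {u x y} → Unit u → u * x ≈ u * y → x ≈ y
  unit-cancelˡ {u} {x} {y} (v , p) e = begin
    x  ≈⟨ *-identityˡ x ⟨
    1# * x  ≈⟨ *-congʳ p ⟨
    v * u * x  ≈⟨ *-assoc v u x ⟩
    v * (u * x) ≈⟨ *-congˡ e ⟩
    v * (u * y) ≈⟨ *-assoc v u y ⟨
    v * u * y  ≈⟨ *-congʳ p ⟩
    1# * y  ≈⟨ *-identityˡ y ⟩
    y  ∎

  nat : ℕ → Carrier
  nat n = n ×ⁿ 1#

  private
    Sum≈∑ : ∀ n (f : ℕ → Carrier) → Algebra.Properties.Semiring.Sum.sum semiring {n} (f ∘ toℕ) ≈ ∑ (upTo n) f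
    Sum≈∑ zero    f = refl
    Sum≈∑ (suc n) f = trans (+-congˡ (Sum≈∑ n (f ∘ suc))) (sym (∑-head n f))

  binomial : ∀ n x y → (x + y) ^ n ≈ ∑ (upTo (suc n)) (λ k → x ^ k * y ^ (n ∸ k) * nat (n C k))
  binomial n x y = begin
    (x + y) ^ n ≈⟨ Algebra.Properties.CommutativeSemiring.Binomial.theorem commutativeSemiring n x y ⟩
    _  ≈⟨ Sum≈∑ (suc n) (λ k → (n C k) ×ⁿ (x ^ k * y ^ (n ∸ k))) ⟩
    _  ≈⟨ ∑-cong (upTo (suc n)) (λ k → trans (×-congʳ (n C k) (sym (*-identityˡ _)))
                     (trans (sym (×-assoc-* (n C k) 1# _)) (*-comm _ _))) ⟩
    ∑ (upTo (suc n)) (λ k → x ^ k * y ^ (n ∸ k) * nat (n C k)) ∎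

record Hom (R S : CommutativeRing 0ℓ 0ℓ) : Set where
  private
    module R = Tools R
    module S = Tools S
  field
    ⟦_⟧    : R.Carrier → S.Carrier
    ⟦⟧-cong : ∀ {x y} → x R.≈ y → ⟦ x ⟧ S.≈ ⟦ y ⟧
    +-homo : ∀ x y → ⟦ x R.+ y ⟧ S.≈ ⟦ x ⟧ S.+ ⟦ y ⟧
    *-homo : ∀ x y → ⟦ x R.* y ⟧ S.≈ ⟦ x ⟧ S.* ⟦ y ⟧
    1-homo : ⟦ R.1# ⟧ S.≈ S.1#

  0-homo : ⟦ R.0# ⟧ S.≈ S.0#
  0-homo = begin
    a  ≈⟨ solve 1 (λ a → a := (a :+ a) :- a) refl a ⟩
    (a + a) - a  ≈⟨ +-congʳ (+-homo R.0# R.0#) ⟨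
    ⟦ R.0# R.+ R.0# ⟧ - a  ≈⟨ +-congʳ (⟦⟧-cong (R.+-identityʳ R.0#)) ⟩
    a - a  ≈⟨ -‿inverseʳ a ⟩
    0#  ∎
    where
    open S
    a : Carrier
    a = ⟦ R.0# ⟧

  neg-homo : ∀ x → ⟦ R.- x ⟧ S.≈ S.- ⟦ x ⟧
  neg-homo x = begin
    ⟦ R.- x ⟧  ≈⟨ solve 2 (λ a b → a := (b :+ a) :- b) refl ⟦ R.- x ⟧ ⟦ x ⟧ ⟩
    (⟦ x ⟧ + ⟦ R.- x ⟧) - ⟦ x ⟧  ≈⟨ +-congʳ (+-homo x (R.- x)) ⟨
    ⟦ x R.+ R.- x ⟧ - ⟦ x ⟧  ≈⟨ +-congʳ (trans (⟦⟧-cong (R.-‿inverseʳ x)) 0-homo) ⟩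
    0# - ⟦ x ⟧  ≈⟨ +-identityˡ _ ⟩
    - ⟦ x ⟧  ∎
    where open S

  sub-homo : ∀ x y → ⟦ x R.- y ⟧ S.≈ ⟦ x ⟧ S.- ⟦ y ⟧
  sub-homo x y = S.trans (+-homo x (R.- y)) (S.+-congˡ (neg-homo y))

  ^-homo : ∀ x n → ⟦ x R.^ n ⟧ S.≈ ⟦ x ⟧ S.^ n
  ^-homo x zero    = 1-homo
  ^-homo x (suc n) = S.trans (*-homo x (x R.^ n)) (S.*-congˡ (^-homo x n))

  nat-homo : ∀ n → ⟦ R.nat n ⟧ S.≈ S.nat n
  nat-homo zero    = 0-homo
  nat-homo (suc n) = S.trans (+-homo R.1# (R.nat n)) (S.+-cong 1-homo (nat-homo n))

  ∑-homo : ∀ {X : Set} (xs : List X) f → ⟦ R.∑ xs f ⟧ S.≈ S.∑ xs (⟦_⟧ ∘ f)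
  ∑-homo []       f = 0-homo
  ∑-homo (x ∷ xs) f = S.trans (+-homo (f x) (R.∑ xs f)) (S.+-congˡ (∑-homo xs f))

  ∏-homo : ∀ {X : Set} (xs : List X) f → ⟦ R.∏ xs f ⟧ S.≈ S.∏ xs (⟦_⟧ ∘ f)
  ∏-homo []       f = 1-homo
  ∏-homo (x ∷ xs) f = S.trans (*-homo (f x) (R.∏ xs f)) (S.*-congˡ (∏-homo xs f))

_∘ʰ_ : ∀ {R S T} → Hom S T → Hom R S → Hom R T
_∘ʰ_ {R} {S} {T} g f = record
  { ⟦_⟧    = g.⟦_⟧ ∘ f.⟦_⟧
  ; ⟦⟧-cong = g.⟦⟧-cong ∘ f.⟦⟧-cong
  ; +-homo = λ x y → trans (g.⟦⟧-cong (f.+-homo x y)) (g.+-homo _ _)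
  ; *-homo = λ x y → trans (g.⟦⟧-cong (f.*-homo x y)) (g.*-homo _ _)
  ; 1-homo = trans (g.⟦⟧-cong f.1-homo) g.1-homo
  }
  where
  module g = Hom g
  module f = Hom f
  open CommutativeRing T using (trans)

-- Formal power series.

module PowerSeries (R : CommutativeRing 0ℓ 0ℓ) where
  open Tools R

  Series : Set
  Series = ℕ → Carrier

  infix 4 _≋_
  -- A record rather than a bare function type, so that unification can recover `f` and `g` from the
  -- type of an equation.
  record _≋_ (f g : Series) : Set where
    constructor pointwise
    field at : ∀ n → f n ≈ g n
  open _≋_ public

  tail : Series → Series
  tail f = f ∘ suc

  infixl 7 _⊛_
  -- The Cauchy product through f = f(0) + x · `tail` f. This is the recursion by which coefficient
  -- lists are multiplied, so `coeff-⊗` follows it clause by clause.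
  _⊛_ : Series → Series → Series
  (f ⊛ g) zero    = f 0 * g 0
  (f ⊛ g) (suc n) = f 0 * g (suc n) + (tail f ⊛ g) n

  constant : Carrier → Series
  constant c zero    = c
  constant c (suc n) = 0#

  X : Series
  X 1 = 1#
  X _ = 0#

  private
    ⊛-cong : ∀ {f f′ g g′} → (∀ n → f n ≈ f′ n) → (∀ n → g n ≈ g′ n) → ∀ n → (f ⊛ g) n ≈ (f′ ⊛ g′) n
    ⊛-cong e e′ zero    = *-cong (e 0) (e′ 0)
    ⊛-cong e e′ (suc n) = +-cong (*-cong (e 0) (e′ (suc n))) (⊛-cong (e ∘ suc) e′ n)

    ⊛-unfoldʳ : ∀ f g n → (f ⊛ g) (suc n) ≈ (f ⊛ tail g) n + f (suc n) * g 0
    ⊛-unfoldʳ f g zero    = refl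
    ⊛-unfoldʳ f g (suc n) = trans (+-congˡ (⊛-unfoldʳ (tail f) g n)) (sym (+-assoc _ _ _))

    ⊛-comm : ∀ f g n → (f ⊛ g) n ≈ (g ⊛ f) n
    ⊛-comm f g zero    = *-comm _ _
    ⊛-comm f g (suc n) = begin
      f 0 * g (suc n) + (tail f ⊛ g) n ≈⟨ +-cong (*-comm _ _) (⊛-comm (tail f) g n) ⟩
      g (suc n) * f 0 + (g ⊛ tail f) n ≈⟨ +-comm _ _ ⟩
      (g ⊛ tail f) n + g (suc n) * f 0 ≈⟨ ⊛-unfoldʳ g f n ⟨
      (g ⊛ f) (suc n)  ∎

    ⊛-distribʳ : ∀ h f g n → ((λ k → f k + g k) ⊛ h) n ≈ (f ⊛ h) n + (g ⊛ h) n
    ⊛-distribʳ h f g zero    = distribʳ _ _ _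
    ⊛-distribʳ h f g (suc n) = begin
      (f 0 + g 0) * h (suc n) + ((λ k → f (suc k) + g (suc k)) ⊛ h) n  ≈⟨ +-congˡ (⊛-distribʳ h (tail f) (tail g) n) ⟩
      (f 0 + g 0) * h (suc n) + ((tail f ⊛ h) n + (tail g ⊛ h) n)
        ≈⟨ solve 5 (λ a b c u v → (a :+ b) :* c :+ (u :+ v) := (a :* c :+ u) :+ (b :* c :+ v)) refl _ _ _ _ _ ⟩
      (f 0 * h (suc n) + (tail f ⊛ h) n) + (g 0 * h (suc n) + (tail g ⊛ h) n)  ∎

    ⊛-scale : ∀ c f g n → ((λ k → c * f k) ⊛ g) n ≈ c * (f ⊛ g) n
    ⊛-scale c f g zero    = *-assoc _ _ _
    ⊛-scale c f g (suc n) = trans (+-cong (*-assoc _ _ _) (⊛-scale c (tail f) g n)) (sym (distribˡ _ _ _))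

    ⊛-assoc : ∀ f g h n → ((f ⊛ g) ⊛ h) n ≈ (f ⊛ (g ⊛ h)) n
    ⊛-assoc f g h zero    = *-assoc _ _ _
    ⊛-assoc f g h (suc n) = begin
      f 0 * g 0 * h (suc n) + ((λ k → f 0 * tail g k + (tail f ⊛ g) k) ⊛ h) n
        ≈⟨ +-congˡ (⊛-distribʳ h (λ k → f 0 * tail g k) (tail f ⊛ g) n) ⟩
      f 0 * g 0 * h (suc n) + (((λ k → f 0 * tail g k) ⊛ h) n + ((tail f ⊛ g) ⊛ h) n)
        ≈⟨ +-congˡ (+-cong (⊛-scale (f 0) (tail g) h n) (⊛-assoc (tail f) g h n)) ⟩
      f 0 * g 0 * h (suc n) + (f 0 * (tail g ⊛ h) n + (tail f ⊛ (g ⊛ h)) n)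
        ≈⟨ solve 5 (λ a b c u v → a :* b :* c :+ (a :* u :+ v) := a :* (b :* c :+ u) :+ v) refl _ _ _ _ _ ⟩
      f 0 * (g 0 * h (suc n) + (tail g ⊛ h) n) + (tail f ⊛ (g ⊛ h)) n ∎

    zero-⊛ : ∀ f n → ((λ _ → 0#) ⊛ f) n ≈ 0#
    zero-⊛ f zero    = zeroˡ _
    zero-⊛ f (suc n) = trans (+-cong (zeroˡ _) (zero-⊛ f n)) (+-identityˡ _)

  constant-⊛ : ∀ c f n → (constant c ⊛ f) n ≈ c * f n
  constant-⊛ c f zero    = refl
  constant-⊛ c f (suc n) = trans (+-congˡ (zero-⊛ f n)) (+-identityʳ _)

  powerSeriesRing : CommutativeRing 0ℓ 0ℓ
  powerSeriesRing = record
    { Carrier = Series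
    ; _≈_ = _≋_
    ; _+_ = λ f g n → f n + g n
    ; _*_ = _⊛_
    ; -_  = λ f n → - f n
    ; 0#  = λ _ → 0#
    ; 1#  = constant 1#
    ; isCommutativeRing = record
      { isRing = record
        { +-isAbelianGroup = record
          { isGroup = record
            { isMonoid = record
              { isSemigroup = record
                { isMagma = record
                  { isEquivalence = record
                    { refl = pointwise (λ _ → refl)
                    ; sym = λ e → pointwise (λ n → sym (at e n))
                    ; trans = λ e e′ → pointwise (λ n → trans (at e n) (at e′ n))
                    }
                  ; ∙-cong = λ e e′ → pointwise (λ n → +-cong (at e n) (at e′ n))
                  }
                ; assoc = λ f g h → pointwise (λ n → +-assoc (f n) (g n) (h n))
                }
              ; identity = (λ f → pointwise (λ n → +-identityˡ (f n))) , (λ f → pointwise (λ n → +-identityʳ (f n)))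
              }
            ; inverse = (λ f → pointwise (λ n → -‿inverseˡ (f n))) , (λ f → pointwise (λ n → -‿inverseʳ (f n)))
            ; ⁻¹-cong = λ e → pointwise (λ n → -‿cong (at e n))
            }
          ; comm = λ f g → pointwise (λ n → +-comm (f n) (g n))
          }
        ; *-cong = λ e e′ → pointwise (⊛-cong (at e) (at e′))
        ; *-assoc = λ f g h → pointwise (⊛-assoc f g h)
        ; *-identity = (λ f → pointwise (one-⊛ f)) , (λ f → pointwise (λ n → trans (⊛-comm f (constant 1#) n) (one-⊛ f n)))
        ; distrib = (λ f g h → pointwise (⊛-distribˡ f g h)) , (λ f g h → pointwise (⊛-distribʳ f g h))
        }
      ; *-comm = λ f g → pointwise (⊛-comm f g)
      }
    }
    where
    one-⊛ : ∀ f n → (constant 1# ⊛ f) n ≈ f n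
    one-⊛ f n = trans (constant-⊛ 1# f n) (*-identityˡ (f n))
    ⊛-distribˡ : ∀ f g h n → (f ⊛ (λ k → g k + h k)) n ≈ (f ⊛ g) n + (f ⊛ h) n
    ⊛-distribˡ f g h n = begin
      (f ⊛ (λ k → g k + h k)) n  ≈⟨ ⊛-comm f _ n ⟩
      ((λ k → g k + h k) ⊛ f) n  ≈⟨ ⊛-distribʳ f g h n ⟩
      (g ⊛ f) n + (h ⊛ f) n  ≈⟨ +-cong (⊛-comm g f n) (⊛-comm h f n) ⟩
      (f ⊛ g) n + (f ⊛ h) n  ∎

  constantHom : Hom R powerSeriesRing
  constantHom = record
    { ⟦_⟧     = constant
    ; ⟦⟧-cong = λ e → pointwise λ { zero → e ; (suc n) → refl }
    ; +-homo  = λ x y → pointwise λ { zero → refl ; (suc n) → sym (+-identityˡ 0#) }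
    ; *-homo  = λ x y → pointwise λ { zero → refl ; (suc n) → sym (trans (constant-⊛ x (constant y) (suc n)) (zeroʳ x)) }
    ; 1-homo  = pointwise (λ _ → refl)
    }

  X-⊛-suc : ∀ f n → (X ⊛ f) (suc n) ≈ f n
  X-⊛-suc f n = begin
    0# * f (suc n) + (tail X ⊛ f) n  ≈⟨ +-cong (zeroˡ _) (⊛-cong tail-X (λ _ → refl) n) ⟩
    0# + (constant 1# ⊛ f) n  ≈⟨ +-identityˡ _ ⟩
    (constant 1# ⊛ f) n  ≈⟨ constant-⊛ 1# f n ⟩
    1# * f n  ≈⟨ *-identityˡ _ ⟩
    f n  ∎
    where
    tail-X : ∀ k → tail X k ≈ constant 1# k
    tail-X zero    = refl
    tail-X (suc k) = refl

  private module S = Tools powerSeriesRing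

  X^-⊛-< : ∀ m f n → n < m → ((X S.^ m) ⊛ f) n ≈ 0#
  X^-⊛-< (suc m) f zero    _         = trans (*-congʳ (zeroˡ _)) (zeroˡ _)
  X^-⊛-< (suc m) f (suc n) (s≤s n<m) = begin
    ((X ⊛ (X S.^ m)) ⊛ f) (suc n)  ≈⟨ ⊛-assoc X (X S.^ m) f (suc n) ⟩
    (X ⊛ ((X S.^ m) ⊛ f)) (suc n)  ≈⟨ X-⊛-suc _ n ⟩
    ((X S.^ m) ⊛ f) n  ≈⟨ X^-⊛-< m f n n<m ⟩
    0#  ∎

  X^-⊛-≤ : ∀ m f n → m ≤ n → ((X S.^ m) ⊛ f) n ≈ f (n ∸ m)
  X^-⊛-≤ zero    f n       _         = trans (constant-⊛ 1# f n) (*-identityˡ _)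
  X^-⊛-≤ (suc m) f (suc n) (s≤s m≤n) = begin
    ((X ⊛ (X S.^ m)) ⊛ f) (suc n)  ≈⟨ ⊛-assoc X (X S.^ m) f (suc n) ⟩
    (X ⊛ ((X S.^ m) ⊛ f)) (suc n)  ≈⟨ X-⊛-suc _ n ⟩
    ((X S.^ m) ⊛ f) n  ≈⟨ X^-⊛-≤ m f n m≤n ⟩
    f (n ∸ m)  ∎

-- Polynomials as coefficient lists: ring laws, evaluation, division by monic polynomials.

module PolyRing (R : CommutativeRing 0ℓ 0ℓ) (_≟_ : DecidableEquality (CommutativeRing.Carrier R)) where
  open Tools R
  open PowerSeries R using (Series; _≋_; pointwise; at; _⊛_; constant; powerSeriesRing)
  open PolyOps _≟_ 0# 1# _+_ _*_ -_
  private module S = Tools powerSeriesRing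

  coeff : Poly → Series
  coeff []      _       = 0#
  coeff (a ∷ p) zero    = a
  coeff (a ∷ p) (suc n) = coeff p n

  infix 4 _≈ᴾ_
  record _≈ᴾ_ (p q : Poly) : Set where
    constructor coeffwise
    field coeff-≋ : coeff p ≋ coeff q
  open _≈ᴾ_ public

  coeff-≈ : ∀ {p q} → p ≈ᴾ q → ∀ n → coeff p n ≈ coeff q n
  coeff-≈ e = at (coeff-≋ e)

  coeffs≈ : ∀ {p q} → (∀ n → coeff p n ≈ coeff q n) → p ≈ᴾ q
  coeffs≈ e = coeffwise (pointwise e)

  -- PolyOps keeps cons, addRaw and mulRaw private; unification against the unfolded public operations recovers them.
  mutual
    cons : Carrier → Poly → Poly
    cons = _

    norm-∷ : ∀ c p → norm (c ∷ p) ≡ cons c (norm p)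
    norm-∷ c p with norm p
    ... | xs = ≡.refl

  mutual
    mulRaw : Poly → Poly → Poly
    mulRaw = _

    ⊗-mulRaw : ∀ a p r → (a ∷ p) ⊗ r ≡ map (a *_) r ⊕ (0# ∷ mulRaw p r)
    ⊗-mulRaw a p r = ≡.refl

  mutual
    addRaw : Poly → Poly → Poly
    addRaw = _

    mulRaw-∷ : ∀ a p r → mulRaw (a ∷ p) r ≡ addRaw (map (a *_) r) (0# ∷ mulRaw p r)
    mulRaw-∷ a p r with map (a *_) r | Poly ∋ (0# ∷ mulRaw p r)
    ... | s | t = ≡.refl

  cons-zero : ∀ {c} → c ≡ 0# → cons c [] ≡ []
  cons-zero {c} c≡0 rewrite dec-true (c ≟ 0#) c≡0 = ≡.refl

  coeff-cons : ∀ c p n → coeff (cons c p) n ≈ coeff (c ∷ p) n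
  coeff-cons c (x ∷ p) n = refl
  coeff-cons c []      n with c ≟ 0#
  coeff-cons c [] zero    | yes c≡0 = reflexive (≡.sym c≡0)
  coeff-cons c [] (suc n) | yes c≡0 = refl
  coeff-cons c [] n       | no _    = refl

  coeff-norm : ∀ p n → coeff (norm p) n ≈ coeff p n
  coeff-norm []      n       = refl
  coeff-norm (c ∷ p) zero    = coeff-cons c (norm p) 0
  coeff-norm (c ∷ p) (suc n) = trans (coeff-cons c (norm p) (suc n)) (coeff-norm p n)

  coeff-⊕ : ∀ p r n → coeff (p ⊕ r) n ≈ coeff p n + coeff r n
  coeff-⊕ []      r       n       = trans (coeff-norm r n) (sym (+-identityˡ _))
  coeff-⊕ (a ∷ p) []      n       = trans (coeff-norm (a ∷ p) n) (sym (+-identityʳ _))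
  coeff-⊕ (a ∷ p) (b ∷ r) zero    = coeff-cons (a + b) (p ⊕ r) 0
  coeff-⊕ (a ∷ p) (b ∷ r) (suc n) = trans (coeff-cons (a + b) (p ⊕ r) (suc n)) (coeff-⊕ p r n)

  coeff-map : ∀ (f : Carrier → Carrier) → f 0# ≈ 0# → ∀ p n → coeff (map f p) n ≈ f (coeff p n)
  coeff-map f f0 []      n       = sym f0
  coeff-map f f0 (a ∷ p) zero    = refl
  coeff-map f f0 (a ∷ p) (suc n) = coeff-map f f0 p n

  coeff-neg : ∀ p n → coeff (neg p) n ≈ - coeff p n
  coeff-neg p n = trans (coeff-norm (map -_ p) n) (coeff-map -_ -0#≈0# p n)

  coeff-⊗ : ∀ p r n → coeff (p ⊗ r) n ≈ (coeff p ⊛ coeff r) n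
  coeff-⊗ []      r n       = at (S.sym (S.zeroˡ (coeff r))) n
  coeff-⊗ (a ∷ p) r zero    = begin
    coeff ((a ∷ p) ⊗ r) 0  ≈⟨ coeff-⊕ (map (a *_) r) (0# ∷ mulRaw p r) 0 ⟩
    coeff (map (a *_) r) 0 + 0#  ≈⟨ +-identityʳ _ ⟩
    coeff (map (a *_) r) 0  ≈⟨ coeff-map (a *_) (zeroʳ a) r 0 ⟩
    a * coeff r 0  ∎
  coeff-⊗ (a ∷ p) r (suc n) = begin
    coeff ((a ∷ p) ⊗ r) (suc n)  ≈⟨ coeff-⊕ (map (a *_) r) (0# ∷ mulRaw p r) (suc n) ⟩
    coeff (map (a *_) r) (suc n) + _  ≈⟨ +-cong (coeff-map (a *_) (zeroʳ a) r (suc n)) (sym (coeff-norm (mulRaw p r) n)) ⟩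
    a * coeff r (suc n) + coeff (p ⊗ r) n  ≈⟨ +-congˡ (coeff-⊗ p r n) ⟩
    a * coeff r (suc n) + (coeff p ⊛ coeff r) n  ∎

  ⊕-series : ∀ p r → coeff (p ⊕ r) ≋ coeff p S.+ coeff r
  ⊕-series p r = pointwise (coeff-⊕ p r)

  ⊗-series : ∀ p r → coeff (p ⊗ r) ≋ coeff p S.* coeff r
  ⊗-series p r = pointwise (coeff-⊗ p r)

  neg-series : ∀ p → coeff (neg p) ≋ S.- coeff p
  neg-series p = pointwise (coeff-neg p)

  oneP-series : coeff oneP ≋ S.1#
  oneP-series = pointwise λ n → trans (coeff-norm [ 1# ] n) (lemma n)
    where
    lemma : ∀ n → coeff [ 1# ] n ≈ constant 1# n
    lemma zero    = refl
    lemma (suc n) = refl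

  -- Equality of polynomials is equality of their coefficient series and `coeff` respects the
  -- operations, so each ring law is pulled back from the power series ring; `via` is the pullback.
  polyRing : CommutativeRing 0ℓ 0ℓ
  polyRing = record
    { Carrier = Poly
    ; _≈_ = _≈ᴾ_
    ; _+_ = _⊕_
    ; _*_ = _⊗_
    ; -_  = neg
    ; 0#  = zeroP
    ; 1#  = oneP
    ; isCommutativeRing = record
      { isRing = record
        { +-isAbelianGroup = record
          { isGroup = record
            { isMonoid = record
              { isSemigroup = record
                { isMagma = record
                  { isEquivalence = record
                    { refl = coeffwise S.refl
                    ; sym = λ e → coeffwise (S.sym (coeff-≋ e))
                    ; trans = λ e e′ → coeffwise (S.trans (coeff-≋ e) (coeff-≋ e′))
                    }
                  ; ∙-cong = λ {p} {p′} {r} {r′} e e′ → via (⊕-series p r) (S.+-cong (coeff-≋ e) (coeff-≋ e′)) (⊕-series p′ r′)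
                  }
                ; assoc = λ p r s → via (⊕ˡ (p ⊕ r) s (⊕-series p r)) (S.+-assoc _ _ _) (⊕ʳ p (r ⊕ s) (⊕-series r s))
                }
              ; identity = (λ p → via (⊕-series [] p) (S.+-identityˡ _) S.refl) , (λ p → via (⊕-series p []) (S.+-identityʳ _) S.refl)
              }
            ; inverse = (λ p → via (⊕ˡ (neg p) p (neg-series p)) (S.-‿inverseˡ _) S.refl)
                      , (λ p → via (⊕ʳ p (neg p) (neg-series p)) (S.-‿inverseʳ _) S.refl)
            ; ⁻¹-cong = λ {p} {r} e → via (neg-series p) (S.-‿cong (coeff-≋ e)) (neg-series r)
            }
          ; comm = λ p r → via (⊕-series p r) (S.+-comm _ _) (⊕-series r p)
          }
        ; *-cong = λ {p} {p′} {r} {r′} e e′ → via (⊗-series p r) (S.*-cong (coeff-≋ e) (coeff-≋ e′)) (⊗-series p′ r′)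
        ; *-assoc = λ p r s → via (⊗ˡ (p ⊗ r) s (⊗-series p r)) (S.*-assoc _ _ _) (⊗ʳ p (r ⊗ s) (⊗-series r s))
        ; *-identity = (λ p → via (⊗ˡ oneP p oneP-series) (S.*-identityˡ _) S.refl) , (λ p → via (⊗ʳ p oneP oneP-series) (S.*-identityʳ _) S.refl)
        ; distrib = (λ p r s → via (⊗ʳ p (r ⊕ s) (⊕-series r s)) (S.distribˡ _ _ _) (⊕² (p ⊗ r) (p ⊗ s) (⊗-series p r) (⊗-series p s)))
                  , (λ p r s → via (⊗ˡ (r ⊕ s) p (⊕-series r s)) (S.distribʳ _ _ _) (⊕² (r ⊗ p) (s ⊗ p) (⊗-series r p) (⊗-series s p)))
        }
      ; *-comm = λ p r → via (⊗-series p r) (S.*-comm _ _) (⊗-series r p)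
      }
    }
    where
    via : ∀ {p r f g} → coeff p ≋ f → f ≋ g → coeff r ≋ g → p ≈ᴾ r
    via a b c = coeffwise (S.trans a (S.trans b (S.sym c)))
    ⊕² : ∀ p r {f g} → coeff p ≋ f → coeff r ≋ g → coeff (p ⊕ r) ≋ f S.+ g
    ⊕² p r e e′ = S.trans (⊕-series p r) (S.+-cong e e′)
    ⊕ˡ : ∀ p r {f} → coeff p ≋ f → coeff (p ⊕ r) ≋ f S.+ coeff r
    ⊕ˡ p r e = ⊕² p r e S.refl
    ⊕ʳ : ∀ p r {f} → coeff r ≋ f → coeff (p ⊕ r) ≋ coeff p S.+ f
    ⊕ʳ p r e = ⊕² p r S.refl e
    ⊗ˡ : ∀ p r {f} → coeff p ≋ f → coeff (p ⊗ r) ≋ f S.* coeff r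
    ⊗ˡ p r e = S.trans (⊗-series p r) (S.*-congʳ e)
    ⊗ʳ : ∀ p r {f} → coeff r ≋ f → coeff (p ⊗ r) ≋ coeff p S.* f
    ⊗ʳ p r e = S.trans (⊗-series p r) (S.*-congˡ e)

  private module P = Tools polyRing

  norm-≈ : ∀ p → norm p ≈ᴾ p
  norm-≈ p = coeffs≈ (coeff-norm p)

  ∷-cong : ∀ {a b p r} → a ≈ b → p ≈ᴾ r → (a ∷ p) ≈ᴾ (b ∷ r)
  ∷-cong e e′ = coeffs≈ λ { zero → e ; (suc n) → coeff-≈ e′ n }

  ∷-⊕-∷ : ∀ a p b r → (a ∷ p) ⊕ (b ∷ r) ≈ᴾ (a + b) ∷ (p ⊕ r)
  ∷-⊕-∷ a p b r = coeffs≈ λ { zero → coeff-⊕ (a ∷ p) (b ∷ r) 0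
                            ; (suc n) → trans (coeff-⊕ (a ∷ p) (b ∷ r) (suc n)) (sym (coeff-⊕ p r n)) }

  ∷-⊗ : ∀ a p r → (a ∷ p) ⊗ r ≈ᴾ map (a *_) r ⊕ (0# ∷ (p ⊗ r))
  ∷-⊗ a p r = coeffs≈ λ n → begin
    coeff ((a ∷ p) ⊗ r) n  ≈⟨ coeff-⊗ (a ∷ p) r n ⟩
    (coeff (a ∷ p) ⊛ coeff r) n  ≈⟨ unfold n ⟩
    a * coeff r n + coeff (0# ∷ (p ⊗ r)) n  ≈⟨ +-congʳ (coeff-map (a *_) (zeroʳ a) r n) ⟨
    coeff (map (a *_) r) n + coeff (0# ∷ (p ⊗ r)) n  ≈⟨ coeff-⊕ (map (a *_) r) (0# ∷ (p ⊗ r)) n ⟨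
    coeff (map (a *_) r ⊕ (0# ∷ (p ⊗ r))) n  ∎
    where
    unfold : ∀ n → (coeff (a ∷ p) ⊛ coeff r) n ≈ a * coeff r n + coeff (0# ∷ (p ⊗ r)) n
    unfold zero    = sym (+-identityʳ _)
    unfold (suc n) = +-congˡ (sym (coeff-⊗ p r n))

  coeff-∷-⊗ : ∀ a p r n → coeff ((a ∷ p) ⊗ r) (suc n) ≈ a * coeff r (suc n) + coeff (p ⊗ r) n
  coeff-∷-⊗ a p r n = trans (coeff-⊗ (a ∷ p) r (suc n)) (+-congˡ (sym (coeff-⊗ p r n)))

  ^P≡^ : ∀ p n → p ^P n ≡ p P.^ n
  ^P≡^ p zero    = ≡.refl
  ^P≡^ p (suc n) = ≡.cong (p ⊗_) (^P≡^ p n)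

  sumP-map : ∀ {X : Set} (f : X → Poly) xs → sumP (map f xs) P.≈ P.∑ xs f
  sumP-map f xs = P.trans (P.foldr≈∑ (map f xs)) (P.∑-map f xs)

  prodP-map : ∀ {X : Set} (f : X → Poly) xs → prodP (map f xs) P.≈ P.∏ xs f
  prodP-map f xs = P.trans (P.foldr≈∏ (map f xs)) (P.∏-map f xs)

  coeff-monomial : ∀ c k j → coeff (replicate k 0# ++ [ c ]) (k ℕ.+ j) ≈ constant c j
  coeff-monomial c zero    zero    = refl
  coeff-monomial c zero    (suc j) = refl
  coeff-monomial c (suc k) j       = coeff-monomial c k j

  replicate-≈0 : ∀ k → replicate k 0# ≈ᴾ []
  replicate-≈0 zero    = P.refl
  replicate-≈0 (suc k) = coeffs≈ λ { zero → refl ; (suc n) → coeff-≈ (replicate-≈0 k) n }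

  constHom : Hom R polyRing
  constHom = record
    { ⟦_⟧     = const
    ; ⟦⟧-cong = λ {x} {y} e → by x (∷-cong e P.refl) (norm-≈ [ y ])
    ; +-homo  = λ x y → by (x + y) (P.sym (∷-⊕-∷ x [] y [])) (P.+-cong (norm-≈ [ x ]) (norm-≈ [ y ]))
    ; *-homo  = λ x y → by (x * y) (P.sym (product x y)) (P.*-cong (norm-≈ [ x ]) (norm-≈ [ y ]))
    ; 1-homo  = P.refl
    }
    where
    by : ∀ x {p r} → [ x ] ≈ᴾ p → r ≈ᴾ p → const x ≈ᴾ r
    by x e e′ = P.trans (norm-≈ [ x ]) (P.trans e (P.sym e′))
    product : ∀ x y → [ x ] ⊗ [ y ] ≈ᴾ [ x * y ]
    product x y = coeffs≈ λ { zero → coeff-⊗ [ x ] [ y ] 0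
                            ; (suc n) → trans (coeff-∷-⊗ x [] [ y ] n) (trans (+-identityʳ _) (zeroʳ x)) }

module Evaluation (R : CommutativeRing 0ℓ 0ℓ) (_≟_ : DecidableEquality (CommutativeRing.Carrier R))
                  (S : CommutativeRing 0ℓ 0ℓ) (τ : Hom R S) (z : CommutativeRing.Carrier S) where
  private
    module R = Tools R
    module τ = Hom τ
  open PolyOps _≟_ R.0# R.1# R._+_ R._*_ R.-_
  open PolyRing R _≟_
  open Tools S

  eval : Poly → Carrier
  eval []      = 0#
  eval (a ∷ p) = τ.⟦ a ⟧ + z * eval p

  eval-zero : ∀ p → (∀ n → coeff p n R.≈ R.0#) → eval p ≈ 0#
  eval-zero []      h = refl
  eval-zero (a ∷ p) h = begin
    τ.⟦ a ⟧ + z * eval p  ≈⟨ +-cong (trans (τ.⟦⟧-cong (h 0)) τ.0-homo) (*-congˡ (eval-zero p (h ∘ suc))) ⟩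
    0# + z * 0#  ≈⟨ trans (+-identityˡ _) (zeroʳ z) ⟩
    0#  ∎

  -- The two lists may differ by trailing zeros; once one of them is exhausted, `eval-zero` disposes
  -- of the other.
  eval-cong : ∀ {p r} → p ≈ᴾ r → eval p ≈ eval r
  eval-cong {[]}    {r}     e = sym (eval-zero r (λ n → R.sym (coeff-≈ e n)))
  eval-cong {a ∷ p} {[]}    e = eval-zero (a ∷ p) (coeff-≈ e)
  eval-cong {a ∷ p} {b ∷ r} e =
    +-cong (τ.⟦⟧-cong (coeff-≈ e 0)) (*-congˡ (eval-cong {p} {r} (coeffs≈ (λ n → coeff-≈ e (suc n)))))

  eval-⊕ : ∀ p r → eval (p ⊕ r) ≈ eval p + eval r
  eval-⊕ []      r       = trans (eval-cong (norm-≈ r)) (sym (+-identityˡ _))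
  eval-⊕ (a ∷ p) []      = trans (eval-cong (norm-≈ (a ∷ p))) (sym (+-identityʳ _))
  eval-⊕ (a ∷ p) (b ∷ r) = begin
    eval ((a ∷ p) ⊕ (b ∷ r))  ≈⟨ eval-cong (∷-⊕-∷ a p b r) ⟩
    τ.⟦ a R.+ b ⟧ + z * eval (p ⊕ r)  ≈⟨ +-cong (τ.+-homo a b) (*-congˡ (eval-⊕ p r)) ⟩
    (τ.⟦ a ⟧ + τ.⟦ b ⟧) + z * (eval p + eval r)
      ≈⟨ solve 5 (λ a b z p r → (a :+ b) :+ z :* (p :+ r) := (a :+ z :* p) :+ (b :+ z :* r)) refl _ _ _ _ _ ⟩
    (τ.⟦ a ⟧ + z * eval p) + (τ.⟦ b ⟧ + z * eval r)  ∎

  eval-scale : ∀ a p → eval (map (a R.*_) p) ≈ τ.⟦ a ⟧ * eval p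
  eval-scale a []      = sym (zeroʳ _)
  eval-scale a (b ∷ p) = begin
    τ.⟦ a R.* b ⟧ + z * eval (map (a R.*_) p)  ≈⟨ +-cong (τ.*-homo a b) (*-congˡ (eval-scale a p)) ⟩
    τ.⟦ a ⟧ * τ.⟦ b ⟧ + z * (τ.⟦ a ⟧ * eval p)
      ≈⟨ solve 4 (λ a b z p → a :* b :+ z :* (a :* p) := a :* (b :+ z :* p)) refl _ _ _ _ ⟩
    τ.⟦ a ⟧ * (τ.⟦ b ⟧ + z * eval p)  ∎

  eval-⊗ : ∀ p r → eval (p ⊗ r) ≈ eval p * eval r
  eval-⊗ []      r = sym (zeroˡ _)
  eval-⊗ (a ∷ p) r = begin
    eval ((a ∷ p) ⊗ r)  ≈⟨ eval-cong (∷-⊗ a p r) ⟩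
    eval (map (a R.*_) r ⊕ (R.0# ∷ (p ⊗ r)))  ≈⟨ eval-⊕ (map (a R.*_) r) (R.0# ∷ (p ⊗ r)) ⟩
    eval (map (a R.*_) r) + (τ.⟦ R.0# ⟧ + z * eval (p ⊗ r)) ≈⟨ +-cong (eval-scale a r) (+-cong τ.0-homo (*-congˡ (eval-⊗ p r))) ⟩
    τ.⟦ a ⟧ * eval r + (0# + z * (eval p * eval r))  ≈⟨ +-congˡ (+-identityˡ _) ⟩
    τ.⟦ a ⟧ * eval r + z * (eval p * eval r)
      ≈⟨ solve 4 (λ a z p r → a :* r :+ z :* (p :* r) := (a :+ z :* p) :* r) refl _ _ _ _ ⟩
    (τ.⟦ a ⟧ + z * eval p) * eval r  ∎

  eval-const : ∀ c → eval (const c) ≈ τ.⟦ c ⟧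
  eval-const c = trans (eval-cong (norm-≈ [ c ])) (trans (+-congˡ (zeroʳ z)) (+-identityʳ _))

  evalHom : Hom polyRing S
  evalHom = record
    { ⟦_⟧     = eval
    ; ⟦⟧-cong = eval-cong
    ; +-homo  = eval-⊕
    ; *-homo  = eval-⊗
    ; 1-homo  = trans (eval-const R.1#) τ.1-homo
    }

  eval-monomial : ∀ c n → eval (monomial c n) ≈ z ^ n * τ.⟦ c ⟧
  eval-monomial c n = trans (eval-cong (norm-≈ (replicate n R.0# ++ [ c ]))) (raw n)
    where
    raw : ∀ n → eval (replicate n R.0# ++ [ c ]) ≈ z ^ n * τ.⟦ c ⟧
    raw zero    = trans (trans (+-congˡ (zeroʳ z)) (+-identityʳ _)) (sym (*-identityˡ _))
    raw (suc n) = trans (+-cong τ.0-homo (*-congˡ (raw n))) (trans (+-identityˡ _) (sym (*-assoc _ _ _)))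

-- N singles out the coefficients in normal form, for which x ≈ 0# can be tested by _≟_.
module Division (R : CommutativeRing 0ℓ 0ℓ) (_≟_ : DecidableEquality (CommutativeRing.Carrier R))
                (N : CommutativeRing.Carrier R → Set)
                (N-0 : N (CommutativeRing.0# R))
                (N-+ : ∀ x y → N (CommutativeRing._+_ R x y))
                (N-* : ∀ x y → N (CommutativeRing._*_ R x y))
                (N-neg : ∀ x → N (CommutativeRing.-_ R x))
                (N-zero : ∀ {x} → N x → CommutativeRing._≈_ R x (CommutativeRing.0# R) → x ≡ CommutativeRing.0# R) where
  open Tools R
  open PolyOps _≟_ 0# 1# _+_ _*_ -_
  open PolyRing R _≟_
  private module P = Tools polyRing

  mutual
    divGo : Poly → ℕ → Poly → Poly → Poly × Poly
    divGo = _

    -- Unfolding one round of `divMod` exposes the private loop. The `with` abstractions turn the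
    -- arguments of `divGo` into variables, which lets unification solve for it.
    divMod-divGo : ∀ m c p →
      let r = norm (c ∷ p) ; mon = monomial (lead r) (length r ∸ length m) in
      divMod (c ∷ p) m ≡ (if length r <ᵇ length m then (zeroP , r) else divGo m (length p) (zeroP ⊕ mon) (r ⊖ (mon ⊗ m)))
    divMod-divGo m c p with length p | norm (c ∷ p)
    ... | f | r with zeroP ⊕ monomial (lead r) (length r ∸ length m) | r ⊖ (monomial (lead r) (length r ∸ length m) ⊗ m)
    ... | qt | r′ = ≡.refl

  last : Poly → Carrier
  last []          = 0#
  last (c ∷ [])    = c
  last (c ∷ d ∷ p) = last (d ∷ p)

  lead≡last : ∀ p → lead p ≡ last (norm p)
  lead≡last [] = ≡.refl
  lead≡last (c ∷ p) with norm p | lead≡last p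
  ... | x ∷ xs | h = h
  ... | []     | h with c ≟ 0#
  ...   | yes _ = ≡.refl
  ...   | no  _ = ≡.refl

  last-coeff : ∀ p → last p ≡ coeff p (length p ∸ 1)
  last-coeff []          = ≡.refl
  last-coeff (c ∷ [])    = ≡.refl
  last-coeff (c ∷ d ∷ p) = last-coeff (d ∷ p)

  coeff-beyond : ∀ p {n} → length p ≤ n → coeff p n ≡ 0#
  coeff-beyond []      _       = ≡.refl
  coeff-beyond (a ∷ p) (s≤s h) = coeff-beyond p h

  length-norm≤length : ∀ p → length (norm p) ≤ length p
  length-norm≤length [] = z≤n
  length-norm≤length (c ∷ p) with norm p | length-norm≤length p
  ... | x ∷ xs | h = s≤s h
  ... | []     | h with c ≟ 0#
  ...   | yes _ = z≤n
  ...   | no  _ = s≤s z≤n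

  norm-idem : ∀ p → norm (norm p) ≡ norm p
  norm-idem [] = ≡.refl
  norm-idem (c ∷ p) with norm p | norm-idem p
  ... | x ∷ xs | h = ≡.trans (norm-∷ c (x ∷ xs)) (≡.cong (cons c) h)
  ... | []     | h with c ≟ 0#
  ...   | yes _  = ≡.refl
  ...   | no c≢0 rewrite dec-false (c ≟ 0#) c≢0 = ≡.refl

  cons-All : ∀ {c p} → N c → All N p → All N (cons c p)
  cons-All {c} {x ∷ p} n ns = n ∷ ns
  cons-All {c} {[]}    n ns with c ≟ 0#
  ... | yes _ = []
  ... | no  _ = n ∷ []

  norm-All : ∀ {p} → All N p → All N (norm p)
  norm-All []       = []
  norm-All (n ∷ ns) = cons-All n (norm-All ns)

  addRaw-All : ∀ {p r} → All N p → All N r → All N (addRaw p r)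
  addRaw-All {[]}    {r}     ns       ms       = ms
  addRaw-All {a ∷ p} {[]}    ns       ms       = ns
  addRaw-All {a ∷ p} {b ∷ r} (_ ∷ ns) (_ ∷ ms) = N-+ a b ∷ addRaw-All ns ms

  map-All : ∀ {f : Carrier → Carrier} → (∀ x → N (f x)) → ∀ p → All N (map f p)
  map-All h []      = []
  map-All h (a ∷ p) = h a ∷ map-All h p

  mulRaw-All : ∀ p r → All N (mulRaw p r)
  mulRaw-All []      r = []
  mulRaw-All (a ∷ p) r = addRaw-All (map-All (N-* a) r) (N-0 ∷ mulRaw-All p r)

  ⊕-All : ∀ p r → All N p → All N r → All N (p ⊕ r)
  ⊕-All p r ns ms = norm-All (addRaw-All ns ms)

  ⊗-All : ∀ p r → All N (p ⊗ r)
  ⊗-All p r = norm-All (mulRaw-All p r)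

  neg-All : ∀ p → All N (neg p)
  neg-All p = norm-All (map-All N-neg p)

  length-norm : ∀ k p → All N p → (∀ n → k ≤ n → coeff p n ≈ 0#) → length (norm p) ≤ k
  length-norm k       []      _        _ = z≤n
  length-norm (suc k) (c ∷ p) (_ ∷ ns) h = ℕP.≤-trans (length-cons c (norm p)) (s≤s (length-norm k p ns (λ n k≤n → h (suc n) (s≤s k≤n))))
    where
    length-cons : ∀ c p → length (cons c p) ≤ suc (length p)
    length-cons c (x ∷ p) = ℕP.≤-refl
    length-cons c []      with c ≟ 0#
    ... | yes _ = z≤n
    ... | no  _ = s≤s z≤n
  length-norm zero    (c ∷ p) (n ∷ ns) h
    with norm p | length-norm zero p ns (λ n _ → h (suc n) z≤n)
  ... | [] | _ = ℕP.≤-reflexive (≡.cong length (cons-zero (N-zero n (h 0 z≤n))))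

  length≡0 : ∀ {p : Poly} → length p ≤ 0 → p ≡ []
  length≡0 {[]} _ = ≡.refl

  norm≡[] : ∀ p → All N p → p ≈ᴾ [] → norm p ≡ []
  norm≡[] p ns e = length≡0 (length-norm 0 p ns (λ n _ → coeff-≈ e n))

  length-exact : ∀ p l → norm p ≡ p → All N p → (∀ n → l < n → coeff p n ≈ 0#) → ¬ (coeff p l ≈ 0#) → length p ≡ suc l
  length-exact p l np ns beyond leading≉0 = ℕP.≤-antisym
    (ℕP.≤-trans (ℕP.≤-reflexive (≡.cong length (≡.sym np))) (length-norm (suc l) p ns beyond))
    (ℕP.≰⇒> λ short → leading≉0 (reflexive (coeff-beyond p short)))

  module Divisor (m : Poly) (l : ℕ) (length-m : length m ≡ suc l) (leading : coeff m l ≈ 1#) where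

    -- The source of uniqueness in division. Above degree l the summand a · m vanishes, so the
    -- hypothesis passes to the tail of the list; once the tail is zero, the coefficient in degree l
    -- is a itself because `m` is monic.
    quotient-zero : ∀ z → (∀ n → l ≤ n → coeff (z ⊗ m) n ≈ 0#) → z ≈ᴾ []
    quotient-zero []      h = P.refl
    quotient-zero (a ∷ z) h = coeffs≈ λ { zero → a≈0 ; (suc n) → coeff-≈ z≈0 n }
      where
      z≈0 : z ≈ᴾ []
      z≈0 = quotient-zero z λ n l≤n → begin
        coeff (z ⊗ m) n  ≈⟨ +-identityˡ _ ⟨
        0# + coeff (z ⊗ m) n  ≈⟨ +-congʳ (trans (*-congˡ (reflexive (coeff-beyond m (ℕP.≤-trans (ℕP.≤-reflexive length-m) (s≤s l≤n))))) (zeroʳ a)) ⟨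
        a * coeff m (suc n) + coeff (z ⊗ m) n  ≈⟨ coeff-∷-⊗ a z m n ⟨
        coeff ((a ∷ z) ⊗ m) (suc n)  ≈⟨ h (suc n) (ℕP.m≤n⇒m≤1+n l≤n) ⟩
        0#  ∎
      z⊗m≈0 : (0# ∷ (z ⊗ m)) ≈ᴾ []
      z⊗m≈0 = coeffs≈ λ { zero → refl ; (suc n) → coeff-≈ (P.trans (P.*-congʳ {m} z≈0) P.refl) n }
      a≈0 : a ≈ 0#
      a≈0 = begin
        a  ≈⟨ *-identityʳ a ⟨
        a * 1#  ≈⟨ *-congˡ leading ⟨
        a * coeff m l  ≈⟨ coeff-map (a *_) (zeroʳ a) m l ⟨
        coeff (map (a *_) m) l  ≈⟨ +-identityʳ _ ⟨
        coeff (map (a *_) m) l + 0#  ≈⟨ +-congˡ (coeff-≈ z⊗m≈0 l) ⟨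
        coeff (map (a *_) m) l + coeff (0# ∷ (z ⊗ m)) l  ≈⟨ coeff-⊕ (map (a *_) m) (0# ∷ (z ⊗ m)) l ⟨
        coeff (map (a *_) m ⊕ (0# ∷ (z ⊗ m))) l  ≈⟨ coeff-≈ (∷-⊗ a z m) l ⟨
        coeff ((a ∷ z) ⊗ m) l  ≈⟨ h l ℕP.≤-refl ⟩
        0#  ∎

    coeff-monomial-⊗ : ∀ c k j → coeff (monomial c k ⊗ m) (k ℕ.+ j) ≈ c * coeff m j
    coeff-monomial-⊗ c k j = trans (coeff-≈ (P.*-congʳ {m} (norm-≈ (replicate k 0# ++ [ c ]))) (k ℕ.+ j)) (raw k)
      where
      raw : ∀ k → coeff ((replicate k 0# ++ [ c ]) ⊗ m) (k ℕ.+ j) ≈ c * coeff m j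
      raw zero    = begin
        coeff ([ c ] ⊗ m) j  ≈⟨ coeff-≈ (∷-⊗ c [] m) j ⟩
        coeff (map (c *_) m ⊕ [ 0# ]) j  ≈⟨ coeff-⊕ (map (c *_) m) [ 0# ] j ⟩
        coeff (map (c *_) m) j + coeff [ 0# ] j  ≈⟨ +-cong (coeff-map (c *_) (zeroʳ c) m j) (coeff-≈ (replicate-≈0 1) j) ⟩
        c * coeff m j + 0#  ≈⟨ +-identityʳ _ ⟩
        c * coeff m j  ∎
      raw (suc k) = begin
        coeff ((0# ∷ s) ⊗ m) (suc (k ℕ.+ j))  ≈⟨ coeff-∷-⊗ 0# s m (k ℕ.+ j) ⟩
        0# * coeff m (suc (k ℕ.+ j)) + coeff (s ⊗ m) (k ℕ.+ j)  ≈⟨ trans (+-congʳ (zeroˡ _)) (+-identityˡ _) ⟩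
        coeff (s ⊗ m) (k ℕ.+ j)  ≈⟨ raw k ⟩
        c * coeff m j  ∎
        where
        s : Poly
        s = replicate k 0# ++ [ c ]

    reduce : Poly → Poly
    reduce r = r ⊖ (monomial (lead r) (length r ∸ length m) ⊗ m)

    -- The leading terms cancel since `m` is monic. The predicate `N` turns the cancellation up to
    -- `_≈_` into literal zeros, which `norm` then strips, so every round of division shortens the
    -- list.
    length-reduce : ∀ r → norm r ≡ r → All N r → length m ≤ length r → suc (length (reduce r)) ≤ length r
    length-reduce r nr ns m≤r = ℕP.≤-trans (s≤s (length-norm (k ℕ.+ l) _ (addRaw-All ns (neg-All s)) vanish)) (ℕP.≤-reflexive total)
      where
      k : ℕ
      k = length r ∸ length m
      s : Poly
      s = monomial (lead r) k ⊗ m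
      total : suc (k ℕ.+ l) ≡ length r
      total = ≡.trans (≡.sym (ℕP.+-suc k l)) (≡.trans (≡.cong (k ℕ.+_) (≡.sym length-m)) (ℕP.m∸n+n≡m m≤r))
      lead-coeff : lead r ≡ coeff r (k ℕ.+ l)
      lead-coeff = ≡.trans (lead≡last r) (≡.trans (≡.cong last nr) (≡.trans (last-coeff r) (≡.cong (λ n → coeff r (n ∸ 1)) (≡.sym total))))
      coeffs-agree : ∀ j → l ≤ j → coeff r (k ℕ.+ j) ≈ lead r * coeff m j
      coeffs-agree j l≤j with ℕP.m≤n⇒m<n∨m≡n l≤j
      ... | inj₂ ≡.refl = begin
        coeff r (k ℕ.+ l)  ≡⟨ lead-coeff ⟨
        lead r  ≈⟨ *-identityʳ _ ⟨
        lead r * 1#  ≈⟨ *-congˡ leading ⟨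
        lead r * coeff m l  ∎
      ... | inj₁ l<j = begin
        coeff r (k ℕ.+ j)  ≡⟨ coeff-beyond r (ℕP.≤-trans (ℕP.≤-reflexive (≡.trans (≡.sym total) (≡.sym (ℕP.+-suc k l)))) (ℕP.+-monoʳ-≤ k l<j)) ⟩
        0#  ≈⟨ zeroʳ _ ⟨
        lead r * 0#  ≡⟨ ≡.cong (lead r *_) (coeff-beyond m (ℕP.≤-trans (ℕP.≤-reflexive length-m) l<j)) ⟨
        lead r * coeff m j  ∎
      vanish : ∀ n → k ℕ.+ l ≤ n → coeff (addRaw r (neg s)) n ≈ 0#
      vanish n h = begin
        coeff (addRaw r (neg s)) n  ≈⟨ coeff-norm (addRaw r (neg s)) n ⟨
        coeff (r ⊖ s) n  ≈⟨ trans (coeff-⊕ r (neg s) n) (+-congˡ (coeff-neg s n)) ⟩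
        coeff r n - coeff s n  ≡⟨ ≡.cong (λ n → coeff r n - coeff s n) (≡.sym n≡k+j) ⟩
        coeff r (k ℕ.+ j) - coeff s (k ℕ.+ j)  ≈⟨ +-cong (coeffs-agree j l≤j) (-‿cong (coeff-monomial-⊗ (lead r) k j)) ⟩
        lead r * coeff m j - lead r * coeff m j  ≈⟨ -‿inverseʳ _ ⟩
        0#  ∎
        where
        j : ℕ
        j = n ∸ k
        n≡k+j : k ℕ.+ j ≡ n
        n≡k+j = ℕP.m+[n∸m]≡n (ℕP.≤-trans (ℕP.m≤m+n k l) h)
        l≤j : l ≤ j
        l≤j = ℕP.+-cancelˡ-≤ k l j (ℕP.≤-trans h (ℕP.≤-reflexive (≡.sym n≡k+j)))

    record IsRemainder (x q r : Poly) : Set where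
      constructor remainder
      field
        identity : x ≈ᴾ q ⊗ m ⊕ r
        small    : length r ≤ l
        normal   : norm r ≡ r
        coeffs-N : All N r

    -- A loop invariant: the dividend is always recovered as `qt ⊗ m ⊕ r`. Fuel of at least the
    -- length of `r` suffices because each round shortens `r`.
    divGo-spec : ∀ f qt r → length r ≤ f → norm r ≡ r → All N r →
                 IsRemainder (qt ⊗ m ⊕ r) (proj₁ (divGo m f qt r)) (proj₂ (divGo m f qt r))
    divGo-spec zero    qt []      _   nr ns = remainder P.refl z≤n nr ns
    divGo-spec (suc f) qt r       r≤f nr ns with length r <ᵇ length m in eq
    ... | true  = remainder P.refl (ℕ.s≤s⁻¹ (ℕP.≤-trans (ℕP.<ᵇ⇒< _ _ (≡.subst T (≡.sym eq) tt)) (ℕP.≤-reflexive length-m))) nr ns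
    ... | false with divGo-spec f (qt ⊕ mon) (reduce r) (ℕ.s≤s⁻¹ (ℕP.≤-trans (length-reduce r nr ns m≤r) r≤f))
                       (norm-idem (addRaw r (neg (mon ⊗ m)))) (⊕-All r (neg (mon ⊗ m)) ns (neg-All (mon ⊗ m)))
      where
      mon : Poly
      mon = monomial (lead r) (length r ∸ length m)
      m≤r : length m ≤ length r
      m≤r = ℕP.≮⇒≥ (λ r<m → ≡.subst T eq (ℕP.<⇒<ᵇ r<m))
    ...   | remainder e s n c = remainder (P.trans (split qt _ r m) e) s n c
      where
      split : ∀ qt mon r m → qt ⊗ m ⊕ r ≈ᴾ (qt ⊕ mon) ⊗ m ⊕ (r ⊖ (mon ⊗ m))
      split = P.solve 4 (λ qt mon r m → qt P.:* m P.:+ r P.:= (qt P.:+ mon) P.:* m P.:+ (r P.:- (mon P.:* m))) P.refl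

    divMod-spec : ∀ x → All N x → IsRemainder x (quot x m) (x modP m)
    divMod-spec x ns with divGo-spec (length x) zeroP (norm x) (length-norm≤length x) (norm-idem x) (norm-All ns)
    ... | remainder e s n c = remainder (P.trans (P.sym (P.trans (P.+-identityˡ (norm x)) (norm-≈ x))) e) s n c

    remainder-zero : ∀ {z r} → z ⊗ m ≈ᴾ r → length r ≤ l → z ≈ᴾ []
    remainder-zero {z} {r} e h = quotient-zero z (λ n l≤n → trans (coeff-≈ e n) (reflexive (coeff-beyond r (ℕP.≤-trans h l≤n))))

    quot-exact : ∀ x h → All N x → x ≈ᴾ h ⊗ m → quot x m ≈ᴾ h
    quot-exact x h ns e with divMod-spec x ns
    ... | remainder e′ s n c = P.sym (P.x-y≈0⇒x≈y (remainder-zero {h ⊖ quot x m} {x modP m} (difference (quot x m) (x modP m) (P.trans (P.sym e) e′)) s))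
      where
      difference : ∀ q r → h ⊗ m ≈ᴾ q ⊗ m ⊕ r → (h ⊖ q) ⊗ m ≈ᴾ r
      difference q r e = P.begin
        (h ⊖ q) ⊗ m  P.≈⟨ P.solve 3 (λ h q m → (h P.:- q) P.:* m P.:= h P.:* m P.:- q P.:* m) P.refl h q m ⟩
        h ⊗ m ⊖ q ⊗ m  P.≈⟨ P.+-congʳ e ⟩
        (q ⊗ m ⊕ r) ⊖ q ⊗ m  P.≈⟨ P.solve 2 (λ a r → (a P.:+ r) P.:- a P.:= r) P.refl (q ⊗ m) r ⟩
        r  P.∎

    modP-zero : ∀ x h → All N x → x ≈ᴾ h ⊗ m → x modP m ≡ []
    modP-zero x h ns e with divMod-spec x ns
    ... | remainder e′ s n c = ≡.trans (≡.sym n) (norm≡[] _ c r≈0)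
      where
      q≈h : quot x m ≈ᴾ h
      q≈h = quot-exact x h ns e
      r≈0 : x modP m ≈ᴾ []
      r≈0 = P.begin
        x modP m  P.≈⟨ P.solve 2 (λ r a → r P.:= (a P.:+ r) P.:- a) P.refl (x modP m) (quot x m ⊗ m) ⟩
        (quot x m ⊗ m ⊕ (x modP m)) ⊖ quot x m ⊗ m  P.≈⟨ P.+-cong (P.trans (P.sym e′) e) (P.-‿cong (P.*-congʳ {m} q≈h)) ⟩
        h ⊗ m ⊖ h ⊗ m  P.≈⟨ P.-‿inverseʳ (h ⊗ m) ⟩
        []  P.∎

-- The finite field: c^q = c, binomial coefficients and power sums.

module FiniteFieldTheory (F : FiniteField) where
  private module F = FiniteField F
  open F using (_≟_; elems; complete; unique)

  q : ℕ
  q = length elems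

  fieldRing : CommutativeRing 0ℓ 0ℓ
  fieldRing = record
    { Carrier = F.Carrier ; _≈_ = _≡_ ; _+_ = F._+_ ; _*_ = F._*_ ; -_ = F.-_ ; 0# = F.0# ; 1# = F.1#
    ; isCommutativeRing = F.isCommutativeRing }

  open Tools fieldRing

  unit-≢0 : ∀ {x} → x ≢ 0# → Unit x
  unit-≢0 {x} x≢0 = x F.⁻¹ , ≡.trans (*-comm _ x) (F.inverseʳ x x≢0)

  map-elems-↭ : ∀ (f g : Carrier → Carrier) → (∀ x → g (f x) ≡ x) → (∀ x → f (g x) ≡ x) → map f elems ↭ elems
  map-elems-↭ f g gf fg = ∼bag⇒↭ (unique∧set⇒bag
    (UniqueP.map⁺ (λ {x} {y} e → ≡.trans (≡.sym (gf x)) (≡.trans (≡.cong g e) (gf y))) unique) unique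
    (λ {x} → mk⇔ (λ _ → complete x) (λ _ → ≡.subst (_∈ map f elems) (fg x) (∈P.∈-map⁺ f (complete (g x))))))

  ∑-translate : ∀ c (f : Carrier → Carrier) → ∑ elems (λ x → f (c + x)) ≡ ∑ elems f
  ∑-translate c f = ≡.trans (≡.sym (∑-map (c +_) elems))
    (∑-↭ {f = f} (map-elems-↭ (c +_) (- c +_) (λ x → solve 2 (λ c x → :- c :+ (c :+ x) := x) refl c x)
                                              (λ x → solve 2 (λ c x → c :+ (:- c :+ x) := x) refl c x)))

  -- Translation by 1 permutes the field, so the sum of all 1 + x equals the sum of all x.
  ∑1≡0 : ∑ elems (λ _ → 1#) ≡ 0#
  ∑1≡0 = begin
    ∑ elems (λ _ → 1#)  ≡⟨ solve 2 (λ a b → a := (a :+ b) :- b) refl _ s ⟩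
    (∑ elems (λ _ → 1#) + s) - s  ≡⟨ ≡.cong (_- s) (∑-+ elems (λ _ → 1#) id) ⟨
    ∑ elems (λ x → 1# + x) - s  ≡⟨ ≡.cong (_- s) (∑-translate 1# id) ⟩
    s - s  ≡⟨ -‿inverseʳ s ⟩
    0#  ∎
    where
    s : Carrier
    s = ∑ elems id

  private
    split-0 : ∃ λ rest → elems ↭ 0# ∷ rest
    split-0 with ∈P.∈-∃++ (complete 0#)
    ... | ys , zs , e = ys ++ zs , ↭-trans (↭-reflexive e) (PermP.shift 0# ys zs)

  nonzeros : List Carrier
  nonzeros = proj₁ split-0

  elems-↭ : elems ↭ 0# ∷ nonzeros
  elems-↭ = proj₂ split-0

  q-1 : ℕ
  q-1 = length nonzeros

  q≡ : q ≡ suc q-1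
  q≡ = PermP.↭-length elems-↭

  nonzeros-≢0 : ∀ {x} → x ∈ nonzeros → x ≢ 0#
  nonzeros-≢0 x∈ ≡.refl with PermS.Unique-resp-↭ (≡.setoid _) (Perm.↭⇒↭ₛ elems-↭) unique
  ... | 0∉ AllPairs.∷ _ = All.lookup 0∉ x∈ ≡.refl

  1≤q-1 : 1 ≤ q-1
  1≤q-1 with nonzeros | PermP.∈-resp-↭ elems-↭ (complete 1#)
  ... | []     | here 1≡0 = ⊥-elim (F.0≢1 (≡.sym 1≡0))
  ... | x ∷ xs | _        = s≤s z≤n

  2≤q : 2 ≤ q
  2≤q = ℕP.≤-trans (s≤s 1≤q-1) (ℕP.≤-reflexive (≡.sym q≡))

  i<q^i : ∀ i → i < q ℕ.^ i
  i<q^i zero    = s≤s z≤n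
  i<q^i (suc i) = ℕP.≤-trans (ℕP.+-mono-≤ (ℕP.≤-trans (s≤s z≤n) (i<q^i i)) (ℕP.≤-trans (i<q^i i) (ℕP.m≤m+n _ 0)))
                             (ℕP.*-monoˡ-≤ (q ℕ.^ i) 2≤q)

  -- Multiplication by c permutes the field and fixes 0, hence permutes `nonzeros`; compare the
  -- products before and after, and cancel.
  c^[q-1]≡1 : ∀ {c} → c ≢ 0# → c ^ q-1 ≡ 1#
  c^[q-1]≡1 {c} c≢0 = unit-cancelˡ (unit-∏ nonzeros id (unit-≢0 ∘ nonzeros-≢0)) (begin
    ∏ nonzeros id * c ^ q-1  ≡⟨ *-comm _ _ ⟩
    c ^ q-1 * ∏ nonzeros id  ≡⟨ *-congʳ (∏-constant nonzeros) ⟨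
    ∏ nonzeros (λ _ → c) * ∏ nonzeros id  ≡⟨ ∏-* nonzeros (λ _ → c) id ⟨
    ∏ nonzeros (c *_)  ≡⟨ ∏-map (c *_) nonzeros ⟨
    ∏ (map (c *_) nonzeros) id  ≡⟨ ∏-↭ (PermP.drop-∷ permuted) ⟩
    ∏ nonzeros id  ≡⟨ *-identityʳ _ ⟨
    ∏ nonzeros id * 1#  ∎)
    where
    ∏-constant : ∀ (xs : List Carrier) → ∏ xs (λ _ → c) ≡ c ^ length xs
    ∏-constant []       = ≡.refl
    ∏-constant (x ∷ xs) = ≡.cong (c *_) (∏-constant xs)
    c⁻¹ : Carrier
    c⁻¹ = c F.⁻¹
    permuted : 0# ∷ map (c *_) nonzeros ↭ 0# ∷ nonzeros
    permuted = ↭-trans (↭-reflexive (≡.cong (_∷ map (c *_) nonzeros) (≡.sym (zeroʳ c))))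
      (↭-trans (↭-sym (PermP.map⁺ (c *_) elems-↭)) (↭-trans
        (map-elems-↭ (c *_) (c⁻¹ *_) (λ x → ≡.trans (≡.sym (*-assoc c⁻¹ c x)) (≡.trans (≡.cong (_* x) (proj₂ (unit-≢0 c≢0))) (*-identityˡ x)))
                                     (λ x → ≡.trans (≡.sym (*-assoc c c⁻¹ x)) (≡.trans (≡.cong (_* x) (F.inverseʳ c c≢0)) (*-identityˡ x))))
        elems-↭))

  c^q≡c : ∀ c → c ^ q ≡ c
  c^q≡c c = ≡.trans (≡.cong (c ^_) q≡) lemma
    where
    lemma : c * c ^ q-1 ≡ c
    lemma with c ≟ 0#
    ... | yes ≡.refl = zeroˡ _
    ... | no c≢0     = ≡.trans (≡.cong (c *_) (c^[q-1]≡1 c≢0)) (*-identityʳ c)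

  powerSum : ℕ → Carrier
  powerSum k = ∑ elems (_^ k)

  powerSum-q-1 : powerSum q-1 ≡ - 1#
  powerSum-q-1 = begin
    ∑ elems (_^ q-1)  ≡⟨ ∑-↭ elems-↭ ⟩
    0# ^ q-1 + ∑ nonzeros (_^ q-1)  ≡⟨ ≡.cong₂ _+_ (0^n≈0 q-1 1≤q-1) (∑-cong-∈ nonzeros (c^[q-1]≡1 ∘ nonzeros-≢0)) ⟩
    0# + ∑ nonzeros (λ _ → 1#)  ≡⟨ solve 2 (λ a b → :0# :+ b := (:1# :+ b) :- :1#) refl 0# _ ⟩
    (1# + ∑ nonzeros (λ _ → 1#)) - 1#  ≡⟨ ≡.cong (_- 1#) (∑-↭ elems-↭) ⟨
    ∑ elems (λ _ → 1#) - 1#  ≡⟨ ≡.cong (_- 1#) ∑1≡0 ⟩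
    0# - 1#  ≡⟨ +-identityˡ _ ⟩
    - 1#  ∎

  horner : List Carrier → Carrier → Carrier
  horner []      x = 0#
  horner (a ∷ p) x = a + x * horner p x

  syntheticQuotient : Carrier → List Carrier → List Carrier
  syntheticQuotient c []          = []
  syntheticQuotient c (a ∷ [])    = []
  syntheticQuotient c (a ∷ b ∷ p) = horner (b ∷ p) c ∷ syntheticQuotient c (b ∷ p)

  length-syntheticQuotient : ∀ c a p → length (syntheticQuotient c (a ∷ p)) ≡ length p
  length-syntheticQuotient c a []      = ≡.refl
  length-syntheticQuotient c a (b ∷ p) = ≡.cong suc (length-syntheticQuotient c b p)

  horner-difference : ∀ c p x → horner p x - horner p c ≡ (x - c) * horner (syntheticQuotient c p) x
  horner-difference c []          x = solve 2 (λ x c → :0# :- :0# := (x :- c) :* :0#) refl x c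
  horner-difference c (a ∷ [])    x = solve 3 (λ a x c → (a :+ x :* :0#) :- (a :+ c :* :0#) := (x :- c) :* :0#) refl a x c
  horner-difference c (a ∷ b ∷ p) x = begin
    (a + x * hx) - (a + c * hc)  ≡⟨ solve 5 (λ a x c hx hc → (a :+ x :* hx) :- (a :+ c :* hc) := (x :- c) :* hc :+ x :* (hx :- hc)) refl a x c hx hc ⟩
    (x - c) * hc + x * (hx - hc)  ≡⟨ ≡.cong (λ d → (x - c) * hc + x * d) (horner-difference c (b ∷ p) x) ⟩
    (x - c) * hc + x * ((x - c) * r)  ≡⟨ solve 4 (λ x c hc r → (x :- c) :* hc :+ x :* ((x :- c) :* r) := (x :- c) :* (hc :+ x :* r)) refl x c hc r ⟩
    (x - c) * (hc + x * r)  ∎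
    where
    hx hc r : Carrier
    hx = horner (b ∷ p) x
    hc = horner (b ∷ p) c
    r  = horner (syntheticQuotient c (b ∷ p)) x

  horner-zeros : ∀ {p} x → All (_≡ 0#) p → horner p x ≡ 0#
  horner-zeros x []            = ≡.refl
  horner-zeros x (≡.refl ∷ zs) = ≡.trans (+-identityˡ _) (≡.trans (≡.cong (x *_) (horner-zeros x zs)) (zeroʳ x))

  syntheticQuotient-zeros : ∀ c p → horner p c ≡ 0# → All (_≡ 0#) (syntheticQuotient c p) → All (_≡ 0#) p
  syntheticQuotient-zeros c []          _ _        = []
  syntheticQuotient-zeros c (a ∷ [])    h _        = ≡.trans (solve 2 (λ a c → a := a :+ c :* :0#) refl a c) h ∷ []
  syntheticQuotient-zeros c (a ∷ b ∷ p) h (z ∷ zs) = a≡0 ∷ tail≡0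
    where
    tail≡0 : All (_≡ 0#) (b ∷ p)
    tail≡0 = syntheticQuotient-zeros c (b ∷ p) z zs
    a≡0 : a ≡ 0#
    a≡0 = ≡.trans (solve 2 (λ a c → a := a :+ c :* :0#) refl a c) (≡.trans (≡.cong (λ y → a + c * y) (≡.sym z)) h)

  -- Synthetic division by X - c consumes one root and one coefficient. The other roots remain roots
  -- of the quotient because x - c is a unit for x different from c.
  zero-polynomial : ∀ p cs → Unique cs → length p ≤ length cs → (∀ {c} → c ∈ cs → horner p c ≡ 0#) → All (_≡ 0#) p
  zero-polynomial []      cs       _                 _       _ = []
  zero-polynomial (a ∷ p) (c ∷ cs) (c∉ AllPairs.∷ u) (s≤s l) h =
    syntheticQuotient-zeros c (a ∷ p) (h (here ≡.refl))
      (zero-polynomial _ cs u (ℕP.≤-trans (ℕP.≤-reflexive (length-syntheticQuotient c a p)) l) root)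
    where
    root : ∀ {x} → x ∈ cs → horner (syntheticQuotient c (a ∷ p)) x ≡ 0#
    root {x} x∈ = unit-cancelˡ (unit-≢0 (λ e → All.lookup c∉ x∈ (≡.sym (x-y≈0⇒x≈y e)))) (begin
      (x - c) * horner (syntheticQuotient c (a ∷ p)) x  ≡⟨ horner-difference c (a ∷ p) x ⟨
      horner (a ∷ p) x - horner (a ∷ p) c  ≡⟨ ≡.cong₂ _-_ (h (there x∈)) (h (here ≡.refl)) ⟩
      0# - 0#  ≡⟨ -‿inverseʳ 0# ⟩
      0#  ≡⟨ zeroʳ _ ⟨
      (x - c) * 0#  ∎)

  -- Degree below q and q roots. Identities valid at every field element thus become identities
  -- between coefficients; the vanishing of binomial coefficients and power sums below is obtained
  -- in this way.
  coefficients-zero : ∀ n f → n ≤ q → (∀ c → ∑ (upTo n) (λ k → c ^ k * f k) ≡ 0#) → ∀ {k} → k < n → f k ≡ 0#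
  coefficients-zero n f n≤q h k<n = AllP.applyUpTo⁻ f n
    (zero-polynomial (applyUpTo f n) elems unique (ℕP.≤-trans (ℕP.≤-reflexive (LP.length-applyUpTo f n)) n≤q)
      (λ {c} _ → ≡.trans (horner-applyUpTo n f c) (h c))) k<n
    where
    horner-applyUpTo : ∀ n f c → horner (applyUpTo f n) c ≡ ∑ (upTo n) (λ k → c ^ k * f k)
    horner-applyUpTo zero    f c = ≡.refl
    horner-applyUpTo (suc n) f c = begin
      f 0 + c * horner (applyUpTo (f ∘ suc) n) c  ≡⟨ ≡.cong (λ s → f 0 + c * s) (horner-applyUpTo n (f ∘ suc) c) ⟩
      f 0 + c * ∑ (upTo n) (λ k → c ^ k * f (suc k))  ≡⟨ ≡.cong₂ _+_ (≡.sym (*-identityˡ (f 0))) (∑-*ˡ (upTo n) c _) ⟩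
      1# * f 0 + ∑ (upTo n) (λ k → c * (c ^ k * f (suc k)))  ≡⟨ +-congˡ (∑-cong (upTo n) (λ k → *-assoc c (c ^ k) _)) ⟨
      1# * f 0 + ∑ (upTo n) (λ k → c ^ suc k * f (suc k))  ≡⟨ ∑-head n (λ k → c ^ k * f k) ⟨
      ∑ (upTo (suc n)) (λ k → c ^ k * f k)  ∎

  -- (c + 1)^q − c^q − 1 vanishes at all q elements c but has degree < q.
  binomial-vanishes : ∀ {k} → k < q-1 → nat (q C suc k) ≡ 0#
  binomial-vanishes {k} k<q-1 = coefficients-zero (suc q-1) f (ℕP.≤-reflexive (≡.sym q≡)) vanish {suc k} (s≤s k<q-1)
    where
    f : ℕ → Carrier
    f zero    = 0#
    f (suc k) = nat (q C suc k)
    vanish : ∀ c → ∑ (upTo (suc q-1)) (λ k → c ^ k * f k) ≡ 0#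
    vanish c = begin
      ∑ (upTo (suc q-1)) (λ k → c ^ k * f k)  ≡⟨ ∑-head q-1 (λ k → c ^ k * f k) ⟩
      1# * 0# + middle  ≡⟨ solve 3 (λ a m c → :1# :* :0# :+ m := ((:1# :+ m) :+ c) :- (c :+ :1#)) refl 0# middle c ⟩
      ((1# + middle) + c) - (c + 1#)  ≡⟨ ≡.cong₂ _-_ (≡.trans (≡.cong₂ _+_ low high) (≡.sym (∑-last (suc q-1) t))) (≡.sym (c^q≡c (c + 1#))) ⟩
      ∑ (upTo (suc (suc q-1))) t - (c + 1#) ^ q  ≡⟨ ≡.cong (λ n → ∑ (upTo (suc n)) t - (c + 1#) ^ q) (≡.sym q≡) ⟩
      ∑ (upTo (suc q)) t - (c + 1#) ^ q  ≡⟨ +-congʳ (≡.sym (binomial q c 1#)) ⟩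
      (c + 1#) ^ q - (c + 1#) ^ q  ≡⟨ -‿inverseʳ _ ⟩
      0#  ∎
      where
      t : ℕ → Carrier
      t k = c ^ k * 1# ^ (q ∸ k) * nat (q C k)
      t≡ : ∀ k → c ^ k * nat (q C k) ≡ t k
      t≡ k = ≡.cong (_* nat (q C k)) (≡.sym (≡.trans (≡.cong (c ^ k *_) (1^n≈1 (q ∸ k))) (*-identityʳ _)))
      middle : Carrier
      middle = ∑ (upTo q-1) (λ k → c ^ suc k * f (suc k))
      low : 1# + middle ≡ ∑ (upTo (suc q-1)) t
      low = begin
        1# + middle  ≡⟨ ≡.cong₂ _+_ (solve 1 (λ a → :1# := :1# :* (:1# :+ :0#)) refl 0#) (∑-cong (upTo q-1) (t≡ ∘ suc)) ⟩
        1# * nat (q C 0) + ∑ (upTo q-1) (t ∘ suc)  ≡⟨ +-congʳ (t≡ 0) ⟩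
        t 0 + ∑ (upTo q-1) (t ∘ suc)  ≡⟨ ∑-head q-1 t ⟨
        ∑ (upTo (suc q-1)) t  ∎
      high : c ≡ t (suc q-1)
      high = begin
        c  ≡⟨ c^q≡c c ⟨
        c ^ q  ≡⟨ solve 1 (λ a → a := a :* (:1# :+ :0#)) refl (c ^ q) ⟩
        c ^ q * nat 1  ≡⟨ ≡.cong (λ n → c ^ q * nat n) (nCn≡1 q) ⟨
        c ^ q * nat (q C q)  ≡⟨ t≡ q ⟩
        t q  ≡⟨ ≡.cong t q≡ ⟩
        t (suc q-1)  ∎

  -- ∑_c (x + c)^{q-1} is independent of x, so its coefficients in positive degree are 0.
  powerSum-binomial : ∀ {k} → k < q-1 → powerSum (q-1 ∸ suc k) * nat (q-1 C suc k) ≡ 0#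
  powerSum-binomial {k} k<q-1 = coefficients-zero (suc q-1) f (ℕP.≤-reflexive (≡.sym q≡)) vanish {suc k} (s≤s k<q-1)
    where
    g f : ℕ → Carrier
    g k = powerSum (q-1 ∸ k) * nat (q-1 C k)
    f zero    = 0#
    f (suc k) = g (suc k)
    g0 : g 0 ≡ - 1#
    g0 = ≡.trans (≡.cong (_* nat 1) powerSum-q-1) (solve 1 (λ a → (:- :1#) :* (:1# :+ :0#) := :- :1#) refl 0#)
    expand : ∀ x → ∑ elems (λ c → (x + c) ^ q-1) ≡ ∑ (upTo (suc q-1)) (λ k → x ^ k * g k)
    expand x = begin
      ∑ elems (λ c → (x + c) ^ q-1)
        ≡⟨ ∑-cong elems (λ c → binomial q-1 x c) ⟩
      ∑ elems (λ c → ∑ (upTo (suc q-1)) (λ k → x ^ k * c ^ (q-1 ∸ k) * nat (q-1 C k)))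
        ≡⟨ ∑-swap elems (upTo (suc q-1)) _ ⟩
      ∑ (upTo (suc q-1)) (λ k → ∑ elems (λ c → x ^ k * c ^ (q-1 ∸ k) * nat (q-1 C k)))
        ≡⟨ ∑-cong (upTo (suc q-1)) (λ k → ≡.trans (∑-cong elems (λ c → *-assoc (x ^ k) (c ^ (q-1 ∸ k)) _))
             (≡.trans (≡.sym (∑-*ˡ elems (x ^ k) _)) (≡.cong (x ^ k *_) (≡.sym (∑-*ʳ elems _ (λ c → c ^ (q-1 ∸ k))))))) ⟩
      ∑ (upTo (suc q-1)) (λ k → x ^ k * g k) ∎
    vanish : ∀ x → ∑ (upTo (suc q-1)) (λ k → x ^ k * f k) ≡ 0#
    vanish x = begin
      ∑ (upTo (suc q-1)) (λ k → x ^ k * f k)  ≡⟨ ∑-head q-1 (λ k → x ^ k * f k) ⟩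
      1# * 0# + rest  ≡⟨ solve 2 (λ a m → :1# :* :0# :+ m := (:1# :* (:- :1#) :+ m) :+ :1#) refl 0# rest ⟩
      (1# * - 1# + rest) + 1#  ≡⟨ ≡.cong (λ a → (1# * a + rest) + 1#) g0 ⟨
      (1# * g 0 + rest) + 1#  ≡⟨ ≡.cong (_+ 1#) (∑-head q-1 (λ k → x ^ k * g k)) ⟨
      ∑ (upTo (suc q-1)) (λ k → x ^ k * g k) + 1#  ≡⟨ ≡.cong (_+ 1#) (expand x) ⟨
      ∑ elems (λ c → (x + c) ^ q-1) + 1#  ≡⟨ ≡.cong (_+ 1#) (≡.trans (∑-translate x (_^ q-1)) powerSum-q-1) ⟩
      - 1# + 1#  ≡⟨ -‿inverseˡ 1# ⟩
      0#  ∎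
      where
      rest : Carrier
      rest = ∑ (upTo q-1) (λ k → x ^ suc k * g (suc k))

-- Frobenius on algebras over the finite field.

module FieldAlgebra (F : FiniteField) (R : CommutativeRing 0ℓ 0ℓ) (ι : Hom (FiniteFieldTheory.fieldRing F) R) where
  open FiniteFieldTheory F using (q; q-1; q≡; c^q≡c; powerSum; powerSum-q-1; binomial-vanishes; powerSum-binomial)
  open FiniteField F using (elems) renaming (_*_ to _*ᶠ_)
  open Tools R
  private
    module ι = Hom ι
    module K = Tools (FiniteFieldTheory.fieldRing F)

  -- The middle binomial coefficients vanish already in the field, and `ι` carries them to the
  -- algebra.
  +-^q : ∀ x y → (x + y) ^ q ≈ x ^ q + y ^ q
  +-^q x y = begin
    (x + y) ^ q  ≈⟨ binomial q x y ⟩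
    ∑ (upTo (suc q)) t  ≈⟨ ∑-last q t ⟩
    ∑ (upTo q) t + t q  ≡⟨ ≡.cong (λ n → ∑ (upTo n) t + t q) q≡ ⟩
    ∑ (upTo (suc q-1)) t + t q  ≈⟨ +-congʳ (∑-head q-1 t) ⟩
    (t 0 + ∑ (upTo q-1) (t ∘ suc)) + t q  ≈⟨ +-cong (+-cong first middle) final ⟩
    (y ^ q + 0#) + x ^ q  ≈⟨ solve 2 (λ a b → (a :+ :0#) :+ b := b :+ a) refl _ _ ⟩
    x ^ q + y ^ q  ∎
    where
    t : ℕ → Carrier
    t k = x ^ k * y ^ (q ∸ k) * nat (q C k)
    first : t 0 ≈ y ^ q
    first = solve 1 (λ a → :1# :* a :* (:1# :+ :0#) := a) refl _
    final : t q ≈ x ^ q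
    final = begin
      x ^ q * y ^ (q ∸ q) * nat (q C q)  ≡⟨ ≡.cong₂ (λ a b → x ^ q * y ^ a * nat b) (ℕP.n∸n≡0 q) (nCn≡1 q) ⟩
      x ^ q * 1# * (1# + 0#)  ≈⟨ solve 1 (λ a → a :* :1# :* (:1# :+ :0#) := a) refl _ ⟩
      x ^ q  ∎
    middle : ∑ (upTo q-1) (t ∘ suc) ≈ 0#
    middle = trans (∑-cong-∈ (upTo q-1) (λ {k} k∈ → trans (*-congˡ (nat≈0 (∈P.∈-upTo⁻ k∈))) (zeroʳ _))) (∑-0 (upTo q-1))
      where
      nat≈0 : ∀ {k} → k < q-1 → nat (q C suc k) ≈ 0#
      nat≈0 {k} h = trans (sym (ι.nat-homo (q C suc k))) (trans (ι.⟦⟧-cong (binomial-vanishes h)) ι.0-homo)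

  -- After binomial expansion the coefficient of x^k is a power sum times a binomial coefficient,
  -- which is 0 for k ≥ 1 and -1 for k = 0. It evaluates the sum over the top coefficient in
  -- `e*∑-inverses`.
  ∑-[x+cy]^[q-1] : ∀ x y → ∑ elems (λ c → (x + ι.⟦ c ⟧ * y) ^ q-1) ≈ - (y ^ q-1)
  ∑-[x+cy]^[q-1] x y = begin
    ∑ elems (λ c → (x + ι.⟦ c ⟧ * y) ^ q-1)  ≈⟨ ∑-cong elems (λ c → binomial q-1 x (ι.⟦ c ⟧ * y)) ⟩
    ∑ elems (λ c → ∑ (upTo (suc q-1)) (λ k → t k c))  ≈⟨ ∑-swap elems (upTo (suc q-1)) (λ c k → t k c) ⟩
    ∑ (upTo (suc q-1)) (λ k → ∑ elems (t k))  ≈⟨ ∑-cong (upTo (suc q-1)) collect ⟩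
    ∑ (upTo (suc q-1)) s  ≈⟨ ∑-head q-1 s ⟩
    s 0 + ∑ (upTo q-1) (s ∘ suc)  ≈⟨ +-cong first (trans (∑-cong-∈ (upTo q-1) (λ k∈ → rest (∈P.∈-upTo⁻ k∈))) (∑-0 (upTo q-1))) ⟩
    - (y ^ q-1) + 0#  ≈⟨ +-identityʳ _ ⟩
    - (y ^ q-1)  ∎
    where
    t : ℕ → K.Carrier → Carrier
    t k c = x ^ k * (ι.⟦ c ⟧ * y) ^ (q-1 ∸ k) * nat (q-1 C k)
    s : ℕ → Carrier
    s k = x ^ k * y ^ (q-1 ∸ k) * ι.⟦ powerSum (q-1 ∸ k) *ᶠ K.nat (q-1 C k) ⟧
    collect : ∀ k → ∑ elems (t k) ≈ s k
    collect k = begin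
      ∑ elems (t k)
        ≈⟨ ∑-cong elems (λ c → trans (*-congʳ (*-congˡ (trans (^-distrib-* ι.⟦ c ⟧ y j) (*-congʳ (sym (ι.^-homo c j))))))
             (solve 4 (λ a b c d → a :* (b :* c) :* d := (a :* c) :* (b :* d)) refl _ _ _ _)) ⟩
      ∑ elems (λ c → x ^ k * y ^ j * (ι.⟦ c K.^ j ⟧ * n))  ≈⟨ ∑-*ˡ elems (x ^ k * y ^ j) _ ⟨
      x ^ k * y ^ j * ∑ elems (λ c → ι.⟦ c K.^ j ⟧ * n)  ≈⟨ *-congˡ (∑-*ʳ elems n _) ⟨
      x ^ k * y ^ j * (∑ elems (λ c → ι.⟦ c K.^ j ⟧) * n)  ≈⟨ *-congˡ (*-cong (ι.∑-homo elems (K._^ j)) (ι.nat-homo (q-1 C k))) ⟨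
      x ^ k * y ^ j * (ι.⟦ powerSum j ⟧ * ι.⟦ K.nat (q-1 C k) ⟧)  ≈⟨ *-congˡ (ι.*-homo _ _) ⟨
      s k  ∎
      where
      j : ℕ
      j = q-1 ∸ k
      n : Carrier
      n = nat (q-1 C k)
    first : s 0 ≈ - (y ^ q-1)
    first = begin
      1# * y ^ q-1 * ι.⟦ powerSum q-1 *ᶠ K.nat 1 ⟧
        ≈⟨ *-congˡ (ι.⟦⟧-cong (≡.trans (≡.cong (_*ᶠ K.nat 1) powerSum-q-1) (K.trans (K.*-congˡ (K.+-identityʳ K.1#)) (K.*-identityʳ _)))) ⟩
      1# * y ^ q-1 * ι.⟦ K.- K.1# ⟧  ≈⟨ *-congˡ (trans (ι.neg-homo K.1#) (-‿cong ι.1-homo)) ⟩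
      1# * y ^ q-1 * - 1#  ≈⟨ solve 1 (λ a → :1# :* a :* (:- :1#) := :- a) refl _ ⟩
      - (y ^ q-1)  ∎
    rest : ∀ {k} → k < q-1 → s (suc k) ≈ 0#
    rest h = trans (*-congˡ (trans (ι.⟦⟧-cong (powerSum-binomial h)) ι.0-homo)) (zeroʳ _)

  ^q^-suc : ∀ x d → x ^ (q ℕ.^ suc d) ≈ (x ^ (q ℕ.^ d)) ^ q
  ^q^-suc x d = trans (^-congʳ x (ℕP.*-comm q (q ℕ.^ d))) (sym (^-assocʳ x (q ℕ.^ d) q))

  ^q^-+ : ∀ x d e → (x ^ (q ℕ.^ d)) ^ (q ℕ.^ e) ≈ x ^ (q ℕ.^ (d ℕ.+ e))
  ^q^-+ x d e = trans (^-assocʳ x (q ℕ.^ d) (q ℕ.^ e)) (^-congʳ x (≡.sym (ℕP.^-distribˡ-+-* q d e)))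

  frobenius : ℕ → Hom R R
  frobenius d = record
    { ⟦_⟧     = _^ (q ℕ.^ d)
    ; ⟦⟧-cong = ^-congˡ (q ℕ.^ d)
    ; +-homo  = additive d
    ; *-homo  = λ x y → ^-distrib-* x y (q ℕ.^ d)
    ; 1-homo  = 1^n≈1 (q ℕ.^ d)
    }
    where
    additive : ∀ d x y → (x + y) ^ (q ℕ.^ d) ≈ x ^ (q ℕ.^ d) + y ^ (q ℕ.^ d)
    additive zero    x y = solve 2 (λ a b → (a :+ b) :* :1# := a :* :1# :+ b :* :1#) refl x y
    additive (suc d) x y = begin
      (x + y) ^ (q ℕ.^ suc d)  ≈⟨ ^q^-suc (x + y) d ⟩
      ((x + y) ^ (q ℕ.^ d)) ^ q  ≈⟨ ^-congˡ q (additive d x y) ⟩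
      (x ^ (q ℕ.^ d) + y ^ (q ℕ.^ d)) ^ q  ≈⟨ +-^q _ _ ⟩
      (x ^ (q ℕ.^ d)) ^ q + (y ^ (q ℕ.^ d)) ^ q  ≈⟨ +-cong (^q^-suc x d) (^q^-suc y d) ⟨
      x ^ (q ℕ.^ suc d) + y ^ (q ℕ.^ suc d)  ∎

  frobenius-ι : ∀ d c → ι.⟦ c ⟧ ^ (q ℕ.^ d) ≈ ι.⟦ c ⟧
  frobenius-ι zero    c = *-identityʳ _
  frobenius-ι (suc d) c = begin
    ι.⟦ c ⟧ ^ (q ℕ.^ suc d)  ≈⟨ ^q^-suc ι.⟦ c ⟧ d ⟩
    (ι.⟦ c ⟧ ^ (q ℕ.^ d)) ^ q  ≈⟨ ^-congˡ q (frobenius-ι d c) ⟩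
    ι.⟦ c ⟧ ^ q  ≈⟨ ι.^-homo c q ⟨
    ι.⟦ c K.^ q ⟧  ≈⟨ ι.⟦⟧-cong (c^q≡c c) ⟩
    ι.⟦ c ⟧  ∎

-- Carlitz's D and L, the polynomials e_d and their generating function, in an arbitrary algebra.

record CarlitzData (F : FiniteField) (R : CommutativeRing 0ℓ 0ℓ) : Set where
  open FiniteFieldTheory F using (q; fieldRing)
  open Tools R
  field
    ι     : Hom fieldRing R
    θ     : Carrier
    D L   : ℕ → Carrier
    D-0   : D 0 ≈ 1#
    D-suc : ∀ d → D (suc d) ≈ (θ ^ (q ℕ.^ suc d) - θ) * D d ^ q
    L-0   : L 0 ≈ 1#
    L-suc : ∀ d → L (suc d) ≈ (θ - θ ^ (q ℕ.^ suc d)) * L d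

-- Recording D and L by their recursions makes them portable along homomorphisms: from A to A/(P),
-- and from there to constant power series.
mapCarlitzData : ∀ {F R S} → Hom R S → CarlitzData F R → CarlitzData F S
mapCarlitzData {F} {R} {S} h C = record
  { ι     = h ∘ʰ C.ι
  ; θ     = ⟦ C.θ ⟧
  ; D     = ⟦_⟧ ∘ C.D
  ; L     = ⟦_⟧ ∘ C.L
  ; D-0   = trans (⟦⟧-cong C.D-0) 1-homo
  ; D-suc = λ d → trans (⟦⟧-cong (C.D-suc d)) (trans (*-homo _ _)
      (*-cong (trans (sub-homo _ _) (+-congʳ (^-homo C.θ (q ℕ.^ suc d)))) (^-homo (C.D d) q)))
  ; L-0   = trans (⟦⟧-cong C.L-0) 1-homo
  ; L-suc = λ d → trans (⟦⟧-cong (C.L-suc d)) (trans (*-homo _ _)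
      (*-congʳ (trans (sub-homo _ _) (+-congˡ (-‿cong (^-homo C.θ (q ℕ.^ suc d)))))))
  }
  where
  module C = CarlitzData C
  open Hom h
  open Tools S
  open FiniteFieldTheory F using (q)

module Carlitz (F : FiniteField) (R : CommutativeRing 0ℓ 0ℓ) (C : CarlitzData F R) where
  open FiniteFieldTheory F using (q; q-1; q≡; fieldRing; ∑1≡0)
  open FiniteField F using (elems; _≟_) renaming (Carrier to 𝔽; 1# to 1ᶠ)
  open Setup F using (vecs)
  open CarlitzData C public
  open Tools R
  open FieldAlgebra F R ι
  open Evaluation fieldRing _≟_ R ι θ
  private
    module ι = Hom ι
    module Frob d = Hom (frobenius d)

  infix 9 _^[_]
  _^[_] : Carrier → ℕ → Carrier
  x ^[ d ] = x ^ (q ℕ.^ d)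

  -- Carlitz's bracket [d].
  ⟨_⟩ : ℕ → Carrier
  ⟨ d ⟩ = θ ^[ d ] - θ

  ^q≈ : ∀ x → x ^ q ≈ x * x ^ q-1
  ^q≈ x = reflexive (≡.cong (x ^_) q≡)

  ^[1]≈ : ∀ x → x ^[ 1 ] ≈ x ^ q
  ^[1]≈ x = ^-congʳ x (ℕP.*-identityʳ q)

  -‿^q : ∀ x y → (x - y) ^ q ≈ x ^ q - y ^ q
  -‿^q x y = trans (sym (^[1]≈ _)) (trans (Frob.sub-homo 1 x y) (+-cong (^[1]≈ x) (-‿cong (^[1]≈ y))))

  -- e d y = ∏ (y − a) over the polynomials a of degree < d.
  e : ℕ → Carrier → Carrier
  e zero    y = y
  e (suc d) y = e d y ^ q - D d ^ q-1 * e d y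

  e-cong : ∀ d {x y} → x ≈ y → e d x ≈ e d y
  e-cong zero    p = p
  e-cong (suc d) p = +-cong (^-congˡ q (e-cong d p)) (-‿cong (*-congˡ (e-cong d p)))

  e-+ : ∀ d x y → e d (x + y) ≈ e d x + e d y
  e-+ zero    x y = refl
  e-+ (suc d) x y = begin
    e d (x + y) ^ q - w * e d (x + y)  ≈⟨ +-cong (trans (^-congˡ q (e-+ d x y)) (+-^q _ _)) (-‿cong (*-congˡ (e-+ d x y))) ⟩
    (e d x ^ q + e d y ^ q) - w * (e d x + e d y)
      ≈⟨ solve 5 (λ a b w x y → (a :+ b) :- w :* (x :+ y) := (a :- w :* x) :+ (b :- w :* y)) refl _ _ _ _ _ ⟩
    e (suc d) x + e (suc d) y  ∎
    where
    w : Carrier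
    w = D d ^ q-1

  e-ι : ∀ d c x → e d (ι.⟦ c ⟧ * x) ≈ ι.⟦ c ⟧ * e d x
  e-ι zero    c x = refl
  e-ι (suc d) c x = begin
    e d (ι.⟦ c ⟧ * x) ^ q - w * e d (ι.⟦ c ⟧ * x)  ≈⟨ +-cong (^-congˡ q (e-ι d c x)) (-‿cong (*-congˡ (e-ι d c x))) ⟩
    (ι.⟦ c ⟧ * e d x) ^ q - w * (ι.⟦ c ⟧ * e d x)  ≈⟨ +-congʳ (trans (^-distrib-* _ _ q) (*-congʳ (trans (sym (^[1]≈ _)) (frobenius-ι 1 c)))) ⟩
    ι.⟦ c ⟧ * e d x ^ q - w * (ι.⟦ c ⟧ * e d x)
      ≈⟨ solve 4 (λ c a w x → c :* a :- w :* (c :* x) := c :* (a :- w :* x)) refl _ _ _ _ ⟩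
    ι.⟦ c ⟧ * e (suc d) x  ∎
    where
    w : Carrier
    w = D d ^ q-1

  e-neg : ∀ d x → e d (- x) ≈ - e d x
  e-neg d x = begin
    e d (- x)  ≈⟨ solve 2 (λ a b → b := (:- a) :+ (a :+ b)) refl (e d x) _ ⟩
    - e d x + (e d x + e d (- x))  ≈⟨ +-congˡ (e-+ d x (- x)) ⟨
    - e d x + e d (x - x)  ≈⟨ +-congˡ (trans (e-cong d x-x≈) (trans (e-ι d _ 0#) (trans (*-congʳ ι.0-homo) (zeroˡ _)))) ⟩
    - e d x + 0#  ≈⟨ +-identityʳ _ ⟩
    - e d x  ∎
    where
    x-x≈ : x - x ≈ ι.⟦ FiniteField.0# F ⟧ * 0#
    x-x≈ = trans (-‿inverseʳ x) (sym (zeroʳ _))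

  -- The commutation rule that makes e_d(θ^d) satisfy the recursion of D. In the induction θ^q is
  -- written through brackets and (a^q)^q through b^q and a^q; the remaining multiple of a^q has
  -- coefficient zero by `weights`, which is the recursion of D raised to the power q - 1 and
  -- multiplied by a bracket.
  e-θ : ∀ d y → e (suc d) (θ * y) ≈ θ * e (suc d) y + ⟨ suc d ⟩ * e d y ^ q
  e-θ zero y = begin
    (θ * y) ^ q - w * (θ * y)  ≈⟨ +-congʳ (trans (^-distrib-* θ y q) (*-congʳ (sym (^[1]≈ θ)))) ⟩
    θ ^[ 1 ] * y ^ q - w * (θ * y)
      ≈⟨ solve 5 (λ u a w t y → u :* a :- w :* (t :* y) := t :* (a :- w :* y) :+ (u :- t) :* a) refl _ _ _ _ _ ⟩
    θ * (y ^ q - w * y) + ⟨ 1 ⟩ * y ^ q  ∎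
    where
    w : Carrier
    w = D 0 ^ q-1
  e-θ (suc d) y = begin
    e (suc d) (θ * y) ^ q - w′ * e (suc d) (θ * y)  ≈⟨ +-cong (^-congˡ q (e-θ d y)) (-‿cong (*-congˡ (e-θ d y))) ⟩
    (θ * b + ⟨ suc d ⟩ * a ^ q) ^ q - w′ * (θ * b + ⟨ suc d ⟩ * a ^ q)
      ≈⟨ +-congʳ (trans (+-^q _ _) (+-cong (^-distrib-* θ b q) (^-distrib-* ⟨ suc d ⟩ (a ^ q) q))) ⟩
    (θ ^ q * b ^ q + ⟨ suc d ⟩ ^ q * (a ^ q) ^ q) - w′ * (θ * b + ⟨ suc d ⟩ * a ^ q)
      ≈⟨ +-congʳ (+-cong (*-congʳ θ^q) (*-congˡ a^qq)) ⟩
    ((⟨ suc (suc d) ⟩ + θ - ⟨ suc d ⟩ ^ q) * b ^ q + ⟨ suc d ⟩ ^ q * (b ^ q + w ^ q * a ^ q)) - w′ * (θ * b + ⟨ suc d ⟩ * a ^ q)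
      ≈⟨ solve 9 (λ h t k B wq A w′ b g → ((h :+ t :- k) :* B :+ k :* (B :+ wq :* A)) :- w′ :* (t :* b :+ g :* A)
           := (t :* (B :- w′ :* b) :+ h :* B) :+ (k :* wq :- w′ :* g) :* A) refl ⟨ suc (suc d) ⟩ θ (⟨ suc d ⟩ ^ q) (b ^ q) (w ^ q) (a ^ q) w′ b ⟨ suc d ⟩ ⟩
    (θ * (b ^ q - w′ * b) + ⟨ suc (suc d) ⟩ * b ^ q) + (⟨ suc d ⟩ ^ q * w ^ q - w′ * ⟨ suc d ⟩) * a ^ q
      ≈⟨ +-congˡ (trans (*-congʳ (trans (+-congʳ weights) (-‿inverseʳ _))) (zeroˡ _)) ⟩
    (θ * (b ^ q - w′ * b) + ⟨ suc (suc d) ⟩ * b ^ q) + 0#  ≈⟨ +-identityʳ _ ⟩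
    θ * e (suc (suc d)) y + ⟨ suc (suc d) ⟩ * e (suc d) y ^ q  ∎
    where
    a b w w′ : Carrier
    a  = e d y
    b  = e (suc d) y
    w  = D d ^ q-1
    w′ = D (suc d) ^ q-1
    θ^q : θ ^ q ≈ ⟨ suc (suc d) ⟩ + θ - ⟨ suc d ⟩ ^ q
    θ^q = begin
      θ ^ q  ≈⟨ solve 3 (λ x u t → x := (u :- t) :+ t :- (u :- x)) refl (θ ^ q) (θ ^[ suc (suc d) ]) θ ⟩
      ⟨ suc (suc d) ⟩ + θ - (θ ^[ suc (suc d) ] - θ ^ q)  ≈⟨ +-congˡ (-‿cong (+-congʳ (^q^-suc θ (suc d)))) ⟩
      ⟨ suc (suc d) ⟩ + θ - (θ ^[ suc d ] ^ q - θ ^ q)  ≈⟨ +-congˡ (-‿cong (-‿^q _ θ)) ⟨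
      ⟨ suc (suc d) ⟩ + θ - ⟨ suc d ⟩ ^ q  ∎
    a^qq : (a ^ q) ^ q ≈ b ^ q + w ^ q * a ^ q
    a^qq = begin
      (a ^ q) ^ q  ≈⟨ solve 2 (λ x y → x := (x :- y) :+ y) refl _ (w ^ q * a ^ q) ⟩
      ((a ^ q) ^ q - w ^ q * a ^ q) + w ^ q * a ^ q  ≈⟨ +-congʳ (+-congˡ (-‿cong (^-distrib-* w a q))) ⟨
      ((a ^ q) ^ q - (w * a) ^ q) + w ^ q * a ^ q  ≈⟨ +-congʳ (-‿^q (a ^ q) (w * a)) ⟨
      b ^ q + w ^ q * a ^ q  ∎
    weights : ⟨ suc d ⟩ ^ q * w ^ q ≈ w′ * ⟨ suc d ⟩
    weights = begin
      ⟨ suc d ⟩ ^ q * w ^ q  ≈⟨ *-cong (^q≈ _) (trans (^-assocʳ (D d) q-1 q) (trans (^-congʳ (D d) (ℕP.*-comm q-1 q)) (sym (^-assocʳ (D d) q q-1)))) ⟩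
      ⟨ suc d ⟩ * ⟨ suc d ⟩ ^ q-1 * (D d ^ q) ^ q-1  ≈⟨ trans (*-assoc _ _ _) (*-comm _ _) ⟩
      ⟨ suc d ⟩ ^ q-1 * (D d ^ q) ^ q-1 * ⟨ suc d ⟩  ≈⟨ *-congʳ (trans (^-congˡ q-1 (D-suc d)) (^-distrib-* _ _ q-1)) ⟨
      w′ * ⟨ suc d ⟩  ∎

  mutual
    e-θ^d : ∀ d → e d (θ ^ d) ≈ D d
    e-θ^d zero    = sym D-0
    e-θ^d (suc d) = begin
      e (suc d) (θ * θ ^ d)  ≈⟨ e-θ d (θ ^ d) ⟩
      θ * e (suc d) (θ ^ d) + ⟨ suc d ⟩ * e d (θ ^ d) ^ q  ≈⟨ +-cong (trans (*-congˡ (e-suc-θ^d d)) (zeroʳ θ)) (*-congˡ (^-congˡ q (e-θ^d d))) ⟩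
      0# + ⟨ suc d ⟩ * D d ^ q  ≈⟨ trans (+-identityˡ _) (sym (D-suc d)) ⟩
      D (suc d)  ∎

    e-suc-θ^d : ∀ d → e (suc d) (θ ^ d) ≈ 0#
    e-suc-θ^d d = begin
      e d (θ ^ d) ^ q - D d ^ q-1 * e d (θ ^ d)  ≈⟨ +-cong (trans (^-congˡ q (e-θ^d d)) (^q≈ (D d))) (-‿cong (trans (*-congˡ (e-θ^d d)) (*-comm _ _))) ⟩
      D d * D d ^ q-1 - D d * D d ^ q-1  ≈⟨ -‿inverseʳ _ ⟩
      0#  ∎

  -- The coefficient of y in e d y.
  e′ : ℕ → Carrier
  e′ zero    = 1#
  e′ (suc d) = - (D d ^ q-1 * e′ d)

  -- This is e_d′ = D_d/L_d in multiplied form; the invertibility of L_d is later deduced from it.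
  -- The sign in `e′` cancels the sign in θ - θ^{q^d}.
  e′*L : ∀ d → e′ d * L d ≈ D d
  e′*L zero    = trans (*-identityˡ _) (trans L-0 (sym D-0))
  e′*L (suc d) = begin
    - (w * e′ d) * L (suc d)  ≈⟨ *-congˡ (L-suc d) ⟩
    - (w * e′ d) * ((θ - θ ^[ suc d ]) * L d)
      ≈⟨ solve 5 (λ w c t u l → (:- (w :* c)) :* ((t :- u) :* l) := (u :- t) :* ((c :* l) :* w)) refl _ _ _ _ _ ⟩
    ⟨ suc d ⟩ * ((e′ d * L d) * w)  ≈⟨ *-congˡ (*-congʳ (e′*L d)) ⟩
    ⟨ suc d ⟩ * (D d * w)  ≈⟨ *-congˡ (^q≈ (D d)) ⟨
    ⟨ suc d ⟩ * D d ^ q  ≈⟨ D-suc d ⟨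
    D (suc d)  ∎
    where
    w : Carrier
    w = D d ^ q-1

  ∑-vecs-∷ : ∀ d f → ∑ (vecs (suc d)) f ≈ ∑ elems (λ c → ∑ (vecs d) (λ v → f (c ∷ v)))
  ∑-vecs-∷ d f = trans (∑-concatMap (λ c → map (c ∷_) (vecs d)) elems) (∑-cong elems (λ c → ∑-map (c ∷_) (vecs d)))

  -- `vecs` branches on the constant coefficient, whereas induction on the degree has to branch on
  -- the top one.
  ∑-vecs-∷ʳ : ∀ d f → ∑ (vecs (suc d)) f ≈ ∑ elems (λ c → ∑ (vecs d) (λ v → f (v ++ [ c ])))
  ∑-vecs-∷ʳ zero    f = ∑-vecs-∷ zero f
  ∑-vecs-∷ʳ (suc d) f = begin
    ∑ (vecs (suc (suc d))) f  ≈⟨ ∑-vecs-∷ (suc d) f ⟩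
    ∑ elems (λ a → ∑ (vecs (suc d)) (λ v → f (a ∷ v)))  ≈⟨ ∑-cong elems (λ a → ∑-vecs-∷ʳ d (λ v → f (a ∷ v))) ⟩
    ∑ elems (λ a → ∑ elems (λ c → ∑ (vecs d) (λ v → f (a ∷ v ++ [ c ]))))  ≈⟨ ∑-swap elems elems _ ⟩
    ∑ elems (λ c → ∑ elems (λ a → ∑ (vecs d) (λ v → f (a ∷ v ++ [ c ]))))  ≈⟨ ∑-cong elems (λ c → ∑-vecs-∷ d (λ v → f (v ++ [ c ]))) ⟨
    ∑ elems (λ c → ∑ (vecs (suc d)) (λ v → f (v ++ [ c ])))  ∎

  eval-∷ʳ : ∀ v c → eval (v ++ [ c ]) ≈ eval v + ι.⟦ c ⟧ * θ ^ length v
  eval-∷ʳ []      c = solve 2 (λ c t → c :+ t :* :0# := :0# :+ c :* :1#) refl _ θ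
  eval-∷ʳ (a ∷ v) c = begin
    ι.⟦ a ⟧ + θ * eval (v ++ [ c ])  ≈⟨ +-congˡ (*-congˡ (eval-∷ʳ v c)) ⟩
    ι.⟦ a ⟧ + θ * (eval v + ι.⟦ c ⟧ * θ ^ length v)
      ≈⟨ solve 5 (λ a t v c p → a :+ t :* (v :+ c :* p) := (a :+ t :* v) :+ c :* (t :* p)) refl _ _ _ _ _ ⟩
    (ι.⟦ a ⟧ + θ * eval v) + ι.⟦ c ⟧ * (θ * θ ^ length v) ∎

  -- Induction on the top coefficient c. Put y_c = y + c θ^d and z_c = e_d(y_c). Since e_{d+1}(θ^d)
  -- = 0, e_{d+1}(y) = e_{d+1}(y_c) = z_c (z_c^(q-1) - D_d^(q-1)), and z_c times the slice of the
  -- sum at c is e′_d. Summed over c, z_c^(q-1) gives -D_d^(q-1) and the constant gives 0. The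
  -- inverses are data `I`, and `e d y` may be a nonunit.
  e*∑-inverses : ∀ d y (I : List 𝔽 → Carrier) → (∀ v → length v ≡ d → I v * (y + eval v) ≈ 1#) →
                 e d y * ∑ (vecs d) I ≈ e′ d
  e*∑-inverses zero    y I h = trans (solve 2 (λ y i → y :* (i :+ :0#) := i :* (y :+ :0#)) refl y (I [])) (h [] ≡.refl)
  e*∑-inverses (suc d) y I h = begin
    e (suc d) y * ∑ (vecs (suc d)) I  ≈⟨ *-congˡ (∑-vecs-∷ʳ d I) ⟩
    e (suc d) y * ∑ elems s  ≈⟨ ∑-*ˡ elems _ s ⟩
    ∑ elems (λ c → e (suc d) y * s c)  ≈⟨ ∑-cong elems slice ⟩
    ∑ elems (λ c → (z c ^ q-1 - w) * e′ d)  ≈⟨ ∑-*ʳ elems (e′ d) _ ⟨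
    ∑ elems (λ c → z c ^ q-1 - w) * e′ d  ≈⟨ *-congʳ (∑-+ elems (λ c → z c ^ q-1) (λ _ → - w)) ⟩
    (∑ elems (λ c → z c ^ q-1) + ∑ elems (λ _ → - w)) * e′ d  ≈⟨ *-congʳ (+-cong (∑-[x+cy]^[q-1] (e d y) (D d)) constants) ⟩
    (- w + 0#) * e′ d  ≈⟨ solve 2 (λ w c → (:- w :+ :0#) :* c := :- (w :* c)) refl _ _ ⟩
    - (w * e′ d)  ∎
    where
    w : Carrier
    w = D d ^ q-1
    s z yᶜ : 𝔽 → Carrier
    s c  = ∑ (vecs d) (λ v → I (v ++ [ c ]))
    z c  = e d y + ι.⟦ c ⟧ * D d
    yᶜ c = y + ι.⟦ c ⟧ * θ ^ d
    constants : ∑ elems (λ _ → - w) ≈ 0#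
    constants = begin
      ∑ elems (λ _ → - w)  ≈⟨ ∑-cong elems (λ _ → trans (sym (*-identityʳ _)) (*-congˡ (sym ι.1-homo))) ⟩
      ∑ elems (λ _ → - w * ι.⟦ 1ᶠ ⟧)  ≈⟨ ∑-*ˡ elems (- w) _ ⟨
      - w * ∑ elems (λ _ → ι.⟦ 1ᶠ ⟧)  ≈⟨ *-congˡ (ι.∑-homo elems (λ _ → 1ᶠ)) ⟨
      - w * ι.⟦ _ ⟧  ≈⟨ *-congˡ (trans (ι.⟦⟧-cong ∑1≡0) ι.0-homo) ⟩
      - w * 0#  ≈⟨ zeroʳ _ ⟩
      0#  ∎
    e-yᶜ : ∀ c → e d (yᶜ c) ≈ z c
    e-yᶜ c = trans (e-+ d y _) (+-congˡ (trans (e-ι d c _) (*-congˡ (e-θ^d d))))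
    e-suc-yᶜ : ∀ c → e (suc d) (yᶜ c) ≈ e (suc d) y
    e-suc-yᶜ c = trans (e-+ (suc d) y _) (trans (+-congˡ (trans (e-ι (suc d) c _) (trans (*-congˡ (e-suc-θ^d d)) (zeroʳ _)))) (+-identityʳ _))
    z*s : ∀ c → z c * s c ≈ e′ d
    z*s c = trans (*-congʳ (sym (e-yᶜ c))) (e*∑-inverses d (yᶜ c) (λ v → I (v ++ [ c ])) λ { v ≡.refl →
      trans (*-congˡ (trans (+-assoc _ _ _) (+-congˡ (trans (+-comm _ _) (sym (eval-∷ʳ v c))))))
            (h (v ++ [ c ]) (≡.trans (LP.length-++ v) (ℕP.+-comm (length v) 1))) })
    slice : ∀ c → e (suc d) y * s c ≈ (z c ^ q-1 - w) * e′ d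
    slice c = begin
      e (suc d) y * s c  ≈⟨ *-congʳ (e-suc-yᶜ c) ⟨
      e (suc d) (yᶜ c) * s c  ≈⟨ *-congʳ (+-cong (trans (^-congˡ q (e-yᶜ c)) (^q≈ (z c))) (-‿cong (*-congˡ (e-yᶜ c)))) ⟩
      (z c * z c ^ q-1 - w * z c) * s c
        ≈⟨ solve 4 (λ z p w s → (z :* p :- w :* z) :* s := (p :- w) :* (z :* s)) refl (z c) (z c ^ q-1) w (s c) ⟩
      (z c ^ q-1 - w) * (z c * s c)  ≈⟨ *-congˡ (z*s c) ⟩
      (z c ^ q-1 - w) * e′ d  ∎

  module Units (M : ℕ) (b : List 𝔽 → Carrier) (b-inverse : ∀ v → length v < M → b v * (θ ^ length v + eval v) ≈ 1#) where

    D*∑b : ∀ d → d < M → D d * ∑ (vecs d) b ≈ e′ d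
    D*∑b d d<M = trans (*-congʳ (sym (e-θ^d d))) (e*∑-inverses d (θ ^ d) b λ { v ≡.refl → b-inverse v d<M })

    mutual
      -- Invertibility climbs in d: D_d divides e′_d by `D*∑b`, which is the case y = θ^d of
      -- `e*∑-inverses`, and e′_{d+1} is up to sign D_d^(q-1) e′_d. The only input is that monic
      -- polynomials of degree below M have inverses.
      unit-D : ∀ d → d < M → Unit (D d)
      unit-D d d<M = unit-factorˡ (unit-≈ (sym (D*∑b d d<M)) (unit-e′ d d<M))

      unit-e′ : ∀ d → d < M → Unit (e′ d)
      unit-e′ zero    _   = unit-1
      unit-e′ (suc d) d<M = unit-neg (unit-* (unit-^ q-1 (unit-D d (ℕP.<-trans (ℕP.n<1+n d) d<M))) (unit-e′ d (ℕP.<-trans (ℕP.n<1+n d) d<M)))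

    unit-L : ∀ d → d < M → Unit (L d)
    unit-L d d<M = unit-factorʳ (unit-≈ (sym (e′*L d)) (unit-D d d<M))

    -- Extended by 0 to a total function, so that it can stand inside sums over natural numbers;
    -- those sums run over i < M.
    D⁻¹ : ℕ → Carrier
    D⁻¹ i with i ℕ.<? M
    ... | yes i<M = proj₁ (unit-D i i<M)
    ... | no  _   = 0#

    D⁻¹-inverse : ∀ i → i < M → D⁻¹ i * D i ≈ 1#
    D⁻¹-inverse i i<M with i ℕ.<? M
    ... | yes i<M′ = proj₂ (unit-D i i<M′)
    ... | no  i≮M  = ⊥-elim (i≮M i<M)

  -- The value at t = θ of the d-th Frobenius twist of the Anderson–Thakur polynomial G_i(θ).
  G : ℕ → ℕ → Carrier
  G d i = ∏ (upTo i) (λ l → θ ^[ i ] - θ ^[ suc l ℕ.+ d ])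

  -- The factor with l + 1 + d = i is zero. Hence the d-th twisted generating function is a
  -- polynomial in x with terms i ≤ d only.
  G-vanishes : ∀ d i → d < i → G d i ≈ 0#
  G-vanishes d i d<i = ∏-zero (upTo i) _ (∈P.∈-upTo⁺ l<i) (trans (+-congʳ (^-congʳ θ (≡.cong (q ℕ.^_) i≡))) (-‿inverseʳ _))
    where
    l : ℕ
    l = i ∸ suc d
    i≡ : i ≡ suc l ℕ.+ d
    i≡ = ≡.sym (≡.trans (≡.sym (ℕP.+-suc l d)) (ℕP.m∸n+n≡m d<i))
    l<i : l < i
    l<i = ℕP.≤-trans (ℕP.m≤m+n (suc l) d) (ℕP.≤-reflexive (≡.sym i≡))

  -- Minus the bracket `⟨ d ⟩`: for d ≥ 1 it is the last factor of L_d in the sign convention of L.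
  ℓ : ℕ → Carrier
  ℓ d = θ - θ ^[ d ]

  θ^[]-suc : ∀ d → θ ^[ suc d ] ≈ θ ^[ d ] ^ q
  θ^[]-suc = ^q^-suc θ

  -- The three products share the middle part `m`: the upper G is m (t - u), the lower one is (t -
  -- x) m, and `G d i ^ q` is m itself. What remains is ⟨d+1⟩ = x - θ = (t - θ) - (t - x), and t - u
  -- is the Frobenius twist of ℓ.
  G-recursion : ∀ d i → ⟨ suc d ⟩ * G (suc d) (suc i) ≈ ℓ (suc d) ^[ suc i ] * (⟨ suc i ⟩ * G d i ^ q - G d (suc i))
  G-recursion d i = begin
    ⟨ suc d ⟩ * G (suc d) (suc i)  ≈⟨ *-congˡ G-upper ⟩
    ⟨ suc d ⟩ * (m * (t - u))
      ≈⟨ solve 5 (λ x y m t u → (x :- y) :* (m :* (t :- u)) := (t :- u) :* ((t :- y) :* m :- (t :- x) :* m)) refl x θ m t u ⟩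
    (t - u) * (⟨ suc i ⟩ * m - (t - x) * m)  ≈⟨ *-cong (sym ℓ-twist) (+-cong (*-congˡ m≈) (-‿cong (sym G-lower))) ⟩
    ℓ (suc d) ^[ suc i ] * (⟨ suc i ⟩ * G d i ^ q - G d (suc i))  ∎
    where
    x t u m : Carrier
    x = θ ^[ suc d ]
    t = θ ^[ suc i ]
    u = θ ^[ suc i ℕ.+ suc d ]
    m = ∏ (upTo i) (λ l → t - θ ^[ suc (suc l) ℕ.+ d ])
    G-lower : G d (suc i) ≈ (t - x) * m
    G-lower = ∏-head i _
    G-upper : G (suc d) (suc i) ≈ m * (t - u)
    G-upper = trans (∏-last i _) (*-congʳ (∏-cong (upTo i) (λ l → +-congˡ (-‿cong (^-congʳ θ (≡.cong (λ n → q ℕ.^ suc n) (ℕP.+-suc l d)))))))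
    m≈ : m ≈ G d i ^ q
    m≈ = begin
      m  ≈⟨ ∏-cong (upTo i) (λ l → trans (+-cong (θ^[]-suc i) (-‿cong (θ^[]-suc (suc l ℕ.+ d)))) (sym (-‿^q _ _))) ⟩
      ∏ (upTo i) (λ l → (θ ^[ i ] - θ ^[ suc l ℕ.+ d ]) ^ q)  ≈⟨ ∏-^ (upTo i) _ q ⟨
      G d i ^ q  ∎
    ℓ-twist : ℓ (suc d) ^[ suc i ] ≈ t - u
    ℓ-twist = trans (Frob.sub-homo (suc i) θ x) (+-congˡ (-‿cong (trans (^q^-+ θ (suc d) (suc i)) (^-congʳ θ (≡.cong (q ℕ.^_) (ℕP.+-comm (suc d) (suc i)))))))

  module GeneratingFunction (M : ℕ) (J : ℕ → Carrier) (J-inverse : ∀ i → i < M → J i * D i ≈ 1#) where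

    g : ℕ → ℕ → Carrier
    g d i = G d i * J i

    g-vanishes : ∀ d i → d < i → g d i ≈ 0#
    g-vanishes d i d<i = trans (*-congʳ (G-vanishes d i d<i)) (zeroˡ _)

    -- The cut at M keeps to the invertible D_i; for d < M the terms beyond it would vanish by
    -- `g-vanishes`.
    φ : ℕ → Carrier → Carrier
    φ d x = ∑ (upTo M) (λ i → g d i * x ^[ i ])

    ∑-^q : ∀ {X : Set} (xs : List X) f → ∑ xs f ^ q ≈ ∑ xs (λ x → f x ^ q)
    ∑-^q xs f = trans (sym (^[1]≈ _)) (trans (Frob.∑-homo 1 xs f) (∑-cong xs (λ x → ^[1]≈ (f x))))

    J-suc : ∀ i → suc i < M → J (suc i) * ⟨ suc i ⟩ ≈ J i ^ q
    J-suc i i<M = begin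
      J (suc i) * ⟨ suc i ⟩  ≈⟨ trans (sym (*-identityʳ _)) (*-congˡ (sym JD^q)) ⟩
      J (suc i) * ⟨ suc i ⟩ * (J i ^ q * D i ^ q)
        ≈⟨ solve 4 (λ a b c d → a :* b :* (c :* d) := (a :* (b :* d)) :* c) refl _ _ _ _ ⟩
      J (suc i) * (⟨ suc i ⟩ * D i ^ q) * J i ^ q  ≈⟨ *-congʳ (trans (*-congˡ (sym (D-suc i))) (J-inverse (suc i) i<M)) ⟩
      1# * J i ^ q  ≈⟨ *-identityˡ _ ⟩
      J i ^ q  ∎
      where
      JD^q : J i ^ q * D i ^ q ≈ 1#
      JD^q = trans (sym (^-distrib-* _ _ q)) (trans (^-congˡ q (J-inverse i (ℕP.<-trans (ℕP.n<1+n i) i<M))) (1^n≈1 q))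

    -- Term by term this is `G-recursion` divided by D_{i+1}: by `J-suc`, [i+1]/D_{i+1} = 1/D_i^q,
    -- so the first summand is the q-th power of the preceding term, and the twisted ℓ is absorbed
    -- into the argument.
    φ-recursion : ∀ d x → suc d < M → ⟨ suc d ⟩ * φ (suc d) x ≈ φ d (ℓ (suc d) * x) ^ q - φ d (ℓ (suc d) * x)
    φ-recursion d x d<M = begin
      ⟨ suc d ⟩ * φ (suc d) x  ≈⟨ ∑-*ˡ (upTo M) _ _ ⟩
      ∑ (upTo M) (λ i → ⟨ suc d ⟩ * (g (suc d) i * x ^[ i ]))  ≈⟨ ∑-cong-∈ (upTo M) (λ {i} i∈ → termwise i (∈P.∈-upTo⁻ i∈)) ⟩
      ∑ (upTo M) (λ i → t′ i - t i)  ≈⟨ ∑-+ (upTo M) t′ (λ i → - t i) ⟩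
      ∑ (upTo M) t′ + ∑ (upTo M) (λ i → - t i)  ≈⟨ +-cong (sym t′-sum) ∑-neg ⟩
      φ d y ^ q - φ d y  ∎
      where
      y : Carrier
      y = ℓ (suc d) * x
      t t′ : ℕ → Carrier
      t i = g d i * y ^[ i ]
      -- The q-th power moves the term of index i to index i + 1. The zero in front fills index 0,
      -- and the term pushed out to index M vanishes because d < M - 1.
      t′ zero    = 0#
      t′ (suc i) = t i ^ q
      ∑-neg : ∑ (upTo M) (λ i → - t i) ≈ - φ d y
      ∑-neg = trans (∑-cong (upTo M) (λ i → solve 1 (λ a → :- a := (:- :1#) :* a) refl (t i)))
                    (trans (sym (∑-*ˡ (upTo M) (- 1#) t)) (solve 1 (λ a → (:- :1#) :* a := :- a) refl _))
      t′-sum : φ d y ^ q ≈ ∑ (upTo M) t′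
      t′-sum = begin
        φ d y ^ q  ≈⟨ ∑-^q (upTo M) t ⟩
        ∑ (upTo M) (t′ ∘ suc)  ≈⟨ +-identityˡ _ ⟨
        t′ 0 + ∑ (upTo M) (t′ ∘ suc)  ≈⟨ ∑-head M t′ ⟨
        ∑ (upTo (suc M)) t′  ≈⟨ ∑-last M t′ ⟩
        ∑ (upTo M) t′ + t′ M  ≈⟨ +-congˡ (t′-last M d<M) ⟩
        ∑ (upTo M) t′ + 0#  ≈⟨ +-identityʳ _ ⟩
        ∑ (upTo M) t′  ∎
        where
        t′-last : ∀ i → suc d < i → t′ i ≈ 0#
        t′-last (suc i) (s≤s d<i) = trans (^-congˡ q (trans (*-congʳ (g-vanishes d i d<i)) (zeroˡ _))) (0^n≈0 q (ℕP.≤-trans (s≤s z≤n) (ℕP.≤-reflexive (≡.sym q≡))))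
      termwise : ∀ i → i < M → ⟨ suc d ⟩ * (g (suc d) i * x ^[ i ]) ≈ t′ i - t i
      termwise zero    _   = solve 4 (λ u t j x → (u :- t) :* (:1# :* j :* (x :* :1#)) := :0# :- :1# :* j :* ((t :- u) :* x :* :1#)) refl (θ ^[ suc d ]) θ (J 0) x
      termwise (suc i) i<M = begin
        ⟨ suc d ⟩ * (G (suc d) (suc i) * J (suc i) * X)  ≈⟨ solve 4 (λ a b c d → a :* (b :* c :* d) := (a :* b) :* c :* d) refl _ _ _ _ ⟩
        ⟨ suc d ⟩ * G (suc d) (suc i) * J (suc i) * X  ≈⟨ *-congʳ (*-congʳ (G-recursion d i)) ⟩
        Λ * (⟨ suc i ⟩ * G d i ^ q - G d (suc i)) * J (suc i) * X
          ≈⟨ solve 6 (λ Λ b G H J X → Λ :* (b :* G :- H) :* J :* X := G :* (J :* b) :* (Λ :* X) :- H :* J :* (Λ :* X)) refl Λ ⟨ suc i ⟩ (G d i ^ q) (G d (suc i)) (J (suc i)) X ⟩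
        G d i ^ q * (J (suc i) * ⟨ suc i ⟩) * (Λ * X) - G d (suc i) * J (suc i) * (Λ * X)
          ≈⟨ +-cong (*-cong (*-congˡ (J-suc i i<M)) ΛX) (-‿cong (*-congˡ ΛX)) ⟩
        G d i ^ q * J i ^ q * y ^[ suc i ] - t (suc i)  ≈⟨ +-congʳ (*-cong (sym (^-distrib-* _ _ q)) (^q^-suc y i)) ⟩
        g d i ^ q * (y ^[ i ]) ^ q - t (suc i)  ≈⟨ +-congʳ (^-distrib-* _ _ q) ⟨
        t′ (suc i) - t (suc i)  ∎
        where
        Λ X : Carrier
        Λ = ℓ (suc d) ^[ suc i ]
        X = x ^[ suc i ]
        ΛX : Λ * X ≈ y ^[ suc i ]
        ΛX = sym (^-distrib-* _ _ (q ℕ.^ suc i))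

    φ-0 : ∀ x → 0 < M → φ 0 x ≈ x
    φ-0 x 0<M = begin
      φ 0 x  ≡⟨ ≡.cong (λ n → ∑ (upTo n) t) (≡.sym (ℕP.m∸n+n≡m 0<M)) ⟩
      ∑ (upTo (M ∸ 1 ℕ.+ 1)) t  ≈⟨ ∑-truncate 1 (M ∸ 1) t (λ i 1≤i → trans (*-congʳ (g-vanishes 0 i 1≤i)) (zeroˡ _)) ⟩
      1# * J 0 * (x * 1#) + 0#  ≈⟨ solve 2 (λ j x → :1# :* j :* (x :* :1#) :+ :0# := (j :* :1#) :* x) refl (J 0) x ⟩
      J 0 * 1# * x  ≈⟨ *-congʳ (trans (*-congˡ (sym D-0)) (J-inverse 0 0<M)) ⟩
      1# * x  ≈⟨ *-identityˡ x ⟩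
      x  ∎
      where
      t : ℕ → Carrier
      t i = g 0 i * x ^[ i ]

    -- Since L_{d+1} x = L_d y with y = ℓ(d+1) x, the recursion of e turns the left side into D_d^q
    -- (Φ^q - Φ), where Φ = φ_d(y); `φ-recursion` and the recursion of D do the same to the right
    -- side.
    e-L≈D*φ : ∀ d x → d < M → e d (L d * x) ≈ D d * φ d x
    e-L≈D*φ zero    x d<M = begin
      L 0 * x  ≈⟨ *-cong (trans L-0 (sym D-0)) (sym (φ-0 x d<M)) ⟩
      D 0 * φ 0 x  ∎
    e-L≈D*φ (suc d) x d<M = begin
      e d (L (suc d) * x) ^ q - w * e d (L (suc d) * x)  ≈⟨ +-cong (^-congˡ q step) (-‿cong (*-congˡ step)) ⟩
      (D d * Φ) ^ q - w * (D d * Φ)  ≈⟨ +-congʳ (trans (^-distrib-* _ _ q) (*-congʳ (^q≈ (D d)))) ⟩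
      D d * w * Φ ^ q - w * (D d * Φ)  ≈⟨ solve 4 (λ d w p f → d :* w :* p :- w :* (d :* f) := d :* w :* (p :- f)) refl _ _ _ _ ⟩
      D d * w * (Φ ^ q - Φ)  ≈⟨ *-cong (^q≈ (D d)) (φ-recursion d x d<M) ⟨
      D d ^ q * (⟨ suc d ⟩ * φ (suc d) x)  ≈⟨ solve 3 (λ a b c → a :* (b :* c) := b :* a :* c) refl _ _ _ ⟩
      ⟨ suc d ⟩ * D d ^ q * φ (suc d) x  ≈⟨ *-congʳ (D-suc d) ⟨
      D (suc d) * φ (suc d) x  ∎
      where
      w y Φ : Carrier
      w = D d ^ q-1
      y = ℓ (suc d) * x
      Φ = φ d y
      step : e d (L (suc d) * x) ≈ D d * Φ
      step = trans (e-cong d (trans (*-congʳ (trans (L-suc d) (*-comm _ _))) (*-assoc _ _ x))) (e-L≈D*φ d y (ℕP.<-trans (ℕP.n<1+n d) d<M))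

    [1-φ]*∑-inverses : ∀ d x (I : List 𝔽 → Carrier) → d < M →
                       (∀ v → length v ≡ d → I v * ((θ ^ d + eval v) - L d * x) ≈ 1#) →
                       (1# - φ d x) * (L d * ∑ (vecs d) I) ≈ 1#
    [1-φ]*∑-inverses d x I d<M h = unit-cancelˡ (J d , J-inverse d d<M) (begin
      D d * ((1# - φ d x) * (L d * S))  ≈⟨ solve 4 (λ D p l s → D :* ((:1# :- p) :* (l :* s)) := ((D :- D :* p) :* s) :* l) refl _ _ _ _ ⟩
      (D d - D d * φ d x) * S * L d  ≈⟨ *-congʳ (*-congʳ e-y) ⟨
      e d y * S * L d  ≈⟨ *-congʳ (e*∑-inverses d y I (λ v l → trans (*-congˡ (solve 3 (λ a b c → (a :- c) :+ b := (a :+ b) :- c) refl _ _ _)) (h v l))) ⟩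
      e′ d * L d  ≈⟨ trans (e′*L d) (sym (*-identityʳ _)) ⟩
      D d * 1#  ∎)
      where
      S y : Carrier
      S = ∑ (vecs d) I
      y = θ ^ d - L d * x
      e-y : e d y ≈ D d - D d * φ d x
      e-y = trans (e-+ d _ _) (+-cong (e-θ^d d) (trans (e-neg d _) (-‿cong (e-L≈D*φ d x d<M))))

-- The generating series of the power sums S_d(n + 1).

module PowerSums (F : FiniteField) (K : CommutativeRing 0ℓ 0ℓ) (C : CarlitzData F K) where
  open FiniteFieldTheory F using (q; i<q^i; fieldRing)
  open FiniteField F using (_≟_) renaming (Carrier to 𝔽)
  open Setup F using (vecs)
  open PowerSeries K
  open Tools K
  open Carlitz F K C
  open Evaluation fieldRing _≟_ K ι θ
  private
    module S = Tools powerSeriesRing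
    module κ = Hom constantHom

  constantData : CarlitzData F powerSeriesRing
  constantData = mapCarlitzData constantHom C

  private
    module CS = Carlitz F powerSeriesRing constantData
    module ES = Evaluation fieldRing _≟_ powerSeriesRing (constantHom ∘ʰ ι) (constant θ)

  ∑-at : ∀ {X : Set} (xs : List X) f n → S.∑ xs f n ≈ ∑ xs (λ x → f x n)
  ∑-at []       f n = refl
  ∑-at (x ∷ xs) f n = +-congˡ (∑-at xs f n)

  eval-constant : ∀ v → ES.eval v S.≈ constant (eval v)
  eval-constant []      = S.sym κ.0-homo
  eval-constant (a ∷ v) = S.trans (S.+-congˡ (S.trans (S.*-congˡ {constant θ} (eval-constant v)) (S.sym (κ.*-homo θ (eval v)))))
                                  (S.sym (κ.+-homo (Hom.⟦_⟧ ι a) (θ * eval v)))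

  G-constant : ∀ d i → CS.G d i S.≈ constant (G d i)
  G-constant d i = S.trans (S.∏-cong (upTo i) factor) (S.sym (κ.∏-homo (upTo i) _))
    where
    power : ∀ k → constant θ S.^ (q ℕ.^ k) S.≈ constant (θ ^[ k ])
    power k = S.sym (κ.^-homo θ (q ℕ.^ k))
    factor : ∀ l → (constant θ S.^ (q ℕ.^ i) S.- constant θ S.^ (q ℕ.^ (suc l ℕ.+ d))) S.≈ constant (θ ^[ i ] - θ ^[ suc l ℕ.+ d ])
    factor l = S.trans (S.+-cong (power i) (S.-‿cong (power (suc l ℕ.+ d)))) (S.sym (κ.sub-homo (θ ^[ i ]) (θ ^[ suc l ℕ.+ d ])))

  -- The expansion of 1/(a - l x) when b is the inverse of a.
  geometric : Carrier → Carrier → Series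
  geometric b l n = b ^ suc n * l ^ n

  geometric-inverse : ∀ a b l → b * a ≈ 1# → geometric b l S.* (constant a S.- constant l S.* X) S.≈ S.1#
  geometric-inverse a b l ba≈1 = S.trans (S.trans (S.*-comm I (constant a S.- constant l S.* X)) expand) (pointwise coefficient)
    where
    I : Series
    I = geometric b l
    expand : (constant a S.- constant l S.* X) S.* I S.≈ (constant a S.* I S.- constant l S.* (X S.* I))
    expand = S.solve 4 (λ a l x i → (a S.:- l S.:* x) S.:* i S.:= a S.:* i S.:- l S.:* (x S.:* i)) S.refl (constant a) (constant l) X I
    coefficient : ∀ n → (constant a ⊛ I) n - (constant l ⊛ (X ⊛ I)) n ≈ constant 1# n
    coefficient zero = begin
      a * (b * 1# * 1#) - l * (0# * (b * 1# * 1#))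
        ≈⟨ solve 3 (λ a b l → a :* (b :* :1# :* :1#) :- l :* (:0# :* (b :* :1# :* :1#)) := b :* a) refl a b l ⟩
      b * a ≈⟨ ba≈1 ⟩
      1#  ∎
    coefficient (suc n) = begin
      (constant a ⊛ I) (suc n) - (constant l ⊛ (X ⊛ I)) (suc n)
        ≈⟨ +-cong (constant-⊛ a I (suc n)) (-‿cong (trans (constant-⊛ l (X ⊛ I) (suc n)) (*-congˡ (X-⊛-suc I n)))) ⟩
      a * (b * b ^ suc n * (l * l ^ n)) - l * (b ^ suc n * l ^ n)
        ≈⟨ solve 5 (λ a b l p m → a :* (b :* p :* (l :* m)) :- l :* (p :* m) := (b :* a) :* (l :* (p :* m)) :- l :* (p :* m)) refl a b l (b ^ suc n) (l ^ n) ⟩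
      b * a * (l * (b ^ suc n * l ^ n)) - l * (b ^ suc n * l ^ n)  ≈⟨ +-congʳ (trans (*-congʳ ba≈1) (*-identityˡ _)) ⟩
      l * (b ^ suc n * l ^ n) - l * (b ^ suc n * l ^ n)  ≈⟨ -‿inverseʳ _ ⟩
      0#  ∎

  module Recursion (M : ℕ) (b : List 𝔽 → Carrier) (b-inverse : ∀ v → length v < M → b v * (θ ^ length v + eval v) ≈ 1#) where
    open Units M b b-inverse public
    open GeneratingFunction M D⁻¹ D⁻¹-inverse public using (g)

    D⁻¹-inverse-constant : ∀ i → i < M → constant (D⁻¹ i) S.* constant (D i) S.≈ S.1#
    D⁻¹-inverse-constant i i<M = S.trans (S.sym (κ.*-homo (D⁻¹ i) (D i))) (S.trans (κ.⟦⟧-cong (D⁻¹-inverse i i<M)) κ.1-homo)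

    private module GS = CS.GeneratingFunction M (constant ∘ D⁻¹) D⁻¹-inverse-constant

    -- L_d^{n+1} S_d(n+1), where S_d(s) = ∑ 1/a^s over the monic polynomials a of degree d.
    powerSum : ℕ → ℕ → Carrier
    powerSum d n = ∑ (vecs d) (λ v → (L d * b v) ^ suc n)

    module _ (d : ℕ) (d<M : d < M) where
      private
        I : List 𝔽 → Series
        I v = geometric (b v) (L d)

        P : Series
        P = constant (L d) ⊛ S.∑ (vecs d) I

        P≈ : ∀ n → P n ≈ powerSum d n
        P≈ n = begin
          (constant (L d) ⊛ S.∑ (vecs d) I) n  ≈⟨ trans (constant-⊛ (L d) _ n) (*-congˡ (∑-at (vecs d) I n)) ⟩
          L d * ∑ (vecs d) (λ v → b v ^ suc n * L d ^ n)  ≈⟨ ∑-*ˡ (vecs d) (L d) _ ⟩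
          ∑ (vecs d) (λ v → L d * (b v ^ suc n * L d ^ n))  ≈⟨ ∑-cong (vecs d) (λ v → trans (solve 3 (λ l p m → l :* (p :* m) := (l :* m) :* p) refl _ _ _) (sym (^-distrib-* (L d) (b v) (suc n)))) ⟩
          powerSum d n  ∎

        inverse : ∀ v → length v ≡ d → I v S.* ((constant θ S.^ d S.+ ES.eval v) S.- constant (L d) S.* X) S.≈ S.1#
        inverse v ≡.refl = S.trans (S.*-congˡ {I v} (S.+-congʳ monic)) (geometric-inverse (θ ^ d + eval v) (b v) (L d) (b-inverse v d<M))
          where
          monic : constant θ S.^ d S.+ ES.eval v S.≈ constant (θ ^ d + eval v)
          monic = S.trans (S.+-cong (S.sym (κ.^-homo θ d)) (eval-constant v)) (S.sym (κ.+-homo (θ ^ d) (eval v)))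

        -- The fixed-point form of (1 - φ) P = 1: as φ has no constant term, each coefficient of P
        -- is read off from earlier ones.
        P≋ : P S.≈ S.1# S.+ GS.φ d X S.* P
        P≋ = S.trans (S.solve 2 (λ p f → p S.:= (S.:1# S.:- f) S.:* p S.:+ f S.:* p) S.refl P (GS.φ d X))
                     (S.+-congʳ (GS.[1-φ]*∑-inverses d X I d<M inverse))

        φ-coefficient : ∀ n → (GS.φ d X ⊛ P) n ≈ ∑ (upTo M) (λ i → g d i * (X S.^ (q ℕ.^ i) ⊛ P) n)
        φ-coefficient n = begin
          (GS.φ d X ⊛ P) n  ≈⟨ at (S.∑-*ʳ (upTo M) P _) n ⟩
          S.∑ (upTo M) (λ i → (GS.g d i S.* X S.^ (q ℕ.^ i)) S.* P) n  ≈⟨ ∑-at (upTo M) _ n ⟩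
          ∑ (upTo M) (λ i → ((GS.g d i S.* X S.^ (q ℕ.^ i)) S.* P) n)
            ≈⟨ ∑-cong (upTo M) (λ i → trans (at (S.trans (S.*-assoc (GS.g d i) (X S.^ (q ℕ.^ i)) P) (S.*-congʳ {X S.^ (q ℕ.^ i) S.* P} (g-constant i))) n) (constant-⊛ (g d i) _ n)) ⟩
          ∑ (upTo M) (λ i → g d i * (X S.^ (q ℕ.^ i) ⊛ P) n)  ∎
          where
          g-constant : ∀ i → GS.g d i S.≈ constant (g d i)
          g-constant i = S.trans (S.*-congʳ {constant (D⁻¹ i)} (G-constant d i)) (S.sym (κ.*-homo (G d i) (D⁻¹ i)))

      -- Carlitz's evaluation S_d(1) = 1/L_d: all exponents q^i are positive, so φ contributes
      -- nothing in degree 0.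
      powerSum-0 : powerSum d 0 ≈ 1#
      powerSum-0 = begin
        powerSum d 0  ≈⟨ P≈ 0 ⟨
        P 0  ≈⟨ at P≋ 0 ⟩
        1# + (GS.φ d X ⊛ P) 0  ≈⟨ +-congˡ (φ-coefficient 0) ⟩
        1# + ∑ (upTo M) (λ i → g d i * (X S.^ (q ℕ.^ i) ⊛ P) 0)
          ≈⟨ +-congˡ (trans (∑-cong (upTo M) (λ i → trans (*-congˡ (X^-⊛-< (q ℕ.^ i) P 0 (ℕP.≤-trans (s≤s z≤n) (i<q^i i)))) (zeroʳ _))) (∑-0 (upTo M))) ⟩
        1# + 0#  ≈⟨ +-identityʳ 1# ⟩
        1#  ∎

      -- Stated over the filtered list of `step`, so that it can be matched term by term with the
      -- recursion for the fractions behind H. Indices i > n drop out because i < q^i.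
      powerSum-recursion : ∀ n → 1 ≤ n → n < M →
        powerSum d n ≈ ∑ (filter (λ i → q ℕ.^ i ℕ.≤? n) (upTo (suc n))) (λ i → g d i * powerSum d (n ∸ q ℕ.^ i))
      powerSum-recursion n@(suc m) _ n<M = begin
        powerSum d n  ≈⟨ P≈ n ⟨
        P n  ≈⟨ at P≋ n ⟩
        0# + (GS.φ d X ⊛ P) n  ≈⟨ trans (+-identityˡ _) (φ-coefficient n) ⟩
        ∑ (upTo M) (λ i → g d i * (X S.^ (q ℕ.^ i) ⊛ P) n)  ≈⟨ ∑-cong (upTo M) shifted ⟩
        ∑ (upTo M) t  ≡⟨ ≡.cong (λ k → ∑ (upTo k) t) (≡.sym (ℕP.m∸n+n≡m n<M)) ⟩
        ∑ (upTo (M ∸ suc n ℕ.+ suc n)) t  ≈⟨ ∑-truncate (suc n) (M ∸ suc n) t beyond ⟩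
        ∑ (upTo (suc n)) t  ≈⟨ ∑-filter (λ i → q ℕ.^ i ℕ.≤? n) (upTo (suc n)) _ ⟨
        ∑ (filter (λ i → q ℕ.^ i ℕ.≤? n) (upTo (suc n))) (λ i → g d i * powerSum d (n ∸ q ℕ.^ i)) ∎
        where
        t : ℕ → Carrier
        t i = if does (q ℕ.^ i ℕ.≤? n) then g d i * powerSum d (n ∸ q ℕ.^ i) else 0#
        shifted : ∀ i → g d i * (X S.^ (q ℕ.^ i) ⊛ P) n ≈ t i
        shifted i with q ℕ.^ i ℕ.≤? n
        ... | yes q^i≤n rewrite dec-true (q ℕ.^ i ℕ.≤? n) q^i≤n  = *-congˡ (trans (X^-⊛-≤ (q ℕ.^ i) P n q^i≤n) (P≈ (n ∸ q ℕ.^ i)))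
        ... | no  q^i≰n rewrite dec-false (q ℕ.^ i ℕ.≤? n) q^i≰n = trans (*-congˡ (X^-⊛-< (q ℕ.^ i) P n (ℕP.≰⇒> q^i≰n))) (zeroʳ _)
        beyond : ∀ i → suc n ≤ i → t i ≈ 0#
        beyond i n<i rewrite dec-false (q ℕ.^ i ℕ.≤? n) (λ q^i≤n → ℕP.<-irrefl ≡.refl (ℕP.<-trans n<i (ℕP.<-≤-trans (i<q^i i) q^i≤n))) = refl

-- Monic polynomials.

module MonicPolynomials (R : CommutativeRing 0ℓ 0ℓ) (_≟_ : DecidableEquality (CommutativeRing.Carrier R)) where
  open Tools R
  open PolyOps _≟_ 0# 1# _+_ _*_ -_
  open PolyRing R _≟_
  private module P = Tools polyRing

  X-⊗ : ∀ p → X^ 1 ⊗ p ≈ᴾ 0# ∷ p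
  X-⊗ p = P.trans (P.*-congʳ {p} (norm-≈ (0# ∷ [ 1# ]))) (coeffs≈ λ
    { zero    → trans (coeff-⊗ (0# ∷ [ 1# ]) p 0) (zeroˡ _)
    ; (suc n) → trans (coeff-∷-⊗ 0# [ 1# ] p n) (trans (+-cong (zeroˡ _) (one n)) (+-identityˡ _)) })
    where
    one : ∀ n → coeff ([ 1# ] ⊗ p) n ≈ coeff p n
    one n = coeff-≈ (P.trans (P.*-congʳ {p} (P.sym (norm-≈ [ 1# ]))) (P.*-identityˡ p)) n

  ∷-≈ : ∀ a p → a ∷ p ≈ᴾ const a ⊕ X^ 1 ⊗ p
  ∷-≈ a p = P.sym (P.trans (P.+-cong (norm-≈ [ a ]) (X-⊗ p)) (P.trans (∷-⊕-∷ a [] 0# p)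
    (∷-cong (+-identityʳ a) (P.+-identityˡ p))))

  -- Phrased by coefficients instead of list length, hence invariant under `_≈ᴾ_`.
  record MonicOfDegree (p : Poly) (l : ℕ) : Set where
    constructor monic
    field
      leading : coeff p l ≈ 1#
      beyond  : ∀ n → l < n → coeff p n ≈ 0#
  open MonicOfDegree public

  monic-≈ : ∀ {p r l} → p ≈ᴾ r → MonicOfDegree p l → MonicOfDegree r l
  monic-≈ e (monic a b) = monic (trans (sym (coeff-≈ e _)) a) (λ n h → trans (sym (coeff-≈ e n)) (b n h))

  monic-one : MonicOfDegree oneP 0
  monic-one = monic-≈ (P.sym (norm-≈ [ 1# ])) (monic refl λ { (suc n) _ → refl })

  monic-X : MonicOfDegree (X^ 1) 1
  monic-X = monic-≈ (P.sym (norm-≈ (0# ∷ [ 1# ]))) (monic refl λ { 1 (s≤s ()) ; (suc (suc n)) _ → refl })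

  monic-⊗ : ∀ {p r l k} → MonicOfDegree p l → MonicOfDegree r k → MonicOfDegree (p ⊗ r) (l ℕ.+ k)
  -- The empty list is monic only if 0 ≈ 1, and then all elements of the ring are equal.
  monic-⊗ {[]} {r} (monic 0≈1 _) _ = monic (trivial _) (λ n _ → trans (trivial _) (sym 0≈1))
    where
    trivial : ∀ x → x ≈ 1#
    trivial x = trans (trans (sym (*-identityʳ x)) (trans (*-congˡ (sym 0≈1)) (zeroʳ x))) 0≈1
  monic-⊗ {a ∷ p} {r} {zero} (monic a≈1 p≈0) mr = monic-≈ (P.sym (P.trans (P.*-congʳ {r} a∷p≈1) (P.*-identityˡ r))) mr
    where
    a∷p≈1 : a ∷ p ≈ᴾ oneP
    a∷p≈1 = P.trans (coeffs≈ λ { zero → a≈1 ; (suc n) → p≈0 (suc n) (s≤s z≤n) }) (P.sym (norm-≈ [ 1# ]))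
  monic-⊗ {a ∷ p} {r} {suc l} {k} (monic lp bp) mr with monic-⊗ {p} (monic lp (λ n h → bp (suc n) (s≤s h))) mr
  ... | monic lpr bpr = monic (step (l ℕ.+ k) (ℕP.m≤n+m k l) lpr)
                              (λ { (suc n) (s≤s h) → step n (ℕP.≤-trans (ℕP.m≤n+m k l) (ℕP.<⇒≤ h)) (bpr n h) })
    where
    step : ∀ n → k ≤ n → ∀ {x} → coeff (p ⊗ r) n ≈ x → coeff ((a ∷ p) ⊗ r) (suc n) ≈ x
    step n k≤n e = trans (coeff-∷-⊗ a p r n) (trans (+-cong (trans (*-congˡ (beyond mr (suc n) (s≤s k≤n))) (zeroʳ a)) e) (+-identityˡ _))

  monic-⊖ : ∀ {p r l} → MonicOfDegree p l → (∀ n → l ≤ n → coeff r n ≈ 0#) → MonicOfDegree (p ⊖ r) l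
  monic-⊖ {p} {r} {l} (monic a b) h = monic (difference l ℕP.≤-refl a) (λ n l<n → difference n (ℕP.<⇒≤ l<n) (b n l<n))
    where
    difference : ∀ n → l ≤ n → ∀ {x} → coeff p n ≈ x → coeff (p ⊖ r) n ≈ x
    difference n l≤n e = trans (coeff-⊕ p (neg r) n) (trans (+-cong e (trans (coeff-neg r n) (trans (-‿cong (h n l≤n)) -0#≈0#))) (+-identityʳ _))

  monic-X^ : ∀ n → MonicOfDegree (X^ 1 P.^ n) n
  monic-X^ zero    = monic-one
  monic-X^ (suc n) = monic-⊗ {X^ 1} monic-X (monic-X^ n)

  IsMonic : Poly → Set
  IsMonic p = ∃ (MonicOfDegree p)

  monic-∏ : ∀ {X : Set} (xs : List X) f → (∀ {x} → x ∈ xs → IsMonic (f x)) → IsMonic (P.∏ xs f)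
  monic-∏ []       f h = 0 , monic-one
  monic-∏ (x ∷ xs) f h with h (here ≡.refl) | monic-∏ xs f (h ∘ there)
  ... | l , ml | k , mk = l ℕ.+ k , monic-⊗ {f x} ml mk

-- The rings A and A[t].

module PolynomialsOverFq (F : FiniteField) where
  open FiniteFieldTheory F using (q; fieldRing; i<q^i; 2≤q) public
  open FiniteField F using (_≟_) renaming (Carrier to 𝔽; 0# to 0ᶠ; 1# to 1ᶠ)
  open Setup F hiding (q)

  module 𝔸 = PolyRing fieldRing _≟_
  ringA : CommutativeRing 0ℓ 0ℓ
  ringA = 𝔸.polyRing

  _≟ᴬ_ : DecidableEquality A
  _≟ᴬ_ = LP.≡-dec _≟_

  module 𝔸t = PolyRing ringA _≟ᴬ_
  ringAt : CommutativeRing 0ℓ 0ℓ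
  ringAt = 𝔸t.polyRing

  private
    module PR  = Tools ringA
    module PRt = Tools ringAt

  module 𝔸Div = Division fieldRing _≟_ (λ _ → ⊤) tt (λ _ _ → tt) (λ _ _ → tt) (λ _ → tt) (λ _ e → e)

  Normal : A → Set
  Normal a = PA.norm a ≡ a

  allᵀ : ∀ (p : A) → All (λ _ → ⊤) p
  allᵀ p = All.universal (λ _ → tt) p

  normal-zero : ∀ {a} → Normal a → a PR.≈ [] → a ≡ []
  normal-zero {a} n e = ≡.trans (≡.sym n) (𝔸Div.norm≡[] a (allᵀ a) e)

  -- A coefficient in A is itself a list: being zero up to trailing zeros means being `[]` only for
  -- normalised lists, and every operation of A returns one.
  module 𝔸tDiv = Division ringA _≟ᴬ_ Normal ≡.refl (λ a b → 𝔸Div.norm-idem (𝔸.addRaw a b)) (λ a b → 𝔸Div.norm-idem (𝔸.mulRaw a b))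
                   (λ a → 𝔸Div.norm-idem (map (FiniteField.-_ F) a)) normal-zero

  module 𝔸Monic  = MonicPolynomials fieldRing _≟_
  module 𝔸tMonic = MonicPolynomials ringA _≟ᴬ_

  module FA = FieldAlgebra F ringA 𝔸.constHom

  carlitzA : CarlitzData F ringA
  carlitzA = record
    { ι     = 𝔸.constHom
    ; θ     = θ
    ; D     = D
    ; L     = L
    ; D-0   = PR.refl
    ; D-suc = D-recursion
    ; L-0   = PR.refl
    ; L-suc = λ d → PR.trans (L≈ (suc d)) (PR.trans (PR.∏-last d L-factor) (PR.trans (PR.*-comm (PR.∏ (upTo d) L-factor) (L-factor d)) (PR.*-congˡ {L-factor d} (PR.sym (L≈ d)))))
    }
    where
    L-factor : ℕ → A
    L-factor l = θ PR.- θ PR.^ (q ℕ.^ suc l)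
    D-factor : ℕ → ℕ → A
    D-factor d j = θ PR.^ (q ℕ.^ d) PR.- θ PR.^ (q ℕ.^ j)
    D≈ : ∀ d → D d PR.≈ PR.∏ (upTo d) (D-factor d)
    D≈ d = PR.trans (𝔸.prodP-map _ (upTo d))
      (PR.∏-cong (upTo d) (λ j → PR.reflexive (≡.cong₂ PR._-_ (𝔸.^P≡^ θ (q ℕ.^ d)) (𝔸.^P≡^ θ (q ℕ.^ j)))))
    L≈ : ∀ d → L d PR.≈ PR.∏ (upTo d) L-factor
    L≈ d = PR.trans (𝔸.prodP-map _ (upTo d)) (PR.∏-cong (upTo d) (λ l → PR.reflexive (≡.cong (λ a → θ PR.- a) (𝔸.^P≡^ θ (q ℕ.^ suc l)))))
    -‿^q : ∀ x y → (x PR.- y) PR.^ q PR.≈ x PR.^ q PR.- y PR.^ q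
    -‿^q x y = PR.trans (PR.sym (^1 (x PR.- y))) (PR.trans (Hom.sub-homo (FA.frobenius 1) x y) (PR.+-cong (^1 x) (PR.-‿cong (^1 y))))
      where
      ^1 : ∀ x → x PR.^ (q ℕ.^ 1) PR.≈ x PR.^ q
      ^1 x = PR.^-congʳ x (ℕP.*-identityʳ q)
    -- The factor j = 0 is the bracket; each of the others is a difference of q-th powers, hence the
    -- q-th power of a factor of D_d.
    D-recursion : ∀ d → D (suc d) PR.≈ (θ PR.^ (q ℕ.^ suc d) PR.- θ) PR.* D d PR.^ q
    D-recursion d = PR.begin
      D (suc d)  PR.≈⟨ PR.trans (D≈ (suc d)) (PR.∏-head d (D-factor (suc d))) ⟩
      (θd PR.- θ PR.^ 1) PR.* PR.∏ (upTo d) (λ j → θd PR.- θ PR.^ (q ℕ.^ suc j))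
        PR.≈⟨ PR.*-cong (PR.+-congˡ {θd} (PR.-‿cong (PR.*-identityʳ θ))) (PR.∏-cong (upTo d) (λ j → PR.trans (PR.+-cong (FA.^q^-suc θ d) (PR.-‿cong (FA.^q^-suc θ j))) (PR.sym (-‿^q (θ PR.^ (q ℕ.^ d)) (θ PR.^ (q ℕ.^ j)))))) ⟩
      (θd PR.- θ) PR.* PR.∏ (upTo d) (λ j → D-factor d j PR.^ q)
        PR.≈⟨ PR.*-congˡ {θd PR.- θ} (PR.trans (PR.sym (PR.∏-^ (upTo d) (D-factor d) q)) (PR.^-congˡ q (PR.sym (D≈ d)))) ⟩
      (θd PR.- θ) PR.* D d PR.^ q  PR.∎
      where
      θd : A
      θd = θ PR.^ (q ℕ.^ suc d)

  monic-D : ∀ d → 𝔸Monic.IsMonic (D d)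
  monic-D d = proj₁ M , 𝔸Monic.monic-≈ (PR.sym (𝔸.prodP-map _ (upTo d))) (proj₂ M)
    where
    factor : ∀ {j} → j < d → 𝔸Monic.IsMonic (θ PA.^P (q ℕ.^ d) PR.- θ PA.^P (q ℕ.^ j))
    factor {j} j<d rewrite 𝔸.^P≡^ θ (q ℕ.^ d) | 𝔸.^P≡^ θ (q ℕ.^ j) =
      q ℕ.^ d , 𝔸Monic.monic-⊖ {θ PR.^ (q ℕ.^ d)} {θ PR.^ (q ℕ.^ j)} (𝔸Monic.monic-X^ (q ℕ.^ d))
                  (λ n q^d≤n → 𝔸Monic.beyond (𝔸Monic.monic-X^ (q ℕ.^ j)) n (ℕP.<-≤-trans (ℕP.^-monoʳ-< q 2≤q j<d) q^d≤n))
    M : 𝔸Monic.IsMonic (PR.∏ (upTo d) (λ j → θ PA.^P (q ℕ.^ d) PR.- θ PA.^P (q ℕ.^ j)))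
    M = 𝔸Monic.monic-∏ (upTo d) _ (λ j∈ → factor (∈P.∈-upTo⁻ j∈))

  t : At
  t = PAt.X^ 1

  module ET = Evaluation fieldRing _≟_ ringAt (𝔸t.constHom ∘ʰ 𝔸.constHom) t

  θ↦tHom : Hom ringA ringAt
  θ↦tHom = ET.evalHom

  -- The coefficientwise definition is identified with evaluation at t, which is known to be a ring
  -- homomorphism.
  θ↦t≈ : ∀ a → θ↦t a PRt.≈ ET.eval a
  θ↦t≈ a = PRt.trans (𝔸t.norm-≈ (map PA.const a)) (go a)
    where
    go : ∀ a → map PA.const a PRt.≈ ET.eval a
    go []      = PRt.refl
    go (c ∷ a) = PRt.trans (𝔸tMonic.∷-≈ (PA.const c) (map PA.const a)) (PRt.+-congˡ {PAt.const (PA.const c)} (PRt.*-congˡ {t} (go a)))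

  monic-θ↦t : ∀ {a} → 𝔸Monic.IsMonic a → 𝔸tMonic.IsMonic (θ↦t a)
  monic-θ↦t {a} (l , 𝔸Monic.monic lead beyond) = l , 𝔸tMonic.monic-≈ (PRt.sym (𝔸t.norm-≈ (map PA.const a)))
    (𝔸tMonic.monic (PR.trans (coeff-map a l) (const.⟦⟧-cong lead)) (λ n h → PR.trans (coeff-map a n) (PR.trans (const.⟦⟧-cong (beyond n h)) const.0-homo)))
    where
    module const = Hom 𝔸.constHom
    coeff-map : ∀ a n → 𝔸t.coeff (map PA.const a) n PR.≈ PA.const (𝔸.coeff a n)
    coeff-map []      n       = PR.sym const.0-homo
    coeff-map (c ∷ a) zero    = PR.refl
    coeff-map (c ∷ a) (suc n) = coeff-map a n

-- Carlitz factorials and carries in base q.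

module CarlitzFactorial (F : FiniteField) where
  open PolynomialsOverFq F
  open Setup F hiding (q)
  open Tools ringA
  open CarlitzData carlitzA using (D-suc)

  private instance
    q-nonZero : NonZero q
    q-nonZero = ℕ.>-nonZero (ℕP.≤-trans (s≤s z≤n) 2≤q)

  digitsF-suc : ∀ f n → digitsF (suc f) n ≡ (n % q) ∷ digitsF f (n / q)
  digitsF-suc f n with q | q-nonZero
  ... | suc q′ | _ = ≡.refl

  -- The part of the Carlitz factorial coming from the digits of n, the lowest digit having weight D k.
  γ : ℕ → ℕ → ℕ → A
  γ zero    k n = 1#
  γ (suc f) k n = D k ^ (n % q) * γ f (suc k) (n / q)

  γ-closed : ∀ (Q : A → Set) → Q 1# → (∀ {x y} → Q x → Q y → Q (x * y)) →
             ∀ f k n → (∀ i → i < f ℕ.+ k → Q (D i)) → Q (γ f k n)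
  γ-closed Q Q1 Q* zero    k n h = Q1
  γ-closed Q Q1 Q* (suc f) k n h = Q* (power (n % q)) (γ-closed Q Q1 Q* f (suc k) (n / q) (λ i i< → h i (ℕP.<-≤-trans i< (ℕP.≤-reflexive (ℕP.+-suc f k)))))
    where
    power : ∀ m → Q (D k ^ m)
    power zero    = Q1
    power (suc m) = Q* (h k (s≤s (ℕP.m≤n+m k f))) (power m)

  ΓS≈γ : ∀ n → ΓS n ≈ γ (suc n) 0 n
  ΓS≈γ n = trans (𝔸.prodP-map weight (zip (upTo (length (digits n))) (digits n))) (go (suc n) 0 n id (λ _ → ≡.refl))
    where
    weight : ℕ × ℕ → A
    weight p = D (proj₁ p) PA.^P proj₂ p
    go : ∀ f k n (g : ℕ → ℕ) → (∀ i → g i ≡ k ℕ.+ i) →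
         ∏ (zip (applyUpTo g (length (digitsF f n))) (digitsF f n)) weight ≈ γ f k n
    go zero    k n g h = refl
    go (suc f) k n g h rewrite digitsF-suc f n = *-cong
      (reflexive (≡.trans (𝔸.^P≡^ (D (g 0)) (n % q)) (≡.cong (λ i → D i ^ (n % q)) (≡.trans (h 0) (ℕP.+-identityʳ k)))))
      (go f (suc k) (n / q) (g ∘ suc) (λ i → ≡.trans (h (suc i)) (ℕP.+-suc k i)))

  γ-digit : ∀ f k r x → r < q → γ (suc f) k (r ℕ.+ x ℕ.* q) ≡ D k ^ r * γ f (suc k) x
  γ-digit f k r x r<q = ≡.cong₂ (λ a b → D k ^ a * γ f (suc k) b)
    (≡.trans (ℕD.[m+kn]%n≡m%n r x q) (ℕD.m<n⇒m%n≡m r<q))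
    (≡.trans (ℕD.+-distrib-/-∣ʳ r (ℕDiv.n∣m*n x)) (≡.cong₂ ℕ._+_ (ℕD.m<n⇒m/n≡0 r<q) (ℕD.m*n/n≡m x q)))

  -- As n / q < n for positive n, f steps exhaust the digits of n; a further digit is 0 and
  -- contributes an empty power.
  γ-fuel : ∀ f k n → n ≤ f → γ (suc f) k n ≈ γ f k n
  γ-fuel zero    k zero z≤n = trans (reflexive (γ-digit 0 k 0 0 (ℕP.≤-trans (s≤s z≤n) 2≤q))) (*-identityʳ 1#)
  γ-fuel (suc f) k n    n≤f = *-congˡ {D k ^ (n % q)} (γ-fuel f (suc k) (n / q) (quotient-bound n n≤f))
    where
    quotient-bound : ∀ n → n ≤ suc f → n / q ≤ f
    quotient-bound zero    _   = ℕP.≤-trans (ℕP.≤-reflexive (ℕD.0/n≡0 q)) z≤n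
    quotient-bound (suc n) n≤f = ℕ.s≤s⁻¹ (ℕP.≤-trans (ℕD.m/n<m (suc n) q 2≤q) n≤f)

  γ-fuel-+ : ∀ j f k n → n ≤ f → γ (j ℕ.+ f) k n ≈ γ f k n
  γ-fuel-+ zero    f k n n≤f = refl
  γ-fuel-+ (suc j) f k n n≤f = trans (γ-fuel (j ℕ.+ f) k n (ℕP.≤-trans n≤f (ℕP.m≤n+m f j))) (γ-fuel-+ j f k n n≤f)

  shift-digit : ∀ r a i → (r ℕ.+ a ℕ.* q) ℕ.+ q ℕ.^ suc i ≡ r ℕ.+ (a ℕ.+ q ℕ.^ i) ℕ.* q
  shift-digit r a i = ≡.trans (ℕP.+-assoc r (a ℕ.* q) (q ℕ.^ suc i))
    (≡.cong (r ℕ.+_) (≡.trans (≡.cong (a ℕ.* q ℕ.+_) (ℕP.*-comm q (q ℕ.^ i))) (≡.sym (ℕP.*-distribʳ-+ q a (q ℕ.^ i)))))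

  halving : ∀ x f → 1 ≤ x → x ℕ.* q ≤ suc f → x ≤ f
  halving x f 1≤x h = ℕ.s≤s⁻¹ (ℕP.≤-trans (ℕP.+-monoˡ-≤ x 1≤x) (ℕP.≤-trans (ℕP.≤-reflexive (≡.cong (x ℕ.+_) (≡.sym (ℕP.+-identityʳ x))))
    (ℕP.≤-trans (ℕP.≤-reflexive (ℕP.*-comm 2 x)) (ℕP.≤-trans (ℕP.*-monoʳ-≤ x 2≤q) h))))

  -- Adding q^i to m may carry; a carry out of place k replaces D k ^ q by D (suc k), a multiple of it.
  γ-carry : ∀ f k m i → m ℕ.+ q ℕ.^ i ≤ f → ∃ λ κ → γ f k (m ℕ.+ q ℕ.^ i) ≈ κ * (D (k ℕ.+ i) * γ f k m)
  γ-carry zero k m i h = ⊥-elim (ℕP.<-irrefl ≡.refl (ℕP.≤-trans (ℕP.≤-trans (s≤s z≤n) (i<q^i i)) (ℕP.≤-trans (ℕP.m≤n+m _ m) h)))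
  γ-carry (suc f) k m i h = ≡.subst (λ m → m ℕ.+ q ℕ.^ i ≤ suc f → ∃ λ κ → γ (suc f) k (m ℕ.+ q ℕ.^ i) ≈ κ * (D (k ℕ.+ i) * γ (suc f) k m))
      (≡.sym (ℕD.m≡m%n+[m/n]*n m q)) (split (m % q) (m / q) i (ℕD.m%n<n m q)) h
    where
    split : ∀ r a i → r < q → (r ℕ.+ a ℕ.* q) ℕ.+ q ℕ.^ i ≤ suc f →
            ∃ λ κ → γ (suc f) k ((r ℕ.+ a ℕ.* q) ℕ.+ q ℕ.^ i) ≈ κ * (D (k ℕ.+ i) * γ (suc f) k (r ℕ.+ a ℕ.* q))
    split r a zero r<q h with suc r ℕ.<? q
    ... | yes r+1<q = 1# , (begin
      γ (suc f) k ((r ℕ.+ a ℕ.* q) ℕ.+ 1)  ≡⟨ ≡.cong (γ (suc f) k) (ℕP.+-comm (r ℕ.+ a ℕ.* q) 1) ⟩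
      γ (suc f) k (suc r ℕ.+ a ℕ.* q)  ≡⟨ γ-digit f k (suc r) a r+1<q ⟩
      D k * D k ^ r * γ f (suc k) a  ≈⟨ solve 3 (λ a b c → a :* b :* c := :1# :* (a :* (b :* c))) refl (D k) (D k ^ r) (γ f (suc k) a) ⟩
      1# * (D k * (D k ^ r * γ f (suc k) a))  ≡⟨ ≡.cong₂ (λ j g → 1# * (D j * g)) (≡.sym (ℕP.+-identityʳ k)) (≡.sym (γ-digit f k r a r<q)) ⟩
      1# * (D (k ℕ.+ 0) * γ (suc f) k (r ℕ.+ a ℕ.* q))  ∎)
    ... | no r+1≮q with γ-carry f (suc k) a 0 (ℕP.≤-trans (ℕP.≤-reflexive (ℕP.+-comm a 1)) (halving (suc a) f (s≤s z≤n)
                          (ℕP.≤-trans (ℕP.≤-reflexive (≡.trans (≡.cong (ℕ._+ a ℕ.* q) q≡r+1) (ℕP.+-comm 1 (r ℕ.+ a ℕ.* q)))) h)))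
      where
      q≡r+1 : q ≡ suc r
      q≡r+1 = ℕP.≤-antisym (ℕP.≮⇒≥ r+1≮q) r<q
    -- The digit r = q - 1 wraps to 0 and 1 is added one place higher. There D_{k+1} = [k+1] · D_k ·
    -- D_k^r returns both the required D_k and the power D_k^r lost in wrapping, leaving [k+1] as
    -- the extra factor.
    ...   | κ , e = κ * ⟨k+1⟩ , (begin
      γ (suc f) k ((r ℕ.+ a ℕ.* q) ℕ.+ 1)  ≡⟨ ≡.cong (γ (suc f) k) (≡.trans (ℕP.+-comm (r ℕ.+ a ℕ.* q) 1) (≡.cong (ℕ._+ a ℕ.* q) (≡.sym q≡r+1))) ⟩
      γ (suc f) k (0 ℕ.+ suc a ℕ.* q)  ≡⟨ γ-digit f k 0 (suc a) (ℕP.≤-trans (s≤s z≤n) r<q) ⟩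
      1# * γ f (suc k) (suc a)  ≈⟨ *-identityˡ (γ f (suc k) (suc a)) ⟩
      γ f (suc k) (suc a)  ≡⟨ ≡.cong (γ f (suc k)) (ℕP.+-comm 1 a) ⟩
      γ f (suc k) (a ℕ.+ 1)  ≈⟨ e ⟩
      κ * (D (suc k ℕ.+ 0) * γ f (suc k) a)  ≡⟨ ≡.cong (λ j → κ * (D j * γ f (suc k) a)) (ℕP.+-identityʳ (suc k)) ⟩
      κ * (D (suc k) * γ f (suc k) a)  ≈⟨ *-congˡ {κ} (*-congʳ {γ f (suc k) a} (trans (D-suc k) (*-congˡ {⟨k+1⟩} (^-congʳ (D k) q≡r+1)))) ⟩
      κ * (⟨k+1⟩ * (D k * D k ^ r) * γ f (suc k) a)
        ≈⟨ solve 5 (λ x b d p g → x :* (b :* (d :* p) :* g) := (x :* b) :* (d :* (p :* g))) refl κ ⟨k+1⟩ (D k) (D k ^ r) (γ f (suc k) a) ⟩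
      κ * ⟨k+1⟩ * (D k * (D k ^ r * γ f (suc k) a))
        ≡⟨ ≡.cong₂ (λ j g → κ * ⟨k+1⟩ * (D j * g)) (≡.sym (ℕP.+-identityʳ k)) (≡.sym (γ-digit f k r a r<q)) ⟩
      κ * ⟨k+1⟩ * (D (k ℕ.+ 0) * γ (suc f) k (r ℕ.+ a ℕ.* q))  ∎)
      where
      q≡r+1 : q ≡ suc r
      q≡r+1 = ℕP.≤-antisym (ℕP.≮⇒≥ r+1≮q) r<q
      ⟨k+1⟩ : A
      ⟨k+1⟩ = θ ^ (q ℕ.^ suc k) - θ
    split r a (suc i) r<q h with γ-carry f (suc k) a i (halving (a ℕ.+ q ℕ.^ i) f (ℕP.≤-trans (ℕP.≤-trans (s≤s z≤n) (i<q^i i)) (ℕP.m≤n+m _ a))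
                                   (ℕP.≤-trans (ℕP.m≤n+m _ r) (ℕP.≤-trans (ℕP.≤-reflexive (≡.sym (shift-digit r a i))) h)))
    ... | κ , e = κ , (begin
      γ (suc f) k ((r ℕ.+ a ℕ.* q) ℕ.+ q ℕ.^ suc i)  ≡⟨ ≡.cong (γ (suc f) k) (shift-digit r a i) ⟩
      γ (suc f) k (r ℕ.+ (a ℕ.+ q ℕ.^ i) ℕ.* q)  ≡⟨ γ-digit f k r (a ℕ.+ q ℕ.^ i) r<q ⟩
      D k ^ r * γ f (suc k) (a ℕ.+ q ℕ.^ i)  ≈⟨ *-congˡ {D k ^ r} e ⟩
      D k ^ r * (κ * (D (suc k ℕ.+ i) * γ f (suc k) a))
        ≈⟨ solve 4 (λ p x d g → p :* (x :* (d :* g)) := x :* (d :* (p :* g))) refl (D k ^ r) κ (D (suc k ℕ.+ i)) (γ f (suc k) a) ⟩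
      κ * (D (suc k ℕ.+ i) * (D k ^ r * γ f (suc k) a))  ≡⟨ ≡.cong₂ (λ j g → κ * (D j * g)) (≡.sym (ℕP.+-suc k i)) (≡.sym (γ-digit f k r a r<q)) ⟩
      κ * (D (k ℕ.+ suc i) * γ (suc f) k (r ℕ.+ a ℕ.* q))  ∎)

  D*ΓS∣ΓS : ∀ n i → q ℕ.^ i ≤ n → ∃ λ κ → ΓS n ≈ κ * (D i * ΓS (n ∸ q ℕ.^ i))
  D*ΓS∣ΓS n i q^i≤n with γ-carry (suc n) 0 (n ∸ q ℕ.^ i) i (ℕP.≤-trans (ℕP.≤-reflexive (ℕP.m∸n+n≡m q^i≤n)) (ℕP.n≤1+n n))
  ... | κ , e = κ , (begin
    ΓS n  ≈⟨ ΓS≈γ n ⟩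
    γ (suc n) 0 n  ≡⟨ ≡.cong (γ (suc n) 0) (≡.sym (ℕP.m∸n+n≡m q^i≤n)) ⟩
    γ (suc n) 0 (m ℕ.+ q ℕ.^ i)  ≈⟨ e ⟩
    κ * (D i * γ (suc n) 0 m)  ≈⟨ *-congˡ {κ} (*-congˡ {D i} fuel) ⟩
    κ * (D i * ΓS m)  ∎)
    where
    m : ℕ
    m = n ∸ q ℕ.^ i
    fuel : γ (suc n) 0 m ≈ ΓS m
    fuel = begin
      γ (suc n) 0 m  ≡⟨ ≡.cong (λ f → γ f 0 m) (≡.sym (ℕP.m∸n+n≡m (s≤s (ℕP.m∸n≤m n (q ℕ.^ i))))) ⟩
      γ (suc n ∸ suc m ℕ.+ suc m) 0 m  ≈⟨ γ-fuel-+ (suc n ∸ suc m) (suc m) 0 m (ℕP.n≤1+n m) ⟩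
      γ (suc m) 0 m  ≈⟨ ΓS≈γ m ⟨
      ΓS m  ∎

-- Ring identities behind the cancellation of denominators and remainders.

module Rearrangements (R : CommutativeRing 0ℓ 0ℓ) where
  open Tools R

  -- One summand of the numerator: Γ and g are the factorials of index n and n - q^i, d is D_i(t),
  -- N/Δ the earlier fraction, W the cofactor and E the common denominator. Divisibility of Γ by d g
  -- lets g clear the earlier fraction and d complete E.
  cancel-denominator : ∀ Γ κ d g G N W h Δ E → Γ ≈ κ * (d * g) → g * N ≈ h * Δ → E ≈ d * Δ * W →
                       Γ * (G * N * W) ≈ κ * G * h * E
  cancel-denominator Γ κ d g G N W h Δ E Γ≈ gN≈ E≈ = begin
    Γ * (G * N * W)  ≈⟨ *-congʳ Γ≈ ⟩
    κ * (d * g) * (G * N * W)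
      ≈⟨ solve 6 (λ κ d g G N W → κ :* (d :* g) :* (G :* N :* W) := κ :* G :* d :* W :* (g :* N)) refl κ d g G N W ⟩
    κ * G * d * W * (g * N)  ≈⟨ *-congˡ gN≈ ⟩
    κ * G * d * W * (h * Δ)
      ≈⟨ solve 6 (λ κ G d W h Δ → κ :* G :* d :* W :* (h :* Δ) := κ :* G :* h :* (d :* Δ :* W)) refl κ G d W h Δ ⟩
    κ * G * h * (d * Δ * W)  ≈⟨ *-congˡ E≈ ⟨
    κ * G * h * E  ∎

  subtract-product : ∀ q p r → r ≈ (q * p + r) + - q * p
  subtract-product = solve 3 (λ q p r → r := (q :* p :+ r) :+ (:- q) :* p) refl

  isolate-remainder : ∀ q a r → r ≈ - q * a + 1# * (q * a + r)
  isolate-remainder = solve 3 (λ q a r → r := (:- q) :* a :+ :1# :* (q :* a :+ r)) refl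

  [y+z]-y≈z : ∀ y z → (y + z) - y ≈ z
  [y+z]-y≈z = solve 2 (λ y z → (y :+ z) :- y := z) refl

  ∑-multiple : ∀ {X : Set} (xs : List X) f z → (∀ {x} → x ∈ xs → ∃ λ y → f x ≈ y * z) → ∃ λ y → ∑ xs f ≈ y * z
  ∑-multiple []       f z h = 0# , sym (zeroˡ z)
  ∑-multiple (x ∷ xs) f z h with h (here ≡.refl) | ∑-multiple xs f z (h ∘ there)
  ... | y , e | y′ , e′ = y + y′ , trans (+-cong e e′) (sym (distribʳ z y y′))

  *-∑-multiple : ∀ {X : Set} (xs : List X) Γ N f z → N ≈ ∑ xs f → (∀ {x} → x ∈ xs → ∃ λ y → Γ * f x ≈ y * z) →
                 ∃ λ y → Γ * N ≈ y * z
  *-∑-multiple xs Γ N f z N≈ h with ∑-multiple xs (λ x → Γ * f x) z h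
  ... | y , e = y , trans (*-congˡ N≈) (trans (∑-*ˡ xs Γ f) e)

-- Integrality of the Anderson-Thakur polynomials.

module AndersonThakur (F : FiniteField) where
  open PolynomialsOverFq F
  open CarlitzFactorial F using (D*ΓS∣ΓS)
  open Setup F hiding (q)
  open Tools ringAt
  open Rearrangements ringAt
  private module τ = Hom θ↦tHom

  look-++ˡ : ∀ (xs ys : List Frac) {k} → k < length xs → look (xs ++ ys) k ≡ look xs k
  look-++ˡ (x ∷ xs) ys {zero}  _       = ≡.refl
  look-++ˡ (x ∷ xs) ys {suc k} (s≤s h) = look-++ˡ xs ys h

  look-∷ʳ : ∀ (xs : List Frac) y → look (xs ++ [ y ]) (length xs) ≡ y
  look-∷ʳ []       y = ≡.refl
  look-∷ʳ (x ∷ xs) y = look-∷ʳ xs y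

  length-table : ∀ n → length (table n) ≡ suc n
  length-table zero    = ≡.refl
  length-table (suc n) = ≡.trans (LP.length-++ (table n)) (≡.trans (≡.cong (ℕ._+ 1) (length-table n)) (ℕP.+-comm (suc n) 1))

  Num Den : ℕ → At
  Num n = proj₁ (look (table n) n)
  Den n = proj₂ (look (table n) n)

  look-table : ∀ {n k} → k ≤ n → look (table n) k ≡ look (table k) k
  look-table {zero}  z≤n = ≡.refl
  look-table {suc n} {k} h with ℕP.m≤n⇒m<n∨m≡n h
  ... | inj₂ ≡.refl    = ≡.refl
  ... | inj₁ (s≤s k≤n) = ≡.trans (look-++ˡ (table n) _ (ℕP.≤-trans (s≤s k≤n) (ℕP.≤-reflexive (≡.sym (length-table n))))) (look-table k≤n)

  look-step : ∀ n → look (table (suc n)) (suc n) ≡ step (suc n) (table n)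
  look-step n = ≡.trans (≡.cong (look (table n ++ [ s ])) (≡.sym (length-table n))) (look-∷ʳ (table n) s)
    where
    s : Frac
    s = step (suc n) (table n)

  indices : ℕ → List ℕ
  indices n = filter (λ i → q ℕ.^ i ℕ.≤? n) (upTo (suc n))

  indices-≤ : ∀ n {i} → i ∈ indices n → q ℕ.^ i ≤ n
  indices-≤ n i∈ = proj₂ (∈P.∈-filter⁻ (λ i → q ℕ.^ i ℕ.≤? n) {xs = upTo (suc n)} i∈)

  indices-unique : ∀ n → Unique (indices n)
  indices-unique n = UniqueP.filter⁺ (λ i → q ℕ.^ i ℕ.≤? n) (UniqueP.upTo⁺ (suc n))

  denominator : ℕ → ℕ → At
  denominator n i = θ↦t (D i) * Den (n ∸ q ℕ.^ i)

  cofactor : ℕ → ℕ → At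
  cofactor n i = ∏ (filter (λ j → ¬? (j ℕ.≟ i)) (indices n)) (denominator n)

  term : ℕ → ℕ → At
  term n i = Gθ i * Num (n ∸ q ℕ.^ i) * cofactor n i

  n∸q^i≤m : ∀ m i → suc m ∸ q ℕ.^ i ≤ m
  n∸q^i≤m m i = ℕP.≤-trans (ℕP.∸-monoʳ-≤ (suc m) (ℕP.≤-trans (s≤s z≤n) (i<q^i i))) ℕP.≤-refl

  private
    table-entry : ∀ m i → look (table m) (suc m ∸ q ℕ.^ i) ≡ look (table (suc m ∸ q ℕ.^ i)) (suc m ∸ q ℕ.^ i)
    table-entry m i = look-table (n∸q^i≤m m i)

    dd : ℕ → ℕ → At
    dd m i = θ↦t (D i) * proj₂ (look (table m) (suc m ∸ q ℕ.^ i))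

    others : ℕ → ℕ → List ℕ
    others m i = filter (λ j → ¬? (j ℕ.≟ i)) (indices (suc m))

    nn : ℕ → ℕ → At
    nn m i = Gθ i * proj₁ (look (table m) (suc m ∸ q ℕ.^ i)) * PAt.prodP (map (dd m) (others m i))

    dd≈ : ∀ m i → dd m i ≈ denominator (suc m) i
    dd≈ m i = *-congˡ {θ↦t (D i)} (reflexive (≡.cong proj₂ (table-entry m i)))

  Den-suc : ∀ m → Den (suc m) ≈ ∏ (indices (suc m)) (denominator (suc m))
  Den-suc m = trans (reflexive (≡.cong proj₂ (look-step m))) (trans (𝔸t.prodP-map (dd m) (indices (suc m))) (∏-cong (indices (suc m)) (dd≈ m)))

  Den-split : ∀ n {i} → 1 ≤ n → i ∈ indices n → Den n ≈ denominator n i * cofactor n i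
  Den-split (suc m) _ i∈ = trans (Den-suc m) (∏-extract (indices-unique (suc m)) i∈ (denominator (suc m)))

  Num-suc : ∀ n → 1 ≤ n → Num n ≈ ∑ (indices n) (term n)
  Num-suc (suc m) _ = trans (reflexive (≡.cong proj₁ (look-step m))) (trans (𝔸t.sumP-map (nn m) (indices (suc m))) (∑-cong (indices (suc m)) nn≈))
    where
    nn≈ : ∀ i → nn m i ≈ term (suc m) i
    nn≈ i = *-cong (*-congˡ {Gθ i} (reflexive (≡.cong proj₁ (table-entry m i))))
                    (trans (𝔸t.prodP-map (dd m) (others m i)) (∏-cong (others m i) (dd≈ m)))

  θ↦t-product : ∀ a κ d g → CommutativeRing._≈_ ringA a (κ PA.⊗ (d PA.⊗ g)) → θ↦t a ≈ θ↦t κ * (θ↦t d * θ↦t g)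
  θ↦t-product a κ d g e = begin
    θ↦t a  ≈⟨ θ↦t≈ a ⟩
    τ.⟦ a ⟧  ≈⟨ τ.⟦⟧-cong e ⟩
    τ.⟦ κ PA.⊗ (d PA.⊗ g) ⟧  ≈⟨ τ.*-homo κ (d PA.⊗ g) ⟩
    τ.⟦ κ ⟧ * τ.⟦ d PA.⊗ g ⟧  ≈⟨ *-congˡ {τ.⟦ κ ⟧} (τ.*-homo d g) ⟩
    τ.⟦ κ ⟧ * (τ.⟦ d ⟧ * τ.⟦ g ⟧)  ≈⟨ *-cong (θ↦t≈ κ) (*-cong (θ↦t≈ d) (θ↦t≈ g)) ⟨
    θ↦t κ * (θ↦t d * θ↦t g)  ∎

  -- Γ_{n+1}(t) times the n-th coefficient lies in A[t]; the witness `h` is H_n, obtained before any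
  -- division is performed.
  Integral : ℕ → Set
  Integral n = ∃ λ h → θ↦t (ΓS n) * Num n ≈ h * Den n

  integral-term : ∀ n i → 1 ≤ n → i ∈ indices n → Integral (n ∸ q ℕ.^ i) → ∃ λ y → θ↦t (ΓS n) * term n i ≈ y * Den n
  integral-term n i 1≤n i∈ (h , e′) with D*ΓS∣ΓS n i (indices-≤ n i∈)
  ... | κ , e = θ↦t κ * Gθ i * h ,
    cancel-denominator (θ↦t (ΓS n)) (θ↦t κ) (θ↦t (D i)) (θ↦t (ΓS m)) (Gθ i) (Num m) (cofactor n i) h (Den m) (Den n)
      (θ↦t-product (ΓS n) κ (D i) (ΓS m) e) e′ (Den-split n 1≤n i∈)
    where
    m : ℕ
    m = n ∸ q ℕ.^ i

  integral : ∀ n → Integral n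
  integral = <-rec Integral go
    where
    go : ∀ n → (∀ {m} → m < n → Integral m) → Integral n
    go zero    rec = θ↦t (ΓS 0) , refl
    go (suc m) rec = *-∑-multiple (indices (suc m)) (θ↦t (ΓS (suc m))) (Num (suc m)) (term (suc m)) (Den (suc m)) (Num-suc (suc m) (s≤s z≤n))
      (λ {i} i∈ → integral-term (suc m) i (s≤s z≤n) i∈ (rec (s≤s (n∸q^i≤m m i))))

  Den-monic : ∀ n → 𝔸tMonic.IsMonic (Den n)
  Den-monic = <-rec _ go
    where
    go : ∀ n → (∀ {m} → m < n → 𝔸tMonic.IsMonic (Den m)) → 𝔸tMonic.IsMonic (Den n)
    go zero    rec = 0 , 𝔸tMonic.monic-one
    go (suc m) rec with 𝔸tMonic.monic-∏ (indices (suc m)) (denominator (suc m)) factor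
      where
      factor : ∀ {i} → i ∈ indices (suc m) → 𝔸tMonic.IsMonic (denominator (suc m) i)
      factor {i} _ with monic-θ↦t {D i} (monic-D i) | rec (s≤s (n∸q^i≤m m i))
      ... | l , ml | k , mk = l ℕ.+ k , 𝔸tMonic.monic-⊗ {θ↦t (D i)} ml mk
    ... | l , ml = l , 𝔸tMonic.monic-≈ (sym (Den-suc m)) ml

  private
    oneP-All : All Normal PAt.oneP
    oneP-All = 𝔸tDiv.norm-All (𝔸Div.norm-idem [ FiniteField.1# F ] ∷ [])

    prodP-reduced : ∀ (ps : List At) → PAt.norm (PAt.prodP ps) ≡ PAt.prodP ps × All Normal (PAt.prodP ps)
    prodP-reduced []       = 𝔸tDiv.norm-idem [ PA.oneP ] , oneP-All
    prodP-reduced (p ∷ ps) = 𝔸tDiv.norm-idem (𝔸t.mulRaw p (PAt.prodP ps)) , 𝔸tDiv.⊗-All p (PAt.prodP ps)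

  -- Long division reads the degree of the divisor off its list length, so being monic is not
  -- enough: the list must also be free of trailing zeros.
  Den-reduced : ∀ n → PAt.norm (Den n) ≡ Den n × All Normal (Den n)
  Den-reduced zero    = prodP-reduced []
  Den-reduced (suc m) = ≡.subst (λ p → PAt.norm p ≡ p × All Normal p) (≡.sym (≡.cong proj₂ (look-step m))) (prodP-reduced (map (dd m) (indices (suc m))))

  Den-length : ∀ n → length (Den n) ≡ suc (proj₁ (Den-monic n))
  Den-length n with Den-monic n | Den-reduced n
  ... | l , 𝔸tMonic.monic leading beyond | normed , coeffs = 𝔸tDiv.length-exact (Den n) l normed coeffs beyond
    (λ leading≈0 → FiniteField.0≢1 F (𝔸.coeff-≈ (A.trans (A.sym leading≈0) (A.trans leading (𝔸.norm-≈ [ FiniteField.1# F ]))) 0))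
    where module A = Tools ringA

  -- The quotient is exact by `integral` and unique because `Den n` is monic. All later knowledge of
  -- the polynomial `H n` comes from this equation.
  H*Den : ∀ n → H n * Den n ≈ θ↦t (ΓS n) * Num n
  H*Den n with integral n
  ... | h , e = trans (*-congʳ {Den n} (𝔸tDiv.Divisor.quot-exact (Den n) l (Den-length n) (𝔸tMonic.leading (proj₂ (Den-monic n)))
                  (θ↦t (ΓS n) * Num n) h (𝔸tDiv.⊗-All (θ↦t (ΓS n)) (Num n)) e)) (sym e)
    where
    l : ℕ
    l = proj₁ (Den-monic n)

-- Twisted specialisation of A[t] and the Anderson-Thakur identity.

module Specialization (F : FiniteField) (K : CommutativeRing 0ℓ 0ℓ) (cls : Hom (PolynomialsOverFq.ringA F) K) where
  open PolynomialsOverFq F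
  open AndersonThakur F
  open Setup F hiding (q)
  open FiniteField F using (_≟_) renaming (Carrier to 𝔽; 1# to 1ᶠ)
  open Tools K
  private module cls = Hom cls

  data-K : CarlitzData F K
  data-K = mapCarlitzData cls carlitzA

  open Carlitz F K data-K using (ι; _^[_]; G; eval-∷ʳ) renaming (θ to θᴷ; D to Dᴷ; L to Lᴷ) public
  open FieldAlgebra F K ι
  open Evaluation fieldRing _≟_ K ι θᴷ using () renaming (eval to evalᴷ) public

  evalᴷ≈cls : ∀ a → evalᴷ a ≈ cls.⟦ a ⟧
  evalᴷ≈cls []      = sym cls.0-homo
  evalᴷ≈cls (c ∷ a) = begin
    cls.⟦ PA.const c ⟧ + θᴷ * evalᴷ a  ≈⟨ +-congˡ (*-congˡ (evalᴷ≈cls a)) ⟩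
    cls.⟦ PA.const c ⟧ + θᴷ * cls.⟦ a ⟧  ≈⟨ +-congˡ (cls.*-homo θ a) ⟨
    cls.⟦ PA.const c ⟧ + cls.⟦ θ PA.⊗ a ⟧  ≈⟨ cls.+-homo (PA.const c) (θ PA.⊗ a) ⟨
    cls.⟦ PA.const c PA.⊕ θ PA.⊗ a ⟧  ≈⟨ cls.⟦⟧-cong (𝔸Monic.∷-≈ c a) ⟨
    cls.⟦ c ∷ a ⟧  ∎

  evalᴷ-monic : ∀ v → θᴷ ^ length v + evalᴷ v ≈ cls.⟦ v ++ [ 1ᶠ ] ⟧
  evalᴷ-monic v = begin
    θᴷ ^ length v + evalᴷ v  ≈⟨ +-comm _ _ ⟩
    evalᴷ v + θᴷ ^ length v  ≈⟨ +-congˡ (trans (*-congʳ (Hom.1-homo ι)) (*-identityˡ _)) ⟨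
    evalᴷ v + Hom.⟦_⟧ ι 1ᶠ * θᴷ ^ length v  ≈⟨ eval-∷ʳ v 1ᶠ ⟨
    evalᴷ (v ++ [ 1ᶠ ])  ≈⟨ evalᴷ≈cls (v ++ [ 1ᶠ ]) ⟩
    cls.⟦ v ++ [ 1ᶠ ] ⟧  ∎

  -- The d-th Frobenius twist of A[t] followed by t ↦ θ.
  ε : ℕ → Hom ringAt K
  ε d = Evaluation.evalHom ringA _≟ᴬ_ K (frobenius d ∘ʰ cls) θᴷ

  private module ε d = Hom (ε d)
  private module E d = Evaluation ringA _≟ᴬ_ K (frobenius d ∘ʰ cls) θᴷ

  ε-const : ∀ d a → ε.⟦_⟧ d (cA a) ≈ cls.⟦ a ⟧ ^[ d ]
  ε-const d a = E.eval-const d a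

  ε-X^ : ∀ d n → ε.⟦_⟧ d (PAt.X^ n) ≈ θᴷ ^ n
  ε-X^ d n = trans (E.eval-monomial d PA.oneP n) (trans (*-congˡ (trans (^-congˡ (q ℕ.^ d) cls.1-homo) (1^n≈1 (q ℕ.^ d)))) (*-identityʳ _))

  -- The coefficients of `θ↦t a` come from the finite field, which Frobenius fixes; so the value is
  -- independent of d.
  ε-θ↦t : ∀ d a → ε.⟦_⟧ d (θ↦t a) ≈ cls.⟦ a ⟧
  ε-θ↦t d a = trans (ε.⟦⟧-cong d (θ↦t≈ a)) (go a)
    where
    go : ∀ a → ε.⟦_⟧ d (ET.eval a) ≈ cls.⟦ a ⟧
    go []      = sym cls.0-homo
    go (c ∷ a) = begin
      ε.⟦_⟧ d (cA (PA.const c) PAt.⊕ t PAt.⊗ ET.eval a)  ≈⟨ ε.+-homo d (cA (PA.const c)) (t PAt.⊗ ET.eval a) ⟩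
      ε.⟦_⟧ d (cA (PA.const c)) + ε.⟦_⟧ d (t PAt.⊗ ET.eval a)  ≈⟨ +-cong (trans (ε-const d (PA.const c)) (frobenius-ι d c)) (ε.*-homo d t (ET.eval a)) ⟩
      cls.⟦ PA.const c ⟧ + ε.⟦_⟧ d t * ε.⟦_⟧ d (ET.eval a)  ≈⟨ +-congˡ (*-cong (trans (ε-X^ d 1) (*-identityʳ _)) (trans (go a) (sym (evalᴷ≈cls a)))) ⟩
      evalᴷ (c ∷ a)  ≈⟨ evalᴷ≈cls (c ∷ a) ⟩
      cls.⟦ c ∷ a ⟧  ∎

  cls-≡-^ : ∀ n → cls.⟦ θ PA.^P n ⟧ ≈ θᴷ ^ n
  cls-≡-^ n = trans (reflexive (≡.cong cls.⟦_⟧ (𝔸.^P≡^ θ n))) (cls.^-homo θ n)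

  ε-Gθ : ∀ d i → ε.⟦_⟧ d (Gθ i) ≈ G d i
  ε-Gθ d i = trans (ε.⟦⟧-cong d (𝔸t.prodP-map factorᵗ (upTo i))) (trans (ε.∏-homo d (upTo i) factorᵗ) (∏-cong (upTo i) factor))
    where
    factorᵗ : ℕ → At
    factorᵗ l = PAt.X^ (q ℕ.^ i) PAt.⊖ cA (θ PA.^P (q ℕ.^ suc l))
    factor : ∀ l → ε.⟦_⟧ d (factorᵗ l) ≈ θᴷ ^[ i ] - θᴷ ^[ suc l ℕ.+ d ]
    factor l = trans (ε.sub-homo d (PAt.X^ (q ℕ.^ i)) (cA (θ PA.^P (q ℕ.^ suc l))))
      (+-cong (ε-X^ d (q ℕ.^ i)) (-‿cong (trans (ε-const d (θ PA.^P (q ℕ.^ suc l)))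
        (trans (^-congˡ (q ℕ.^ d) (cls-≡-^ (q ℕ.^ suc l))) (^q^-+ θᴷ (suc l) d)))))

  -- Horner evaluation rewritten over the indexed pairs that `tuples` enumerates. Applied to
  -- `uCoeffs s` it yields the sum of θ^j u_j^{q^d}.
  ε-∑ : ∀ d us → ε.⟦_⟧ d us ≈ ∑ (zip (upTo (length us)) us) (λ ju → θᴷ ^ proj₁ ju * cls.⟦ proj₂ ju ⟧ ^[ d ])
  ε-∑ d us = trans (sym (*-identityˡ _)) (go us 0 id (λ _ → ≡.refl))
    where
    go : ∀ us k (f : ℕ → ℕ) → (∀ i → f i ≡ k ℕ.+ i) →
         θᴷ ^ k * ε.⟦_⟧ d us ≈ ∑ (zip (applyUpTo f (length us)) us) (λ ju → θᴷ ^ proj₁ ju * cls.⟦ proj₂ ju ⟧ ^[ d ])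
    go []       k f h = zeroʳ _
    go (u ∷ us) k f h = begin
      θᴷ ^ k * (cls.⟦ u ⟧ ^[ d ] + θᴷ * ε.⟦_⟧ d us)  ≈⟨ solve 4 (λ p a t s → p :* (a :+ t :* s) := p :* a :+ (t :* p) :* s) refl _ _ _ _ ⟩
      θᴷ ^ k * cls.⟦ u ⟧ ^[ d ] + θᴷ ^ suc k * ε.⟦_⟧ d us  ≈⟨ +-cong (*-congʳ (^-congʳ θᴷ (≡.sym (≡.trans (h 0) (ℕP.+-identityʳ k)))))
                                                                       (go us (suc k) (f ∘ suc) (λ i → ≡.trans (h (suc i)) (ℕP.+-suc k i))) ⟩
      _  ∎

  module Values (M : ℕ) (b : List 𝔽 → Carrier) (b-inverse : ∀ v → length v < M → b v * (θᴷ ^ length v + evalᴷ v) ≈ 1#) where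
    open PowerSums F K data-K using (module Recursion)
    open Recursion M b b-inverse public

    i<M : ∀ n i → n < M → i ∈ indices n → i < M
    i<M n i n<M i∈ = ℕP.<-trans (ℕP.<-≤-trans (i<q^i i) (indices-≤ n i∈)) n<M

    ε-denominator : ∀ d n i → ε.⟦_⟧ d (denominator n i) ≈ Dᴷ i * ε.⟦_⟧ d (Den (n ∸ q ℕ.^ i))
    ε-denominator d n i = trans (ε.*-homo d (θ↦t (D i)) (Den (n ∸ q ℕ.^ i))) (*-congʳ (ε-θ↦t d (D i)))

    unit-ε-Den : ∀ d n → n < M → Unit (ε.⟦_⟧ d (Den n))
    unit-ε-Den d = <-rec (λ n → n < M → Unit (ε.⟦_⟧ d (Den n))) go
      where
      go : ∀ n → (∀ {m} → m < n → m < M → Unit (ε.⟦_⟧ d (Den m))) → n < M → Unit (ε.⟦_⟧ d (Den n))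
      go zero    rec _   = unit-≈ (sym (ε.1-homo d)) unit-1
      go (suc m) rec n<M = unit-≈ (sym (trans (ε.⟦⟧-cong d (Den-suc m)) (ε.∏-homo d (indices (suc m)) (denominator (suc m)))))
        (unit-∏ (indices (suc m)) _ λ {i} i∈ → unit-≈ (sym (ε-denominator d (suc m) i))
          (unit-* (unit-D i (i<M (suc m) i n<M i∈)) (rec (s≤s (n∸q^i≤m m i)) (ℕP.<-trans (s≤s (n∸q^i≤m m i)) n<M))))

    -- The cross-multiplied form of: the n-th coefficient of the twisted generating function is
    -- `powerSum d n`. Both sides obey one recursion; each summand gains a factor D_i⁻¹ D_i = 1 to
    -- complete the common denominator.
    ε-Num : ∀ d → d < M → ∀ n → n < M → ε.⟦_⟧ d (Num n) ≈ powerSum d n * ε.⟦_⟧ d (Den n)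
    ε-Num d d<M = <-rec (λ n → n < M → ε.⟦_⟧ d (Num n) ≈ powerSum d n * ε.⟦_⟧ d (Den n)) go
      where
      go : ∀ n → (∀ {m} → m < n → m < M → ε.⟦_⟧ d (Num m) ≈ powerSum d m * ε.⟦_⟧ d (Den m)) →
           n < M → ε.⟦_⟧ d (Num n) ≈ powerSum d n * ε.⟦_⟧ d (Den n)
      go zero    rec _   = trans (sym (*-identityˡ _)) (*-congʳ (sym (powerSum-0 d d<M)))
      go n@(suc m) rec n<M = begin
        ε.⟦_⟧ d (Num n)  ≈⟨ ε.⟦⟧-cong d (Num-suc n (s≤s z≤n)) ⟩
        ε.⟦_⟧ d (Tools.∑ ringAt (indices n) (term n))  ≈⟨ ε.∑-homo d (indices n) (term n) ⟩
        ∑ (indices n) (λ i → ε.⟦_⟧ d (term n i))  ≈⟨ ∑-cong-∈ (indices n) (λ {i} i∈ → ε-term i i∈) ⟩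
        ∑ (indices n) (λ i → g d i * powerSum d (n ∸ q ℕ.^ i) * ε.⟦_⟧ d (Den n)) ≈⟨ ∑-*ʳ (indices n) _ _ ⟨
        ∑ (indices n) (λ i → g d i * powerSum d (n ∸ q ℕ.^ i)) * ε.⟦_⟧ d (Den n) ≈⟨ *-congʳ (powerSum-recursion d d<M n (s≤s z≤n) n<M) ⟨
        powerSum d n * ε.⟦_⟧ d (Den n)  ∎
        where
        ε-term : ∀ i → i ∈ indices n → ε.⟦_⟧ d (term n i) ≈ g d i * powerSum d (n ∸ q ℕ.^ i) * ε.⟦_⟧ d (Den n)
        ε-term i i∈ = begin
          ε.⟦_⟧ d (term n i)  ≈⟨ ε.*-homo d (Gθ i PAt.⊗ Num k) (cofactor n i) ⟩
          ε.⟦_⟧ d (Gθ i PAt.⊗ Num k) * W  ≈⟨ *-congʳ (ε.*-homo d (Gθ i) (Num k)) ⟩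
          ε.⟦_⟧ d (Gθ i) * ε.⟦_⟧ d (Num k) * W
            ≈⟨ *-congʳ (*-cong (ε-Gθ d i) (rec (s≤s (n∸q^i≤m m i)) (ℕP.<-trans (s≤s (n∸q^i≤m m i)) n<M))) ⟩
          G d i * (powerSum d k * Δ) * W  ≈⟨ *-congʳ (*-congʳ (trans (sym (*-identityʳ _)) (*-congˡ (sym (D⁻¹-inverse i (i<M n i n<M i∈)))))) ⟩
          G d i * (D⁻¹ i * Dᴷ i) * (powerSum d k * Δ) * W
            ≈⟨ solve 6 (λ G J D p Δ W → G :* (J :* D) :* (p :* Δ) :* W := G :* J :* p :* (D :* Δ :* W)) refl _ _ _ _ _ _ ⟩
          g d i * powerSum d k * (Dᴷ i * Δ * W)  ≈⟨ *-congˡ (trans (ε.⟦⟧-cong d (Den-split n (s≤s z≤n) i∈)) (trans (ε.*-homo d (denominator n i) (cofactor n i)) (*-congʳ (ε-denominator d n i)))) ⟨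
          g d i * powerSum d k * ε.⟦_⟧ d (Den n)  ∎
          where
          k : ℕ
          k = n ∸ q ℕ.^ i
          Δ W : Carrier
          Δ = ε.⟦_⟧ d (Den k)
          W = ε.⟦_⟧ d (cofactor n i)

    -- The Anderson-Thakur identity for s = n + 1. The bound on d makes monic polynomials of degree
    -- d invertible; the bound on n makes the specialised denominator a unit, so that it can be
    -- cancelled.
    ε-H : ∀ d n → d < M → n < M → ε.⟦_⟧ d (H n) ≈ cls.⟦ ΓS n ⟧ * powerSum d n
    ε-H d n d<M n<M = unit-cancelˡ (unit-ε-Den d n n<M) (begin
      Δ * ε.⟦_⟧ d (H n)  ≈⟨ *-comm _ _ ⟩
      ε.⟦_⟧ d (H n) * Δ  ≈⟨ ε.*-homo d (H n) (Den n) ⟨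
      ε.⟦_⟧ d (H n PAt.⊗ Den n)  ≈⟨ ε.⟦⟧-cong d (H*Den n) ⟩
      ε.⟦_⟧ d (θ↦t (ΓS n) PAt.⊗ Num n)  ≈⟨ ε.*-homo d (θ↦t (ΓS n)) (Num n) ⟩
      ε.⟦_⟧ d (θ↦t (ΓS n)) * ε.⟦_⟧ d (Num n)  ≈⟨ *-cong (ε-θ↦t d (ΓS n)) (ε-Num d d<M n n<M) ⟩
      cls.⟦ ΓS n ⟧ * (powerSum d n * Δ)  ≈⟨ solve 3 (λ a b c → a :* (b :* c) := c :* (a :* b)) refl _ _ _ ⟩
      Δ * (cls.⟦ ΓS n ⟧ * powerSum d n)  ∎)
      where
      Δ : Carrier
      Δ = ε.⟦_⟧ d (Den n)

-- Nested sums: zeta values and polylogarithms of arbitrary depth.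

module PolylogarithmSums (F : FiniteField) (K : CommutativeRing 0ℓ 0ℓ) (cls : Hom (PolynomialsOverFq.ringA F) K) where
  open PolynomialsOverFq F
  open CarlitzFactorial F using (γ-closed; ΓS≈γ)
  open Setup F hiding (q)
  open FiniteField F using () renaming (Carrier to 𝔽)
  open Tools K
  open Specialization F K cls
  private
    module cls = Hom cls
    module ε d = Hom (ε d)

  exponent : List (ℕ × A) → ℕ
  exponent ju = foldr ℕ._+_ 0 (map proj₁ ju)

  module Sums (M : ℕ) (b : List 𝔽 → Carrier) (b-inverse : ∀ v → length v < M → b v * (θᴷ ^ length v + evalᴷ v) ≈ 1#)
              (L⁻¹ : ℕ → Carrier) (L⁻¹-inverse : ∀ i → i < M → L⁻¹ i * Lᴷ i ≈ 1#) where
    open Values M b b-inverse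

    -- `zetaᴷ` and `liᴷ` mirror `zetaB` and `liB` without the reduction modulo P after each
    -- operation.
    zetaᴷ : ℕ → List ℕ → Carrier
    zetaᴷ d []       = 1#
    zetaᴷ d (s ∷ ss) = ∑ (upTo d) (λ i → ∑ (vecs i) (λ v → b v ^ s * zetaᴷ i ss))

    liᴷ : ℕ → List ℕ → List A → Carrier
    liᴷ d []       _        = 1#
    liᴷ d (s ∷ ss) []       = 0#
    liᴷ d (s ∷ ss) (u ∷ us) = ∑ (upTo d) (λ i → cls.⟦ u ⟧ ^[ i ] * L⁻¹ i ^ s * liᴷ i ss us)

    unit-ΓS : ∀ n → n < M → Unit cls.⟦ ΓS n ⟧
    unit-ΓS n n<M = unit-≈ (sym (cls.⟦⟧-cong (ΓS≈γ n)))
      (γ-closed (λ a → Unit cls.⟦ a ⟧) (unit-≈ (sym cls.1-homo) unit-1) (λ {x} {y} u v → unit-≈ (sym (cls.*-homo x y)) (unit-* u v)) (suc n) 0 n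
        (λ i i≤n → unit-D i (ℕP.<-≤-trans i≤n (ℕP.≤-trans (ℕP.≤-reflexive (ℕP.+-identityʳ (suc n))) n<M))))

    InRange : ℕ → Set
    InRange s = 1 ≤ s × s ≤ M

    unit-Γ𝔰 : ∀ ss → All InRange ss → Unit cls.⟦ Γ𝔰 ss ⟧
    unit-Γ𝔰 []           []                      = unit-≈ (sym cls.1-homo) unit-1
    unit-Γ𝔰 (suc n ∷ ss) ((_ , n<M) ∷ h) = unit-≈ (sym (cls.*-homo (ΓS n) (Γ𝔰 ss))) (unit-* (unit-ΓS n n<M) (unit-Γ𝔰 ss h))

    Γ*∑-inverse-powers : ∀ d n → d < M → n < M → ε.⟦_⟧ d (H n) * L⁻¹ d ^ suc n ≈ cls.⟦ ΓS n ⟧ * ∑ (vecs d) (λ v → b v ^ suc n)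
    Γ*∑-inverse-powers d n d<M n<M = begin
      ε.⟦_⟧ d (H n) * L⁻¹ d ^ suc n  ≈⟨ *-congʳ (ε-H d n d<M n<M) ⟩
      cls.⟦ ΓS n ⟧ * powerSum d n * L⁻¹ d ^ suc n  ≈⟨ *-assoc _ _ _ ⟩
      cls.⟦ ΓS n ⟧ * (powerSum d n * L⁻¹ d ^ suc n)  ≈⟨ *-congˡ (∑-*ʳ (vecs d) (L⁻¹ d ^ suc n) _) ⟩
      cls.⟦ ΓS n ⟧ * ∑ (vecs d) (λ v → (Lᴷ d * b v) ^ suc n * L⁻¹ d ^ suc n)  ≈⟨ *-congˡ (∑-cong (vecs d) cancel) ⟩
      cls.⟦ ΓS n ⟧ * ∑ (vecs d) (λ v → b v ^ suc n)  ∎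
      where
      cancel : ∀ v → (Lᴷ d * b v) ^ suc n * L⁻¹ d ^ suc n ≈ b v ^ suc n
      cancel v = trans (sym (^-distrib-* _ _ (suc n))) (^-congˡ (suc n) (begin
        Lᴷ d * b v * L⁻¹ d  ≈⟨ solve 3 (λ l b j → l :* b :* j := j :* l :* b) refl _ _ _ ⟩
        L⁻¹ d * Lᴷ d * b v  ≈⟨ *-congʳ (L⁻¹-inverse d d<M) ⟩
        1# * b v  ≈⟨ *-identityˡ _ ⟩
        b v  ∎))

    -- The sum over J of the theorem, with deg P replaced by a variable bound d that descends to the
    -- outermost index in the induction on depth.
    tupleSum : ℕ → List ℕ → Carrier
    tupleSum d ss = ∑ (tuples (map uCoeffs ss)) (λ ju → θᴷ ^ exponent ju * liᴷ d ss (map proj₂ ju))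

    -- The exponent of θ is additive in the components of 𝐣 and `liᴷ` splits along its outermost
    -- index i. Moving the sum over i outside factors the rest, and the sum over j_1 becomes the
    -- i-th twisted value of H_{s-1} by `ε-∑`.
    tupleSum-∷ : ∀ d s ss → tupleSum d (s ∷ ss) ≈ ∑ (upTo d) (λ i → ε.⟦_⟧ i (uCoeffs s) * L⁻¹ i ^ s * tupleSum i ss)
    tupleSum-∷ d s ss = begin
      tupleSum d (s ∷ ss)  ≈⟨ trans (∑-concatMap _ first) (∑-cong first (λ ju → ∑-map (ju ∷_) rest)) ⟩
      ∑ first (λ ju → ∑ rest (λ r → θᴷ ^ (proj₁ ju ℕ.+ exponent r) * ∑ (upTo d) (λ i → x i (proj₂ ju) * liᴷ i ss (map proj₂ r))))
        ≈⟨ ∑-cong first (λ ju → ∑-cong rest (λ r → trans (∑-*ˡ (upTo d) _ _) (∑-cong (upTo d) (λ i →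
             trans (*-congʳ (^-homo-* θᴷ (proj₁ ju) (exponent r))) (*-interchange _ _ _ _))))) ⟩
      ∑ first (λ ju → ∑ rest (λ r → ∑ (upTo d) (λ i → y i ju * z i r)))  ≈⟨ ∑-cong first (λ ju → ∑-swap rest (upTo d) _) ⟩
      ∑ first (λ ju → ∑ (upTo d) (λ i → ∑ rest (λ r → y i ju * z i r)))  ≈⟨ ∑-swap first (upTo d) _ ⟩
      ∑ (upTo d) (λ i → ∑ first (λ ju → ∑ rest (λ r → y i ju * z i r)))  ≈⟨ ∑-cong (upTo d) (λ i → trans (∑-cong first (λ ju → sym (∑-*ˡ rest (y i ju) (z i)))) (sym (∑-*ʳ first (∑ rest (z i)) (y i)))) ⟩
      ∑ (upTo d) (λ i → ∑ first (y i) * tupleSum i ss)  ≈⟨ ∑-cong (upTo d) (λ i → *-congʳ (collect i)) ⟩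
      ∑ (upTo d) (λ i → ε.⟦_⟧ i (uCoeffs s) * L⁻¹ i ^ s * tupleSum i ss)  ∎
      where
      first : List (ℕ × A)
      first = zip (upTo (length (uCoeffs s))) (uCoeffs s)
      rest : List (List (ℕ × A))
      rest = tuples (map uCoeffs ss)
      x : ℕ → A → Carrier
      x i u = cls.⟦ u ⟧ ^[ i ] * L⁻¹ i ^ s
      y : ℕ → ℕ × A → Carrier
      y i ju = θᴷ ^ proj₁ ju * x i (proj₂ ju)
      z : ℕ → List (ℕ × A) → Carrier
      z i r = θᴷ ^ exponent r * liᴷ i ss (map proj₂ r)
      collect : ∀ i → ∑ first (y i) ≈ ε.⟦_⟧ i (uCoeffs s) * L⁻¹ i ^ s
      collect i = trans (∑-cong first (λ ju → sym (*-assoc _ _ _))) (trans (sym (∑-*ʳ first (L⁻¹ i ^ s) _)) (*-congʳ (sym (ε-∑ i (uCoeffs s)))))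

    tupleSum≈Γ*zeta : ∀ ss → All InRange ss → ∀ d → d ≤ M → tupleSum d ss ≈ cls.⟦ Γ𝔰 ss ⟧ * zetaᴷ d ss
    tupleSum≈Γ*zeta []           []                d d≤M = trans (+-identityʳ _) (*-congʳ (sym cls.1-homo))
    tupleSum≈Γ*zeta (suc n ∷ ss) ((_ , n<M) ∷ hs) d d≤M = begin
      tupleSum d (suc n ∷ ss)  ≈⟨ tupleSum-∷ d (suc n) ss ⟩
      ∑ (upTo d) (λ i → ε.⟦_⟧ i (H n) * L⁻¹ i ^ suc n * tupleSum i ss)  ≈⟨ ∑-cong-∈ (upTo d) (λ {i} i∈ → level i (ℕP.<-≤-trans (∈P.∈-upTo⁻ i∈) d≤M)) ⟩
      ∑ (upTo d) (λ i → cls.⟦ Γ𝔰 (suc n ∷ ss) ⟧ * ∑ (vecs i) (λ v → b v ^ suc n * zetaᴷ i ss))  ≈⟨ ∑-*ˡ (upTo d) _ _ ⟨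
      cls.⟦ Γ𝔰 (suc n ∷ ss) ⟧ * zetaᴷ d (suc n ∷ ss)  ∎
      where
      level : ∀ i → i < M → ε.⟦_⟧ i (H n) * L⁻¹ i ^ suc n * tupleSum i ss
                          ≈ cls.⟦ Γ𝔰 (suc n ∷ ss) ⟧ * ∑ (vecs i) (λ v → b v ^ suc n * zetaᴷ i ss)
      level i i<M = begin
        ε.⟦_⟧ i (H n) * L⁻¹ i ^ suc n * tupleSum i ss  ≈⟨ *-cong (Γ*∑-inverse-powers i n i<M n<M) (tupleSum≈Γ*zeta ss hs i (ℕP.<⇒≤ i<M)) ⟩
        cls.⟦ ΓS n ⟧ * S * (cls.⟦ Γ𝔰 ss ⟧ * zetaᴷ i ss)  ≈⟨ *-interchange _ _ _ _ ⟩
        cls.⟦ ΓS n ⟧ * cls.⟦ Γ𝔰 ss ⟧ * (S * zetaᴷ i ss)  ≈⟨ *-cong (sym (cls.*-homo (ΓS n) (Γ𝔰 ss))) (∑-*ʳ (vecs i) (zetaᴷ i ss) _) ⟩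
        cls.⟦ Γ𝔰 (suc n ∷ ss) ⟧ * ∑ (vecs i) (λ v → b v ^ suc n * zetaᴷ i ss)  ∎
        where
        S : Carrier
        S = ∑ (vecs i) (λ v → b v ^ suc n)

-- Quotient rings.

module Quotient (R : CommutativeRing 0ℓ 0ℓ) (p : CommutativeRing.Carrier R) where
  open Tools R

  infix 4 _≡ₚ_
  -- A congruence with explicit multiple on the unchanged carrier: the ring laws are inherited
  -- through `lift≈`, and the quotient map is the identity.
  record _≡ₚ_ (x y : Carrier) : Set where
    constructor by
    field
      multiple : Carrier
      equation : x ≈ y + multiple * p
  open _≡ₚ_ public

  lift≈ : ∀ {x y} → x ≈ y → x ≡ₚ y
  lift≈ {x} {y} e = by 0# (trans e (solve 2 (λ y p → y := y :+ :0# :* p) refl y p))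

  quotientRing : CommutativeRing 0ℓ 0ℓ
  quotientRing = record
    { Carrier = Carrier
    ; _≈_ = _≡ₚ_
    ; _+_ = _+_
    ; _*_ = _*_
    ; -_  = -_
    ; 0#  = 0#
    ; 1#  = 1#
    ; isCommutativeRing = record
      { isRing = record
        { +-isAbelianGroup = record
          { isGroup = record
            { isMonoid = record
              { isSemigroup = record
                { isMagma = record
                  { isEquivalence = record
                    { refl = lift≈ refl
                    ; sym = λ { {x} {y} (by w e) → by (- w) (trans (solve 3 (λ y w p → y := (y :+ w :* p) :+ (:- w) :* p) refl y w p) (+-congʳ (sym e))) }
                    ; trans = λ { {x} {y} {z} (by w e) (by v e′) → by (v + w) (trans e (trans (+-congʳ e′) (solve 4 (λ z v w p → (z :+ v :* p) :+ w :* p := z :+ (v :+ w) :* p) refl z v w p))) }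
                    }
                  ; ∙-cong = λ { {x} {x′} {y} {y′} (by w e) (by v e′) → by (w + v) (trans (+-cong e e′)
                      (solve 5 (λ x y w v p → (x :+ w :* p) :+ (y :+ v :* p) := (x :+ y) :+ (w :+ v) :* p) refl x′ y′ w v p)) }
                  }
                ; assoc = λ x y z → lift≈ (+-assoc x y z)
                }
              ; identity = (λ x → lift≈ (+-identityˡ x)) , (λ x → lift≈ (+-identityʳ x))
              }
            ; inverse = (λ x → lift≈ (-‿inverseˡ x)) , (λ x → lift≈ (-‿inverseʳ x))
            ; ⁻¹-cong = λ { {x} {y} (by w e) → by (- w) (trans (-‿cong e) (solve 3 (λ y w p → :- (y :+ w :* p) := :- y :+ (:- w) :* p) refl y w p)) }
            }
          ; comm = λ x y → lift≈ (+-comm x y)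
          }
        ; *-cong = λ { {x} {x′} {y} {y′} (by w e) (by v e′) → by (x′ * v + w * y′ + w * v * p) (trans (*-cong e e′)
            (solve 5 (λ x y w v p → (x :+ w :* p) :* (y :+ v :* p) := (x :* y) :+ (x :* v :+ w :* y :+ w :* v :* p) :* p) refl x′ y′ w v p)) }
        ; *-assoc = λ x y z → lift≈ (*-assoc x y z)
        ; *-identity = (λ x → lift≈ (*-identityˡ x)) , (λ x → lift≈ (*-identityʳ x))
        ; distrib = (λ x y z → lift≈ (distribˡ x y z)) , (λ x y z → lift≈ (distribʳ x y z))
        }
      ; *-comm = λ x y → lift≈ (*-comm x y)
      }
    }

  quotientHom : Hom R quotientRing
  quotientHom = record
    { ⟦_⟧     = id
    ; ⟦⟧-cong = lift≈
    ; +-homo  = λ _ _ → lift≈ refl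
    ; *-homo  = λ _ _ → lift≈ refl
    ; 1-homo  = lift≈ refl
    }

-- Arithmetic modulo an irreducible polynomial P.

module Residues (F : FiniteField) where
  open PolynomialsOverFq F
  open FiniteFieldTheory F using (unit-≢0)
  open Setup F hiding (q)
  open FiniteField F using (_≟_; 0≢1; complete) renaming (Carrier to 𝔽; 0# to 0ᶠ; 1# to 1ᶠ)
  open Rearrangements ringA
  private
    module PR = Tools ringA
    module K = Tools fieldRing

  ≈⇒norm≡ : ∀ p r → p PR.≈ r → PA.norm p ≡ PA.norm r
  ≈⇒norm≡ []      r       e = ≡.sym (𝔸Div.norm≡[] r (allᵀ r) (PR.sym e))
  ≈⇒norm≡ (a ∷ p) []      e = 𝔸Div.norm≡[] (a ∷ p) (allᵀ (a ∷ p)) e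
  ≈⇒norm≡ (a ∷ p) (b ∷ r) e = ≡.trans (𝔸.norm-∷ a p) (≡.trans
    (≡.cong₂ 𝔸.cons (𝔸.coeff-≈ e 0) (≈⇒norm≡ p r (𝔸.coeffs≈ (λ n → 𝔸.coeff-≈ e (suc n))))) (≡.sym (𝔸.norm-∷ b r)))

  normal-≡ : ∀ {p r} → Normal p → Normal r → p PR.≈ r → p ≡ r
  normal-≡ {p} {r} np nr e = ≡.trans (≡.sym np) (≡.trans (≈⇒norm≡ p r e) nr)

  ++-zeros : ∀ p k → p ++ replicate k 0ᶠ PR.≈ p
  ++-zeros []      k = 𝔸.replicate-≈0 k
  ++-zeros (a ∷ p) k = 𝔸.∷-cong ≡.refl (++-zeros p k)

  ∈-vecs : ∀ v → v ∈ vecs (length v)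
  ∈-vecs []      = here ≡.refl
  ∈-vecs (c ∷ v) = ∈P.∈-concatMap⁺ (λ c → map (c ∷_) (vecs (length v))) (lose (complete c) (∈P.∈-map⁺ (c ∷_) (∈-vecs v)))

  -- `vecs` lists vectors of full length, so r is found as the normal form of its padding by zeros.
  normal∈residues : ∀ M r → Normal r → length r ≤ M → r ∈ map PA.norm (vecs M)
  normal∈residues M r nr r≤M = ≡.subst (_∈ map PA.norm (vecs M)) (≡.trans (≈⇒norm≡ padded r (++-zeros r (M ∸ length r))) nr)
    (∈P.∈-map⁺ PA.norm (≡.subst (λ n → padded ∈ vecs n) padded-length (∈-vecs padded)))
    where
    padded : A
    padded = r ++ replicate (M ∸ length r) 0ᶠ
    padded-length : length padded ≡ M
    padded-length = ≡.trans (LP.length-++ r) (≡.trans (≡.cong (length r ℕ.+_) (LP.length-replicate (M ∸ length r))) (ℕP.m+[n∸m]≡n r≤M))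

  split-last : ∀ n (p : A) → length p ≡ suc n → ∃ λ v → p ≡ v ++ [ 𝔸.coeff p n ] × length v ≡ n
  split-last zero    (c ∷ [])     _ = [] , ≡.refl , ≡.refl
  split-last (suc n) (c ∷ d ∷ p) e with split-last n (d ∷ p) (ℕP.suc-injective e)
  ... | v , e′ , l = c ∷ v , ≡.cong (c ∷_) e′ , ≡.cong suc l

  coeff-∷ʳ : ∀ v c → 𝔸.coeff (v ++ [ c ]) (length v) ≡ c
  coeff-∷ʳ []      c = ≡.refl
  coeff-∷ʳ (a ∷ v) c = coeff-∷ʳ v c

  coeff-singleton-⊗ : ∀ c a n → 𝔸.coeff ([ c ] PA.⊗ a) n ≡ c K.* 𝔸.coeff a n
  coeff-singleton-⊗ c a zero    = 𝔸.coeff-⊗ [ c ] a 0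
  coeff-singleton-⊗ c a (suc n) = ≡.trans (𝔸.coeff-∷-⊗ c [] a n) (K.+-identityʳ _)

  coeff-const-⊗ : ∀ c a n → 𝔸.coeff (PA.const c PA.⊗ a) n ≡ c K.* 𝔸.coeff a n
  coeff-const-⊗ c a n = ≡.trans (𝔸.coeff-≈ (PR.*-congʳ {a} (𝔸.norm-≈ [ c ])) n) (coeff-singleton-⊗ c a n)

  module Prime (P : A) (irreducible : Irreducible P) where
    open ModP P renaming (Σ to Σₚ)

    M : ℕ
    M = PA.deg P

    P-normal : Normal P
    P-normal = proj₁ (proj₁ irreducible)

    1≤M : 1 ≤ M
    1≤M = proj₁ (proj₂ irreducible)

    length-P : length P ≡ suc M
    -- `deg` is a truncated difference, which confuses lengths 0 and 1; a degree of at least 1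
    -- leaves only lengths from 2 on.
    length-P with length (PA.norm P) in e | 1≤M
    ... | suc (suc m) | _ = ≡.trans (≡.cong length (≡.sym P-normal)) e

    leading-P : 𝔸.coeff P M ≡ 1ᶠ
    leading-P = ≡.trans (≡.cong (λ n → 𝔸.coeff P (n ∸ 1)) (≡.sym length-P)) (≡.trans (≡.sym (𝔸Div.last-coeff P))
      (≡.trans (≡.cong 𝔸Div.last (≡.sym P-normal)) (≡.trans (≡.sym (𝔸Div.lead≡last P)) (proj₂ (proj₁ irreducible)))))

    P∈monics : P ∈ monics M
    P∈monics with split-last M P length-P
    ... | v , e , l = ≡.subst₂ (λ p n → p ∈ monics n) (≡.sym (≡.trans e (≡.cong (λ c → v ++ [ c ]) leading-P))) l
                        (∈P.∈-map⁺ (_++ [ 1ᶠ ]) (∈-vecs v))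

    open Quotient ringA P using (_≡ₚ_; by; lift≈; quotientRing; quotientHom)
    private
      module A/P = Tools quotientRing
      module Div = 𝔸Div.Divisor P M length-P leading-P

    module Rem x = 𝔸Div.Divisor.IsRemainder (Div.divMod-spec x (allᵀ x))

    red≡ : ∀ x → red x ≡ₚ x
    red≡ x = by (PA.neg (PA.quot x P)) (PR.trans (subtract-product (PA.quot x P) P (red x))
      (PR.+-congʳ {PA.neg (PA.quot x P) PA.⊗ P} (PR.sym (Rem.identity x))))

    ≡ₚ⇒≈P : ∀ {x y} → x ≡ₚ y → x ≈P y
    ≡ₚ⇒≈P {x} {y} (by w e) = Div.modP-zero (x PA.⊖ y) w (allᵀ _)
      (PR.trans (PR.+-congʳ {PA.neg y} e) ([y+z]-y≈z y (w PA.⊗ P)))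

    -- The difference of two remainders is a multiple of P without coefficients from degree M on, so
    -- the multiplier is zero; normal forms that agree as polynomials agree as lists.
    red-injective : ∀ x y → red x ≡ₚ red y → red x ≡ red y
    red-injective x y (by z e) = normal-≡ (Rem.normal x) (Rem.normal y)
      (PR.trans e (PR.trans (PR.+-congˡ {red y} (PR.*-congʳ {P} {z} {[]} z≈0)) (PR.+-identityʳ (red y))))
      where
      difference : z PA.⊗ P PR.≈ red x PA.⊖ red y
      difference = PR.trans (PR.sym ([y+z]-y≈z (red y) (z PA.⊗ P))) (PR.+-congʳ {PA.neg (red y)} (PR.sym e))
      beyond : ∀ n → M ≤ n → 𝔸.coeff (red x PA.⊖ red y) n ≡ 0ᶠ
      beyond n M≤n = ≡.trans (𝔸.coeff-⊕ (red x) (PA.neg (red y)) n) (≡.trans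
        (≡.cong₂ K._+_ (𝔸Div.coeff-beyond (red x) (ℕP.≤-trans (Rem.small x) M≤n))
                       (≡.trans (𝔸.coeff-neg (red y) n) (≡.cong K.-_ (𝔸Div.coeff-beyond (red y) (ℕP.≤-trans (Rem.small y) M≤n)))))
        (K.-‿inverseʳ 0ᶠ))
      z≈0 : z PR.≈ []
      z≈0 = Div.quotient-zero z (λ n M≤n → ≡.trans (𝔸.coeff-≈ difference n) (beyond n M≤n))

    red-cong : ∀ x y → x ≡ₚ y → red x ≡ red y
    red-cong x y e = red-injective x y (A/P.trans (red≡ x) (A/P.trans e (A/P.sym (red≡ y))))

    mutual
      search : A → List A → A
      search = _

      -- Unification recovers the search local to `inv`, once the list of residues has been
      -- abstracted to a variable.
      inv-search : ∀ a → inv a ≡ search a residues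
      inv-search a with residues
      ... | bs = ≡.refl

    -- The search may stop before reaching b, but whatever it returns has passed the test; b only
    -- guarantees that it does not run off the end.
    search-inverse : ∀ a {b} bs → b ∈ bs → b · a ≡ red PA.oneP → search a bs · a ≡ red PA.oneP
    search-inverse a {b} (c ∷ bs) b∈ e = test (LP.≡-dec _≟_ (c · a) (red PA.oneP)) b∈
      where
      test : ∀ (c? : Dec (c · a ≡ red PA.oneP)) → b ∈ c ∷ bs → (if does c? then c else search a bs) · a ≡ red PA.oneP
      test (yes e′) _             = e′
      test (no c≢)  (here ≡.refl) = ⊥-elim (c≢ e)
      test (no c≢)  (there b∈)    = search-inverse a bs b∈ e

    inv-inverse : ∀ a → A/P.Unit a → inv a PA.⊗ a ≡ₚ PA.oneP
    inv-inverse a (z , e) = A/P.trans (A/P.sym (red≡ (inv a PA.⊗ a))) (A/P.trans (A/P.reflexive found) (red≡ PA.oneP))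
      where
      found : inv a · a ≡ red PA.oneP
      found = ≡.subst (λ b → b · a ≡ red PA.oneP) (≡.sym (inv-search a))
        (search-inverse a residues (normal∈residues M (red z) (Rem.normal z) (Rem.small z))
          (red-cong (red z PA.⊗ a) PA.oneP (A/P.trans (A/P.*-congʳ {a} (red≡ z)) e)))

    -- Induction on the degree n. Scale a to a monic a′ and divide: P = Q a′ + r. Irreducibility
    -- rules out r = 0 when n ≥ 1, so r is a nonzero polynomial of smaller degree and a unit by
    -- induction; modulo P it equals -Q a′, hence a′ is a unit. For n = 0, a′ = 1.
    unit-nonzero : ∀ n a → Normal a → length a ≡ suc n → n < M → A/P.Unit a
    unit-nonzero = <-rec (λ n → ∀ a → Normal a → length a ≡ suc n → n < M → A/P.Unit a) go
      where
      go : ∀ n → (∀ {m} → m < n → ∀ a → Normal a → length a ≡ suc m → m < M → A/P.Unit a) →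
           ∀ a → Normal a → length a ≡ suc n → n < M → A/P.Unit a
      go n rec a na la n<M = A/P.unit-factorʳ {PA.const c⁻¹} {a} (unit-a′ n ≡.refl)
        where
        c≢0 : 𝔸.coeff a n ≢ 0ᶠ
        c≢0 c≡0 = ℕP.<-irrefl ≡.refl (ℕP.≤-trans (ℕP.≤-reflexive (≡.trans (≡.sym la) (≡.cong length (≡.sym na)))) (𝔸Div.length-norm n a (allᵀ a) beyond))
          where
          beyond : ∀ k → n ≤ k → 𝔸.coeff a k ≡ 0ᶠ
          beyond k n≤k with ℕP.m≤n⇒m<n∨m≡n n≤k
          ... | inj₁ n<k    = 𝔸Div.coeff-beyond a (ℕP.≤-trans (ℕP.≤-reflexive la) n<k)
          ... | inj₂ ≡.refl = c≡0
        c⁻¹ : 𝔽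
        c⁻¹ = proj₁ (unit-≢0 c≢0)
        a′ : A
        a′ = PA.const c⁻¹ PA.⊗ a
        leading : 𝔸.coeff a′ n ≡ 1ᶠ
        leading = ≡.trans (coeff-const-⊗ c⁻¹ a n) (proj₂ (unit-≢0 c≢0))
        beyond : ∀ k → n < k → 𝔸.coeff a′ k ≡ 0ᶠ
        beyond k n<k = ≡.trans (coeff-const-⊗ c⁻¹ a k) (≡.trans (≡.cong (c⁻¹ K.*_) (𝔸Div.coeff-beyond a (ℕP.≤-trans (ℕP.≤-reflexive la) n<k))) (K.zeroʳ c⁻¹))
        a′-normal : Normal a′
        a′-normal = 𝔸Div.norm-idem (𝔸.mulRaw (PA.const c⁻¹) a)
        length-a′ : length a′ ≡ suc n
        length-a′ = 𝔸Div.length-exact a′ n a′-normal (allᵀ a′) beyond (λ e → 0≢1 (≡.trans (≡.sym e) leading))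
        module Div′ = 𝔸Div.Divisor a′ n length-a′ leading

        P≉Q*a′ : ∀ Q → 1 ≤ n → ¬ (P PR.≈ Q PA.⊗ a′)
        P≉Q*a′ Q 1≤n e with proj₂ (proj₂ irreducible) Q a′ (normal-≡ (𝔸Div.norm-idem (𝔸.mulRaw Q a′)) P-normal (PR.sym e))
        ... | inj₂ deg-a′≡0 = ℕP.<-irrefl (≡.trans (≡.sym deg-a′≡0) (≡.cong (ℕ._∸ 1) (≡.trans (≡.cong length a′-normal) length-a′))) 1≤n
        ... | inj₁ deg-Q≡0 = 0≢1 (≡.trans (≡.sym (constant (PA.norm Q) deg-Q≡0)) (≡.trans (≡.sym (𝔸.coeff-≈ e′ M)) leading-P))
          where
          e′ : P PR.≈ PA.norm Q PA.⊗ a′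
          e′ = PR.trans e (PR.*-congʳ {a′} (PR.sym (𝔸.norm-≈ Q)))
          constant : ∀ s → length s ∸ 1 ≡ 0 → 𝔸.coeff (s PA.⊗ a′) M ≡ 0ᶠ
          constant []      _ = ≡.refl
          constant (c ∷ []) _ = ≡.trans (coeff-singleton-⊗ c a′ M) (≡.trans (≡.cong (c K.*_) (beyond M n<M)) (K.zeroʳ c))

        unit-remainder : ∀ Q r → P PR.≈ Q PA.⊗ a′ PA.⊕ r → A/P.Unit r → A/P.Unit a′
        unit-remainder Q r e u = A/P.unit-factorʳ {PA.neg Q} {a′} (A/P.unit-≈ {r} {PA.neg Q PA.⊗ a′} r≡-Qa′ u)
          where
          r≡-Qa′ : r ≡ₚ PA.neg Q PA.⊗ a′
          r≡-Qa′ = by PA.oneP (PR.trans (isolate-remainder Q a′ r) (PR.+-congˡ {PA.neg Q PA.⊗ a′} (PR.*-congˡ {PA.oneP} (PR.sym e))))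

        unit-a′ : ∀ k → n ≡ k → A/P.Unit a′
        unit-a′ zero    ≡.refl = A/P.unit-≈ {PA.oneP} {a′} (lift≈ (PR.sym (PR.trans (𝔸.coeffs≈ λ { zero → leading ; (suc k) → beyond (suc k) (s≤s z≤n) }) (PR.sym (𝔸.norm-≈ [ 1ᶠ ])))))
                                              (A/P.unit-1)
        unit-a′ (suc m) ≡.refl = from-remainder (PA.quot P a′) (P PA.modP a′) (Div′.divMod-spec P (allᵀ P))
          where
          from-remainder : ∀ Q r → Div′.IsRemainder P Q r → A/P.Unit a′
          from-remainder Q []      (Div′.remainder e _ _ _) = ⊥-elim (P≉Q*a′ Q (s≤s z≤n) (PR.trans e (PR.+-identityʳ (Q PA.⊗ a′))))
          from-remainder Q (x ∷ r) (Div′.remainder e small normal _) =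
            -- The remainder has degree `length r`, and `small` says precisely that this is below n.
            unit-remainder Q (x ∷ r) e (rec small (x ∷ r) normal ≡.refl (ℕP.<-trans small n<M))

    unit-monic : ∀ v → length v < M → A/P.Unit (v ++ [ 1ᶠ ])
    unit-monic v v<M = A/P.unit-≈ {PA.norm a} {a} (lift≈ (𝔸.norm-≈ a)) (unit-nonzero (length v) (PA.norm a) (𝔸Div.norm-idem a) length-norm v<M)
      where
      a : A
      a = v ++ [ 1ᶠ ]
      length-a : length a ≡ suc (length v)
      length-a = ≡.trans (LP.length-++ v) (ℕP.+-comm (length v) 1)
      length-norm : length (PA.norm a) ≡ suc (length v)
      length-norm = 𝔸Div.length-exact (PA.norm a) (length v) (𝔸Div.norm-idem a) (allᵀ (PA.norm a))
        (λ k l<k → ≡.trans (𝔸.coeff-norm a k) (𝔸Div.coeff-beyond a (ℕP.≤-trans (ℕP.≤-reflexive length-a) l<k)))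
        (λ e → 0≢1 (≡.trans (≡.sym e) (≡.trans (𝔸.coeff-norm a (length v)) (coeff-∷ʳ v 1ᶠ))))

    module Spec = Specialization F quotientRing quotientHom

    b : List 𝔽 → A
    b v = inv (v ++ [ 1ᶠ ])

    b-inverse : ∀ v → length v < M → b v PA.⊗ (Spec.θᴷ A/P.^ length v PA.⊕ Spec.evalᴷ v) ≡ₚ PA.oneP
    b-inverse v v<M = A/P.trans (A/P.*-congˡ {b v} (Spec.evalᴷ-monic v)) (inv-inverse (v ++ [ 1ᶠ ]) (unit-monic v v<M))

    -- `liB` inverts L_i by search, so the searched inverse is what `Sums` receives; the unit
    -- property from `Values` shows that the search succeeds.
    L⁻¹-inverse : ∀ i → i < M → inv (L i) PA.⊗ L i ≡ₚ PA.oneP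
    L⁻¹-inverse i i<M = inv-inverse (L i) (Spec.Values.unit-L M b b-inverse i i<M)

    open PolylogarithmSums F quotientRing quotientHom using (module Sums; exponent)
    open Sums M b b-inverse (λ i → inv (L i)) L⁻¹-inverse

    pow≡ : ∀ x n → pow x n ≡ₚ x A/P.^ n
    pow≡ x zero    = red≡ PA.oneP
    pow≡ x (suc n) = A/P.trans (red≡ (x PA.⊗ pow x n)) (A/P.*-congˡ {x} (pow≡ x n))

    ·≡ : ∀ x {x′} y {y′} → x ≡ₚ x′ → y ≡ₚ y′ → x · y ≡ₚ x′ PA.⊗ y′
    ·≡ x y e e′ = A/P.trans (red≡ (x PA.⊗ y)) (A/P.*-cong e e′)

    Σₚ≡ : ∀ xs → Σₚ xs ≡ₚ A/P.∑ xs id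
    Σₚ≡ xs = A/P.trans (red≡ (PA.sumP xs)) (A/P.foldr≈∑ xs)

    Σₚ-map≡ : ∀ {X : Set} (f : X → A) xs → Σₚ (map f xs) ≡ₚ A/P.∑ xs f
    Σₚ-map≡ f xs = A/P.trans (Σₚ≡ (map f xs)) (A/P.∑-map f xs)

    zetaB≡ : ∀ d ss → zetaB d ss ≡ₚ zetaᴷ d ss
    zetaB≡ d []       = red≡ PA.oneP
    zetaB≡ d (s ∷ ss) = A/P.trans (Σₚ≡ (concatMap slice (upTo d))) (A/P.trans (A/P.∑-concatMap slice (upTo d)) (A/P.∑-cong (upTo d) level))
      where
      term : ℕ → A → A
      term i a = pow (inv a) s · zetaB i ss
      slice : ℕ → List A
      slice i = map (term i) (monics i)
      level : ∀ i → A/P.∑ (slice i) id ≡ₚ A/P.∑ (vecs i) (λ v → b v A/P.^ s PA.⊗ zetaᴷ i ss)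
      level i = A/P.trans (A/P.∑-map (term i) (monics i)) (A/P.trans (A/P.∑-map (_++ [ 1ᶠ ]) (vecs i))
        (A/P.∑-cong (vecs i) (λ v → ·≡ (pow (b v) s) (zetaB i ss) (pow≡ (b v) s) (zetaB≡ i ss))))

    liB≡ : ∀ d ss us → liB d ss us ≡ₚ liᴷ d ss us
    liB≡ d []       us       = red≡ PA.oneP
    liB≡ d (s ∷ ss) []       = A/P.refl
    liB≡ d (s ∷ ss) (u ∷ us) = A/P.trans (Σₚ-map≡ term (upTo d)) (A/P.∑-cong (upTo d) λ i →
      ·≡ (pow u (q ℕ.^ i) · pow (inv (L i)) s) (liB i ss us)
         (·≡ (pow u (q ℕ.^ i)) (pow (inv (L i)) s) (pow≡ u (q ℕ.^ i)) (pow≡ (inv (L i)) s)) (liB≡ i ss us))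
      where
      term : ℕ → A
      term i = (pow u (q ℕ.^ i) · pow (inv (L i)) s) · liB i ss us

    zeta≈rhs : ∀ ss → All InRange ss → zeta ss ≈P rhs ss
    zeta≈rhs ss h = ≡ₚ⇒≈P (A/P.trans (zetaB≡ M ss) (A/P.sym (A/P.trans rhs≡ (A/P.trans
        (A/P.*-congˡ {inv (Γ𝔰 ss)} (tupleSum≈Γ*zeta ss h M ℕP.≤-refl)) (cancel (inv (Γ𝔰 ss)) (Γ𝔰 ss) (zetaᴷ M ss) (inv-inverse (Γ𝔰 ss) (unit-Γ𝔰 ss h)))))))
      where
      term : List (ℕ × A) → A
      term ju = pow θ (exponent ju) · Li ss (map proj₂ ju)
      js : List (List (ℕ × A))
      js = tuples (map uCoeffs ss)
      rhs≡ : rhs ss ≡ₚ inv (Γ𝔰 ss) PA.⊗ tupleSum M ss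
      rhs≡ = ·≡ (inv (Γ𝔰 ss)) (Σₚ (map term js)) A/P.refl (A/P.trans (Σₚ-map≡ term js)
        (A/P.∑-cong js (λ ju → ·≡ (pow θ (exponent ju)) (Li ss (map proj₂ ju)) (pow≡ θ (exponent ju)) (liB≡ M ss (map proj₂ ju)))))
      cancel : ∀ x y z → x PA.⊗ y ≡ₚ PA.oneP → x PA.⊗ (y PA.⊗ z) ≡ₚ z
      cancel x y z e = A/P.trans (A/P.sym (A/P.*-assoc x y z)) (A/P.trans (A/P.*-congʳ {z} e) (A/P.*-identityˡ z))

  -- The finite set of exceptional primes.

  s≤sum : ∀ {s} ss → s ∈ ss → s ≤ foldr ℕ._+_ 0 ss
  s≤sum (s ∷ ss) (here ≡.refl) = ℕP.m≤m+n s _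
  s≤sum (s ∷ ss) (there s∈)    = ℕP.≤-trans (s≤sum ss s∈) (ℕP.m≤n+m _ s)

theorem3p3 : (F : FiniteField) → let open Setup F in
    (𝔰 : List ℕ) → 1 ≤ length 𝔰 → All (1 ≤_) 𝔰 →
    Σ (List A) λ S → (P : A) → Irreducible P → P ∉ S →
    let open ModP P in zeta 𝔰 ≈P rhs 𝔰
-- The exceptions are covered by the monic polynomials of degree below s_1 + ... + s_r. A prime
-- outside this list has degree at least the sum, hence at least every s_i, as `InRange` demands.
theorem3p3 F 𝔰 _ positive = concatMap monics (upTo weight) , λ P irreducible P∉ →
  Prime.zeta≈rhs P irreducible 𝔰 (All.tabulate λ {s} s∈ →
    All.lookup positive s∈ , ℕP.≤-trans (s≤sum 𝔰 s∈) (ℕP.≮⇒≥ λ small →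
      P∉ (∈P.∈-concatMap⁺ monics (lose (∈P.∈-upTo⁺ small) (Prime.P∈monics P irreducible)))))
  where
  open Setup F
  open Residues F
  weight : ℕ
  weight = foldr ℕ._+_ 0 𝔰
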